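{- Every bridgeless cubic graph with $n\ge 4$ vertices and with an embedding in a surface of Euler characteristic $\chi$ with representativity at least $4$ has at least $2^{\sqrt[3]{n+2\chi}/100}$ circuit double covers.
   Context: Graphs are finite and may have parallel edges. A circuit is a connected 2-regular subgraph (a subgraph isomorphic to $C_k$ for some $k$; two parallel edges form a circuit $C_2$). A circuit double cover of a graph $G$ is a multiset of circuits of $G$ such that every edge of $G$ is contained in exactly two elements of the multiset (counted with multiplicity). A simple closed curve which does not split the surface into two parts is called noncontractible. Given an embedding of a graph into a surface which is not a sphere, the representativity of this embedding is the minimal number of points of the embedding that any closed noncontractible curve must intersect.
   Formalization: The graph is taken to be connected and its embedding cellular (every face a disc); for disconnected graphs the claim fails, since adding disjoint two-vertex three-edge graphs inside a face raises n without adding circuit double covers. The sphere is included, with no representativity condition. -}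

module Defs where

open import Data.Bool using (Bool; true; false; not; if_then_else_)
open import Data.Fin using (Fin; toℕ)
import Data.Fin as Fin
open import Data.Fin.Subset using (Subset; _∈_; _∩_; ∣_∣; Nonempty)
open import Data.Fin.Subset.Properties using (_∈?_)
open import Data.Integer as ℤ using (ℤ; +_)
open import Data.List using (List; length; filter)
open import Data.List.Relation.Unary.All using (All)
open import Data.List.Relation.Unary.AllPairs using (AllPairs)
open import Data.List.Relation.Binary.Permutation.Propositional using (_↭_)
open import Data.Nat using (ℕ; suc; NonZero; _≤_; _*_; _^_)
open import Data.Nat.DivMod using (_mod_)
open import Data.Product using (_×_; _,_; proj₁; ∃-syntax)
open import Data.Sum using (_⊎_; inj₁; inj₂)
open import Data.Vec using (tabulate)
open import Function using (_↔_; _⇔_; _∘_; Inverse; Injective; Surjective)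
open import Relation.Binary.Construct.Closure.Equivalence using (EqClosure)
open import Relation.Binary.Construct.Closure.ReflexiveTransitive using (Star)
open import Relation.Binary.PropositionalEquality using (_≡_; _≢_)
open import Relation.Nullary using (¬_; does; _⊎-dec_)

-- Finite multigraphs on n vertices: parallel edges allowed, no loops.
-- The direction src → tgt of an edge is only bookkeeping.
record Graph (n : ℕ) : Set where
  field
    m        : ℕ
    src tgt  : Fin m → Fin n
    loopless : ∀ e → src e ≢ tgt e

module _ {n : ℕ} (G : Graph n) where
  open Graph G

  incident : Fin n → Subset m
  incident v = tabulate λ e → does ((src e Fin.≟ v) ⊎-dec (tgt e Fin.≟ v))

  Cubic : Set
  Cubic = ∀ v → ∣ incident v ∣ ≡ 3

  -- u and v are joined by a path all of whose edges satisfy P.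
  JoinedBy : (Fin m → Set) → Fin n → Fin n → Set
  JoinedBy P = EqClosure λ u v → ∃[ e ] (P e × src e ≡ u × tgt e ≡ v)

  -- Deleting e separates its two ends.
  IsBridge : Fin m → Set
  IsBridge e = ¬ JoinedBy (_≢ e) (src e) (tgt e)

  Bridgeless : Set
  Bridgeless = ∀ e → ¬ IsBridge e

  -- Candidate subgraphs; being closed under taking ends of edges is part of
  -- IsCircuit, so that propositional equality here is equality of subgraphs.
  record Subgraph : Set where
    constructor subgraph
    field
      vertices : Subset n
      edges    : Subset m

  open Subgraph

  record IsCircuit (H : Subgraph) : Set where
    field
      ends-in   : ∀ e → e ∈ edges H → src e ∈ vertices H × tgt e ∈ vertices H
      nonempty  : Nonempty (vertices H)
      connected : ∀ u v → u ∈ vertices H → v ∈ vertices H →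
                  JoinedBy (_∈ edges H) u v
      2-regular : ∀ v → v ∈ vertices H → ∣ incident v ∩ edges H ∣ ≡ 2

  -- Lists stand for multisets: they are compared up to _↭_ below.
  record IsCircuitDoubleCover (C : List Subgraph) : Set where
    field
      circuits     : All IsCircuit C
      double-cover : ∀ e → length (filter (λ H → e ∈? edges H) C) ≡ 2

  -- Ds enumerates, without repetition, some circuit double covers of G.
  record DistinctCircuitDoubleCovers (Ds : List (List Subgraph)) : Set where
    field
      all-covers : All IsCircuitDoubleCover Ds
      distinct   : AllPairs (λ C D → ¬ (C ↭ D)) Ds

  -- Half-edges; (e , false) sits at src e and (e , true) at tgt e.
  Dart : Set
  Dart = Fin m × Bool

  tail : Dart → Fin n
  tail (e , false) = src e
  tail (e , true)  = tgt e

  -- The triangles of the barycentric subdivision of the embedding.  With d⁺ the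
  -- successor of d in the rotation at tail d, the flag (d , false) is the one
  -- at d on the side of d⁺, and (d , true) the one on the opposite side of d.
  Flag : Set
  Flag = Dart × Bool

  -- A cyclic order of the darts at every vertex and, for every edge, whether the
  -- local orientations at its ends disagree along it.  Gluing a disc along each
  -- facial walk gives a closed surface, orientable or not.
  record Scheme : Set where
    field
      rotation        : Dart ↔ Dart
      rotation-tail   : ∀ d → tail (Inverse.to rotation d) ≡ tail d
      rotation-cyclic : ∀ d d′ → tail d ≡ tail d′ →
                        Star (λ a b → Inverse.to rotation a ≡ b) d d′
      twisted         : Fin m → Bool

    -- The three neighbours of a triangle: τ₀ keeps edge and face, τ₁ keeps
    -- vertex and face, τ₂ keeps vertex and edge.
    τ₀ τ₁ τ₂ : Flag → Flag
    τ₀ ((e , b) , s) = (e , not b) , (if twisted e then s else not s)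
    τ₁ (d , false)   = Inverse.to rotation d , true
    τ₁ (d , true)    = Inverse.from rotation d , false
    τ₂ (d , s)       = d , not s

  -- A 2-cell embedding of G in a connected closed surface.  The faces are the
  -- orbits of flags under τ₀ and τ₁, numbered by Fin φ.
  record Embedding : Set where
    field
      scheme : Scheme

    open Scheme scheme public

    field
      φ               : ℕ
      face            : Flag → Fin φ
      face-surjective : Surjective _≡_ _≡_ face
      face-orbits     : ∀ x y → face x ≡ face y ⇔
                        EqClosure (λ a b → τ₀ a ≡ b ⊎ τ₁ a ≡ b) x y
      connected       : ∀ x y →
                        EqClosure (λ a b → τ₀ a ≡ b ⊎ τ₁ a ≡ b ⊎ τ₂ a ≡ b) x y

  module _ (M : Embedding) where
    open Embedding M

    eulerCharacteristic : ℤ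
    eulerCharacteristic = (+ n) ℤ.- (+ m) ℤ.+ (+ φ)

    -- Segments of the barycentric subdivision joining the centre of a face to
    -- a vertex or to (the midpoint of) an edge on its boundary: at-vertex x and
    -- at-edge x are the sides of the triangle x opposite its edge and its
    -- vertex.  Each is a side of two triangles, see _≈_.
    data Spoke : Set where
      at-vertex at-edge : Flag → Spoke

    data _≈_ : Spoke → Spoke → Set where
      same   : ∀ {s} → s ≈ s
      vertex : ∀ {x} → at-vertex x ≈ at-vertex (τ₁ x)
      edge   : ∀ {x} → at-edge x ≈ at-edge (τ₀ x)

    point : Spoke → Fin n ⊎ Fin m
    point (at-vertex (d , _)) = inj₁ (tail d)
    point (at-edge (d , _))   = inj₂ (proj₁ d)

    spokeFace : Spoke → Fin φ
    spokeFace (at-vertex x) = face x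
    spokeFace (at-edge x)   = face x

    -- A simple closed curve meeting the embedded graph in exactly k points, at
    -- most one on each vertex and edge, and crossing no face twice.  The i-th
    -- arc leaves the i-th point along enter i, crosses a face, and reaches the
    -- next point (cyclically) along leave i.
    -- Curves crossing a face twice do not affect the minimum number of points:
    -- joining two consecutive arcs inside that face cuts such a curve into two
    -- which share out its points, and if it was nonseparating so is one of them.
    record Curve (k : ℕ) .{{_ : NonZero k}} : Set where
      field
        enter leave     : Fin k → Spoke
        same-face       : ∀ i → spokeFace (enter i) ≡ spokeFace (leave i)
        closed          : ∀ i → point (leave i) ≡ point (enter (suc (toℕ i) mod k))
        points-distinct : Injective _≡_ _≡_ (point ∘ enter)
        faces-distinct  : Injective _≡_ _≡_ (spokeFace ∘ enter)
        -- excludes going back along the same segment when k = 1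
        no-backtrack    : ∀ i → ¬ (enter i ≈ leave i)

    module _ {k : ℕ} .{{_ : NonZero k}} (C : Curve k) where
      open Curve C

      OnCurve : Spoke → Set
      OnCurve s = ∃[ i ] (enter i ≈ s ⊎ leave i ≈ s)

      -- Adjacent triangles whose common side is not on the curve.
      data Uncut : Flag → Flag → Set where
        across-edge   : ∀ {x} → Uncut x (τ₂ x)
        across-vertex : ∀ {x} → ¬ OnCurve (at-vertex x) → Uncut x (τ₁ x)
        across-mid    : ∀ {x} → ¬ OnCurve (at-edge x) → Uncut x (τ₀ x)

      -- The complement of the curve is connected: the curve does not split
      -- the surface into two parts.
      Noncontractible : Set
      Noncontractible = ∀ x y → EqClosure Uncut x y

    -- Curves avoiding the graph (k = 0) need no clause: they lie in an open disc
    -- and so split the surface.  On the sphere every curve splits the surface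
    -- and every bound r holds.
    RepresentativityAtLeast : ℕ → Set
    RepresentativityAtLeast r =
      ∀ k .{{_ : NonZero k}} (C : Curve k) → Noncontractible C → r ≤ k

-- The inequality 2 ^ (∛ a / d) ≤ N between real numbers, for a ≥ 0 and d > 0:
-- the left-hand side is the supremum of 2 ^ (p / (d * q)) over the rationals
-- 0 ≤ p / q ≤ ∛ a.  For cubic graphs a = n + 2χ is twice the number of faces.
2^[∛_/_]≤_ : ℤ → ℕ → ℕ → Set
2^[∛ a / d ]≤ N = ∀ (p q : ℕ) → NonZero q →
  (+ (p ^ 3)) ℤ.≤ a ℤ.* (+ (q ^ 3)) → 2 ^ p ≤ N ^ (d * q)

-- By Euler's formula n + 2χ is twice the number of faces.  Give every face a set of labels such that
-- the sets of two adjacent faces differ in exactly two labels.  For every label, the edges between a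
-- face that has it and one that has not form an even subgraph, and the circuits of all these
-- subgraphs form a circuit double cover.  One label per face yields the facial circuits if all labels
-- differ; more generally the labels may be any proper colouring of the faces.  A face all of whose
-- neighbours have one of three colours can be switched: it gets these three labels instead of its
-- own, and this is visible in the cover.
--
-- By representativity 4, the closed curve through any three pairwise adjacent faces separates.
-- Hence adjacencies between the neighbours of a face do not cross (in their order around the face),
-- so the neighbours are 3-colourable and each face can be switched.  If all faces have few
-- neighbours, then many faces are pairwise far apart and can be switched independently.  Otherwise
-- cut the neighbours of a face f with many neighbours into windows of four consecutive ones.  In a
-- window, either the 3-colouring can be changed, which changes the cover in which f is switched, or
-- a triangle of f and two neighbours separates a third neighbour t from all earlier (or all later)
-- windows; one such t for each of these windows can be switched independently.  Balancing the two
-- cases leads to the cube root.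

module Submission where

open import Defs
open import Data.Bool using (Bool; true; false; _xor_; _∧_; _∨_)
import Data.Bool.Properties as Bool
open import Data.Empty using (⊥; ⊥-elim)
open import Data.Fin as Fin using (Fin; zero; suc; toℕ)
import Data.Fin.Properties as Fin
import Data.Fin.Subset as Subset
open import Data.Fin.Subset using (Subset; ∣_∣; _∩_)
import Data.Fin.Subset.Properties as Subset
open import Data.Integer as ℤ using (ℤ; +_)
import Data.Integer.Properties as ℤ
import Data.Integer.Tactic.RingSolver as ℤ-Solver
open import Data.List as List using (List; []; _∷_; _++_; length; filter; map; concatMap)
open import Data.List.Membership.Propositional using (_∈_; _∉_; find; lose)
open import Data.List.Membership.Propositional.Properties
  using (∈-map⁺; ∈-map⁻; ∈-filter⁺; ∈-filter⁻; ∈-++⁺ˡ; ∈-lookup; ∈-allFin; ∈-upTo⁺; ∈-upTo⁻;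
    ∈-cartesianProduct⁺; ∈-concatMap⁺)
open import Data.List.Properties
  using (length-map; length-++; filter-notAll; unfold-reverse; length-reverse)
open import Data.List.Relation.Binary.Permutation.Propositional using (_↭_; ↭-sym)
open import Data.List.Relation.Binary.Permutation.Propositional.Properties using (∈-resp-↭)
open import Data.List.Relation.Unary.All as All using (All; []; _∷_)
import Data.List.Relation.Unary.All.Properties as All
open import Data.List.Relation.Unary.AllPairs as AllPairs using (AllPairs; []; _∷_)
import Data.List.Relation.Unary.AllPairs.Properties as AllPairs
open import Data.List.Relation.Unary.Any as Any using (Any; here; there)
import Data.List.Relation.Unary.Any.Properties as Any
open import Data.List.Relation.Unary.Unique.Propositional using (Unique)
import Data.List.Relation.Unary.Unique.Propositional.Properties as Unique
open import Data.Maybe using (Maybe; just; nothing)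
open import Data.Nat as ℕ using (ℕ; zero; suc; _+_; _*_; _^_; _≤_; _<_; z≤n; s≤s; s≤s⁻¹)
open import Data.Nat.DivMod using (_mod_)
import Data.Nat.Properties as ℕ
import Data.Nat.Tactic.RingSolver as ℕ-Solver
open import Data.Product using (Σ; _×_; _,_; proj₁; proj₂; ∃; ∃-syntax; ∃₂)
open import Data.Product.Properties using (≡-dec)
open import Data.Sum using (_⊎_; inj₁; inj₂; [_,_]′)
open import Data.Sum.Properties using (inj₂-injective)
open import Data.Vec as Vec using (Vec; []; _∷_; lookup)
import Data.Vec.Properties as Vec
open import Function using (_∘_; id; case_of_; Inverse; Equivalence)
open import Relation.Binary using (DecidableEquality; Decidable; tri<; tri≈; tri>)
open import Relation.Binary.Construct.Closure.Equivalence as EqClosure using (EqClosure)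
open import Relation.Binary.Construct.Closure.ReflexiveTransitive as Star using (Star; ε; _◅_; _◅◅_)
open import Relation.Binary.Construct.Closure.Symmetric using (fwd; bwd)
open import Relation.Binary.PropositionalEquality
open import Relation.Nullary
  using (¬_; Dec; yes; no; does; contradiction; ¬?; _×-dec_; _⊎-dec_; _→-dec_; from-yes)
open import Relation.Nullary.Decidable using (dec-true; dec-false)
import Relation.Unary as Unary
open import Algebra.Properties.CommutativeMonoid.Sum ℕ.+-0-commutativeMonoid using (sum; sum-cong-≗; ∑-comm; ∑-distrib-+)

-- Two covers are told apart by triples of edges that lie on a common circuit in one but not in the
-- other, a property that survives reordering of the multiset.
--
-- The obstacle is that faces switched together need one proper colouring in which each of them sees
-- only three colours around it. For distant faces fresh colours will do. Around a common face the
-- neighbourhoods overlap, so the colouring is extended one face at a time: a colour class of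
-- neighbours containing a face of the separating triangle takes over the old colour of that face,
-- the other classes get fresh colours, and any conflict would be a chain of faces crossing the
-- triangle. In the recolouring case only the central face is switched; the cover shows which
-- neighbours two steps apart have equal colours, and this determines the colouring once two
-- consecutive colours are fixed.
--
-- For `r` independent choices, about `12 * r` neighbours of one face suffice: `3 * r` windows of
-- four, each of one of three kinds. If every face has fewer, a ball of radius two holds of the
-- order of `r ^ 2` faces, so `r` distant faces exist once there are of the order of `r ^ 3` faces.

module _ {A B : Set} (_≟_ : DecidableEquality A) where

  update : A → B → (A → B) → A → B
  update x v f y with y ≟ x
  ... | yes _ = v
  ... | no _  = f y

  update-at : ∀ x v f → update x v f x ≡ v
  update-at x v f with x ≟ x
  ... | yes _ = refl
  ... | no x≢x = contradiction refl x≢x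

  update-off : ∀ {x y} v f → y ≢ x → update x v f y ≡ f y
  update-off {x} {y} v f y≢x with y ≟ x
  ... | yes y≡x = contradiction y≡x y≢x
  ... | no _ = refl

third : (a b : Fin 3) → ∃[ c ] (c ≢ a × c ≢ b)
third = from-yes (Fin.all? λ (a : Fin 3) → Fin.all? λ b → Fin.any? λ c →
  ¬? (c Fin.≟ a) ×-dec ¬? (c Fin.≟ b))

third-unique : (a b c d : Fin 3) → a ≢ b → c ≢ a → c ≢ b → d ≢ a → d ≢ b → c ≡ d
third-unique = from-yes (Fin.all? λ (a : Fin 3) → Fin.all? λ b → Fin.all? λ c → Fin.all? λ d →
  ¬? (a Fin.≟ b) →-dec ¬? (c Fin.≟ a) →-dec ¬? (c Fin.≟ b) →-dec
  ¬? (d Fin.≟ a) →-dec ¬? (d Fin.≟ b) →-dec c Fin.≟ d)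

least : {P : ℕ → Set} → Unary.Decidable P → ∀ k → P k →
  ∃[ l ] (l ≤ k × P l × (∀ {j} → j < l → ¬ P j))
least {P} P? k Pk with ℕ.anyUpTo? P? k
... | no none = k , ℕ.≤-refl , Pk , λ j<k Pj → none (_ , j<k , Pj)
least {P} P? (suc k) Pk | yes (l , s≤s l≤k , Pl) = below k l l≤k Pl
  where
  below : ∀ b l → l ≤ b → P l → ∃[ l′ ] (l′ ≤ suc b × P l′ × (∀ {j} → j < l′ → ¬ P j))
  below b l l≤b Pl with ℕ.anyUpTo? P? l
  ... | no none = l , ℕ.m≤n⇒m≤1+n l≤b , Pl , λ j<l Pj → none (_ , j<l , Pj)
  below (suc b) (suc l) (s≤s l≤b) Pl | yes (j , s≤s j≤l , Pj)
    with l′ , l′≤ , rest ← below b j (ℕ.≤-trans j≤l l≤b) Pj = l′ , ℕ.m≤n⇒m≤1+n l′≤ , rest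

-- Counting

length≡2 : {A : Set} {xs : List A} {a b : A} → Unique xs → a ∈ xs → b ∈ xs → a ≢ b →
  (∀ {x} → x ∈ xs → x ≡ a ⊎ x ≡ b) → length xs ≡ 2
length≡2 {xs = _ ∷ []} _ (here refl) (here refl) a≢b _ = contradiction refl a≢b
length≡2 {xs = _ ∷ _ ∷ []} _ _ _ _ _ = refl
length≡2 {xs = x ∷ y ∷ z ∷ _} ((x≢y ∷ x≢z ∷ _) ∷ (y≢z ∷ _) ∷ _) _ _ _ only
  with only (here refl) | only (there (here refl)) | only (there (there (here refl)))
... | inj₁ refl | inj₁ refl | _ = contradiction refl x≢y
... | inj₁ refl | inj₂ refl | inj₁ refl = contradiction refl x≢z
... | inj₁ refl | inj₂ refl | inj₂ refl = contradiction refl y≢z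
... | inj₂ refl | inj₂ refl | _ = contradiction refl x≢y
... | inj₂ refl | inj₁ refl | inj₁ refl = contradiction refl y≢z
... | inj₂ refl | inj₁ refl | inj₂ refl = contradiction refl x≢z

length-filter≡2 : {A : Set} {P : A → Set} (P? : Unary.Decidable P) {xs : List A} {a b : A} →
  Unique xs → a ∈ xs → b ∈ xs → a ≢ b → P a → P b → (∀ {x} → P x → x ≡ a ⊎ x ≡ b) →
  length (filter P? xs) ≡ 2
length-filter≡2 P? {xs} uniq a∈ b∈ a≢b Pa Pb only =
  length≡2 (Unique.filter⁺ P? uniq) (∈-filter⁺ P? a∈ Pa) (∈-filter⁺ P? b∈ Pb) a≢b
    (λ x∈ → only (proj₂ (∈-filter⁻ P? {xs = xs} x∈)))

elements : ∀ {k} → Subset k → List (Fin k)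
elements [] = []
elements (true ∷ p) = zero ∷ map suc (elements p)
elements (false ∷ p) = map suc (elements p)

length-elements : ∀ {k} (p : Subset k) → length (elements p) ≡ ∣ p ∣
length-elements [] = refl
length-elements (true ∷ p) = cong suc (trans (length-map Fin.suc (elements p)) (length-elements p))
length-elements (false ∷ p) = trans (length-map Fin.suc (elements p)) (length-elements p)

∈-elements⁺ : ∀ {k} (p : Subset k) {x} → x Subset.∈ p → x ∈ elements p
∈-elements⁺ (true ∷ p) Vec.here = here refl
∈-elements⁺ (true ∷ p) (Vec.there x∈) = there (∈-map⁺ suc (∈-elements⁺ p x∈))
∈-elements⁺ (false ∷ p) (Vec.there x∈) = ∈-map⁺ suc (∈-elements⁺ p x∈)

∈-elements⁻ : ∀ {k} (p : Subset k) {x} → x ∈ elements p → x Subset.∈ p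
∈-elements⁻ (true ∷ p) (here refl) = Vec.here
∈-elements⁻ (true ∷ p) (there x∈) with _ , y∈ , refl ← ∈-map⁻ suc x∈ = Vec.there (∈-elements⁻ p y∈)
∈-elements⁻ (false ∷ p) x∈ with _ , y∈ , refl ← ∈-map⁻ suc x∈ = Vec.there (∈-elements⁻ p y∈)

elements-unique : ∀ {k} (p : Subset k) → Unique (elements p)
elements-unique [] = []
elements-unique (true ∷ p) =
  All.map⁺ (All.universal (λ _ ()) _) ∷ Unique.map⁺ Fin.suc-injective (elements-unique p)
elements-unique (false ∷ p) = Unique.map⁺ Fin.suc-injective (elements-unique p)

∣∣≡2 : ∀ {k} (p : Subset k) {a b} → a Subset.∈ p → b Subset.∈ p → a ≢ b →
  (∀ {x} → x Subset.∈ p → x ≡ a ⊎ x ≡ b) → ∣ p ∣ ≡ 2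
∣∣≡2 p a∈ b∈ a≢b only = trans (sym (length-elements p))
  (length≡2 (elements-unique p) (∈-elements⁺ p a∈) (∈-elements⁺ p b∈) a≢b (only ∘ ∈-elements⁻ p))

Triple : ∀ {k} → Subset k → Set
Triple p = ∃[ a ] ∃[ b ] ∃[ c ]
  (a ≢ b × a ≢ c × b ≢ c × a Subset.∈ p × b Subset.∈ p × c Subset.∈ p ×
   (∀ x → x Subset.∈ p → x ≡ a ⊎ x ≡ b ⊎ x ≡ c))

∣∣≡3⁻ : ∀ {k} (p : Subset k) → ∣ p ∣ ≡ 3 → Triple p
∣∣≡3⁻ {k} p eq = go (elements p) (trans (length-elements p) eq) (elements-unique p) (∈-elements⁺ p) (∈-elements⁻ p)
  where
  go : ∀ xs → length xs ≡ 3 → Unique xs → (∀ {x} → x Subset.∈ p → x ∈ xs) →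
    (∀ {x} → x ∈ xs → x Subset.∈ p) → Triple p
  go (a ∷ b ∷ c ∷ []) refl ((a≢b ∷ a≢c ∷ []) ∷ (b≢c ∷ []) ∷ _) to from =
    a , b , c , a≢b , a≢c , b≢c , from (here refl) , from (there (here refl)) ,
    from (there (there (here refl))) , only
    where
    only : ∀ x → x Subset.∈ p → x ≡ a ⊎ x ≡ b ⊎ x ≡ c
    only x x∈ with to x∈
    ... | here e = inj₁ e
    ... | there (here e) = inj₂ (inj₁ e)
    ... | there (there (here e)) = inj₂ (inj₂ e)

∈-tabulate⁺ : ∀ {k} {f : Fin k → Bool} {x} → f x ≡ true → x Subset.∈ Vec.tabulate f
∈-tabulate⁺ {f = f} {x} fx = Vec.lookup⇒[]= x _ (trans (Vec.lookup∘tabulate f x) fx)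

∈-tabulate⁻ : ∀ {k} {f : Fin k → Bool} {x} → x Subset.∈ Vec.tabulate f → f x ≡ true
∈-tabulate⁻ {f = f} {x} x∈ = trans (sym (Vec.lookup∘tabulate f x)) (Vec.[]=⇒lookup x∈)

fresh-element : ∀ {k} (xs : List (Fin k)) → length xs < k → ∃[ x ] x ∉ xs
fresh-element {k} xs short with Fin.any? (λ x → ¬? (Any.any? (x Fin.≟_) xs))
... | yes found = found
... | no none = ⊥-elim (clash (Fin.pigeonhole short (λ x → Any.index (everywhere x))))
  where
  everywhere : ∀ x → x ∈ xs
  everywhere x with Any.any? (x Fin.≟_) xs
  ... | yes x∈ = x∈
  ... | no x∉ = contradiction (x , x∉) none
  clash : (∃₂ λ i j → i Fin.< j × Any.index (everywhere i) ≡ Any.index (everywhere j)) → ⊥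
  clash (i , j , i<j , eq) = ℕ.<⇒≢ i<j (cong toℕ (begin
    i                                           ≡⟨ lookup-index (everywhere i) ⟩
    List.lookup xs (Any.index (everywhere i))   ≡⟨ cong (List.lookup xs) eq ⟩
    List.lookup xs (Any.index (everywhere j))   ≡⟨ lookup-index (everywhere j) ⟨
    j ∎))
    where
    open ≡-Reasoning
    lookup-index : ∀ {x} {ys : List (Fin k)} (x∈ : x ∈ ys) → x ≡ List.lookup ys (Any.index x∈)
    lookup-index (here eq) = eq
    lookup-index (there x∈) = lookup-index x∈

bitVectors : ∀ r → List (Vec Bool r)
bitVectors zero = [] ∷ []
bitVectors (suc r) = map (true ∷_) (bitVectors r) ++ map (false ∷_) (bitVectors r)

length-bitVectors : ∀ r → length (bitVectors r) ≡ 2 ^ r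
length-bitVectors zero = refl
length-bitVectors (suc r) = begin
  length (map (true ∷_) (bitVectors r) ++ map (false ∷_) (bitVectors r)) ≡⟨ length-++ (map (true ∷_) (bitVectors r)) ⟩
  length (map (true ∷_) (bitVectors r)) + length (map (false ∷_) (bitVectors r))
    ≡⟨ cong₂ _+_ (trans (length-map _ (bitVectors r)) (length-bitVectors r)) (trans (length-map _ (bitVectors r)) (length-bitVectors r)) ⟩
  2 ^ r + 2 ^ r ≡⟨ cong (λ k → 2 ^ r + k) (ℕ.+-identityʳ (2 ^ r)) ⟨
  2 * 2 ^ r ∎
  where open ≡-Reasoning

Differ : ∀ {r} → Vec Bool r → Vec Bool r → Set
Differ b b′ = ∃[ i ] lookup b i ≢ lookup b′ i

bitVectors-differ : ∀ r → AllPairs Differ (bitVectors r)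
bitVectors-differ zero = [] ∷ []
bitVectors-differ (suc r) = AllPairs.++⁺ (tails true) (tails false)
  (All.map⁺ (All.universal (λ _ → All.map⁺ (All.universal (λ _ → zero , λ ()) _)) _))
  where
  tails : ∀ b → AllPairs Differ (map (b ∷_) (bitVectors r))
  tails b = AllPairs.map⁺ (AllPairs.map (λ (i , ≢) → suc i , ≢) (bitVectors-differ r))

-- Colourings of noncrossing chords

module Chords (E : ℕ → ℕ → Set) (E? : Decidable E) (E-sym : ∀ {a b} → E a b → E b a)
              (E-irrefl : ∀ {a} → ¬ E a a) where

  Noncrossing : List ℕ → Set
  Noncrossing S = ∀ {a b c d} → a ∈ S → b ∈ S → c ∈ S → d ∈ S →
    a < b → b < c → c < d → E a c → E b d → ⊥

  Proper : List ℕ → (ℕ → Fin 3) → Set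
  Proper S col = ∀ {a b} → a ∈ S → b ∈ S → E a b → col a ≢ col b

  -- The two values only bound where neighbours can be: they may coincide, and need be neither
  -- neighbours of `x` nor in `S`.
  LowDegree : List ℕ → ℕ → Set
  LowDegree S x = x ∈ S × ∃₂ λ p q → ∀ {y} → y ∈ S → E x y → y ≡ p ⊎ y ≡ q

  -- A chord spanning some point but as short as possible has only short chords below it.
  low-between : ∀ {S} → Noncrossing S → ∀ k {lo hi} → hi ≤ lo + k → ∀ {x} → x ∈ S → lo < x → x < hi →
    (∀ {y z} → y ∈ S → lo < y → y < hi → z ∈ S → E y z → lo ≤ z × z ≤ hi) → ∃ (LowDegree S)
  low-between nc zero hi≤ x∈ lo<x x<hi _ =
    ⊥-elim (ℕ.<⇒≱ (ℕ.<-trans lo<x x<hi) (ℕ.≤-trans hi≤ (ℕ.≤-reflexive (ℕ.+-identityʳ _))))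
  low-between {S} nc (suc k) {lo} {hi} hi≤ {x} x∈ lo<x x<hi closed
    -- The leftmost point `a` inside the interval has at most `lo` as a smaller neighbour. If a
    -- chord from `a` to the right jumps over a point, the shorter interval below that chord is
    -- again left by no adjacency, and the search continues there. Otherwise `a` has at most one
    -- larger neighbour.
    with least (λ y → Any.any? (y ℕ.≟_) S ×-dec lo ℕ.<? y ×-dec y ℕ.<? hi) x (x∈ , lo<x , x<hi)
  ... | a , _ , (a∈ , lo<a , a<hi) , a-min
    with Any.any? (λ b → E? a b ×-dec a ℕ.<? b ×-dec Any.any? (λ y → a ℕ.<? y ×-dec y ℕ.<? b) S) S
  ... | yes chord with b , b∈ , Eab , a<b , between ← find chord with y , y∈ , a<y , y<b ← find between =
    low-between nc k bound y∈ a<y y<b inside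
    where
    b≤hi : b ≤ hi
    b≤hi = proj₂ (closed a∈ lo<a a<hi b∈ Eab)
    bound : b ≤ a + k
    bound = ℕ.≤-trans b≤hi (ℕ.≤-trans hi≤ (ℕ.≤-trans (ℕ.≤-reflexive (ℕ.+-suc lo k)) (ℕ.+-monoˡ-≤ k lo<a)))
    inside : ∀ {y z} → y ∈ S → a < y → y < b → z ∈ S → E y z → a ≤ z × z ≤ b
    inside y∈ a<y y<b z∈ Eyz =
      ℕ.≮⇒≥ (λ z<a → nc z∈ a∈ y∈ b∈ z<a a<y y<b (E-sym Eyz) Eab) ,
      ℕ.≮⇒≥ (λ b<z → nc a∈ y∈ b∈ z∈ a<y y<b b<z Eab Eyz)
  ... | no no-chord = a , a∈ , lo , proj₁ right , neighbours
    where
    right : ∃[ z ] (∀ {y} → y ∈ S → E a y → a < y → y ≡ z)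
    right with Any.any? (λ z → E? a z ×-dec a ℕ.<? z) S
    ... | no none = 0 , λ y∈ Eay a<y → contradiction (lose y∈ (Eay , a<y)) none
    ... | yes some with z , z∈ , Eaz , a<z ← find some = z , λ {y} y∈ Eay a<y →
      ℕ.≤-antisym (ℕ.≮⇒≥ λ z<y → no-chord (lose y∈ (Eay , a<y , lose z∈ (a<z , z<y))))
                  (ℕ.≮⇒≥ λ y<z → no-chord (lose z∈ (Eaz , a<z , lose y∈ (a<y , y<z))))
    neighbours : ∀ {y} → y ∈ S → E a y → y ≡ lo ⊎ y ≡ proj₁ right
    neighbours {y} y∈ Eay with ℕ.<-cmp y a
    ... | tri> _ _ a<y = inj₂ (proj₂ right y∈ Eay a<y)
    ... | tri≈ _ refl _ = contradiction Eay E-irrefl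
    ... | tri< y<a _ _ = inj₁ (ℕ.≤-antisym
      (ℕ.≮⇒≥ λ lo<y → a-min y<a (y∈ , lo<y , ℕ.<-trans y<a a<hi))
      (proj₁ (closed a∈ lo<a a<hi y∈ Eay)))

  -- No adjacency leaves the interval from 0 to one more than the maximum of `S`. Position 0 is not
  -- strictly inside it, so the case without positive positions is separate.
  low : ∀ {S} → Noncrossing S → ∀ {x} → x ∈ S → ∃ (LowDegree S)
  low {S} nc {x} x∈ with Any.any? (0 ℕ.<?_) S
  ... | yes some with y , y∈ , 0<y ← find some =
    low-between nc (suc (List.foldr ℕ._⊔_ 0 S)) ℕ.≤-refl y∈ 0<y (s≤s (bound y∈))
      (λ _ _ _ z∈ _ → z≤n , ℕ.m≤n⇒m≤1+n (bound z∈))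
    where
    bound : ∀ {T y} → y ∈ T → y ≤ List.foldr ℕ._⊔_ 0 T
    bound (here refl) = ℕ.m≤m⊔n _ _
    bound (there y∈) = ℕ.≤-trans (bound y∈) (ℕ.m≤n⊔m _ _)
  ... | no none = x , x∈ , 0 , 0 , λ y∈ _ → inj₁ (ℕ.n≤0⇒n≡0 (ℕ.≮⇒≥ λ 0<y → none (lose y∈ 0<y)))

  x≢? : ∀ x → Unary.Decidable (_≢ x)
  x≢? x y = ¬? (y ℕ.≟ x)

  delete : ℕ → List ℕ → List ℕ
  delete x = filter (x≢? x)

  ∈-delete⁻ : ∀ {x S a} → a ∈ delete x S → a ∈ S
  ∈-delete⁻ {x} {S} a∈ = proj₁ (∈-filter⁻ (x≢? x) {xs = S} a∈)

  -- Noncrossing chords form an outerplanar graph, which is 2-degenerate: delete a point with at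
  -- most two neighbours, colour the rest, and a colour remains for it. The bound `k` makes the
  -- recursion structural.
  colouring : ∀ k S → length S ≤ k → Noncrossing S → ∃ (Proper S)
  colouring _ [] _ _ = (λ _ → zero) , λ ()
  colouring (suc k) S@(s ∷ S₀) (s≤s len) nc
    with x , x∈ , p , q , only ← low nc (here refl)
    with col , proper ← colouring k (delete x S)
           (ℕ.≤-trans (s≤s⁻¹ (filter-notAll (x≢? x) S (Any.map (λ { refl ¬x → ¬x refl }) x∈))) len)
           (λ a∈ b∈ c∈ d∈ → nc (∈-delete⁻ a∈) (∈-delete⁻ b∈) (∈-delete⁻ c∈) (∈-delete⁻ d∈))
    = col′ , proper′
    where
    new : ∃[ c ] (c ≢ col p × c ≢ col q)
    new = third (col p) (col q)
    col′ : ℕ → Fin 3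
    col′ = update ℕ._≟_ x (proj₁ new) col
    at-x : ∀ {b} → b ∈ S → b ≢ x → E x b → col′ x ≢ col′ b
    at-x b∈ b≢x Exb eq with only b∈ Exb
    ... | inj₁ refl = proj₁ (proj₂ new) (trans (sym (update-at ℕ._≟_ x _ col)) (trans eq (update-off ℕ._≟_ _ col b≢x)))
    ... | inj₂ refl = proj₂ (proj₂ new) (trans (sym (update-at ℕ._≟_ x _ col)) (trans eq (update-off ℕ._≟_ _ col b≢x)))
    proper′ : Proper S col′
    proper′ {a} {b} a∈ b∈ Eab with a ℕ.≟ x | b ℕ.≟ x
    ... | yes refl | yes refl = contradiction Eab E-irrefl
    ... | yes refl | no b≢x = λ eq → at-x b∈ b≢x Eab (trans (update-at ℕ._≟_ x _ col) (trans eq (sym (update-off ℕ._≟_ _ col b≢x))))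
    ... | no a≢x | yes refl = λ eq → at-x a∈ a≢x (E-sym Eab) (trans (update-at ℕ._≟_ x _ col) (trans (sym eq) (sym (update-off ℕ._≟_ _ col a≢x))))
    ... | no a≢x | no b≢x = proper (∈-filter⁺ (x≢? x) a∈ a≢x) (∈-filter⁺ (x≢? x) b∈ b≢x) Eab

-- Circuits as components of an edge set

does-true : {P : Set} (P? : Dec P) → does P? ≡ true → P
does-true (yes p) _ = p

∧-true : ∀ {a b} → a ∧ b ≡ true → a ≡ true × b ≡ true
∧-true {true} eq = refl , eq

module Incidence {n : ℕ} (G : Graph n) where
  open Graph G

  Inc : Fin m → Fin n → Set
  Inc e v = src e ≡ v ⊎ tgt e ≡ v

  ∈-incident⁺ : ∀ {e v} → Inc e v → e Subset.∈ incident G v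
  ∈-incident⁺ {e} {v} inc = ∈-tabulate⁺ (dec-true ((src e Fin.≟ v) ⊎-dec (tgt e Fin.≟ v)) inc)

  ∈-incident⁻ : ∀ {e v} → e Subset.∈ incident G v → Inc e v
  ∈-incident⁻ {e} {v} e∈ = does-true ((src e Fin.≟ v) ⊎-dec (tgt e Fin.≟ v)) (∈-tabulate⁻ e∈)

module Components {n : ℕ} (G : Graph n) (E : Fin (Graph.m G) → Bool) where
  open Graph G
  open Subgraph
  open Incidence G

  Joined : Fin n → Fin n → Set
  Joined = JoinedBy G (λ e → E e ≡ true)

  -- The union step of union-find: the class of `src e` is absorbed by that of `tgt e`. Computed
  -- representatives make components decidable and name each of them by a vertex.
  merge : Fin m → (Fin n → Fin n) → Fin n → Fin n
  merge e c v with c v Fin.≟ c (src e)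
  ... | yes _ = c (tgt e)
  ... | no _ = c v

  classes : List (Fin m) → Fin n → Fin n
  classes [] v = v
  classes (e ∷ es) with E e
  ... | true = merge e (classes es)
  ... | false = classes es

  classes-sound : ∀ es v → Joined v (classes es v)
  classes-sound [] v = ε
  classes-sound (e ∷ es) v with E e in Ee
  ... | false = classes-sound es v
  ... | true with classes es v Fin.≟ classes es (src e)
  ...   | no _ = classes-sound es v
  ...   | yes eq = subst (Joined v) eq (classes-sound es v)
                   ◅◅ EqClosure.symmetric _ (classes-sound es (src e))
                   ◅◅ fwd (e , Ee , refl , refl) ◅ classes-sound es (tgt e)

  merge-cong : ∀ e c {u v} → c u ≡ c v → merge e c u ≡ merge e c v
  merge-cong e c {u} {v} eq with c u Fin.≟ c (src e) | c v Fin.≟ c (src e)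
  ... | yes _ | yes _ = refl
  ... | no _ | no _ = eq
  ... | yes p | no ¬p = contradiction (trans (sym eq) p) ¬p
  ... | no ¬p | yes p = contradiction (trans eq p) ¬p

  merge-ends : ∀ e c → merge e c (src e) ≡ merge e c (tgt e)
  merge-ends e c with c (src e) Fin.≟ c (src e) | c (tgt e) Fin.≟ c (src e)
  ... | yes _ | yes _ = refl
  ... | yes _ | no _ = refl
  ... | no ¬p | _ = contradiction refl ¬p

  classes-complete : ∀ es {e} → e ∈ es → E e ≡ true → classes es (src e) ≡ classes es (tgt e)
  classes-complete (e ∷ es) (here refl) Ee with E e
  ... | true = merge-ends e (classes es)
  classes-complete (e′ ∷ es) (there e∈) Ee with E e′
  ... | true = merge-cong e′ (classes es) (classes-complete es e∈ Ee)
  ... | false = classes-complete es e∈ Ee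

  comp : Fin n → Fin n
  comp = classes (List.allFin m)

  comp-Inc : ∀ {e v} → E e ≡ true → Inc e v → comp (src e) ≡ comp v
  comp-Inc Ee (inj₁ refl) = refl
  comp-Inc {e} Ee (inj₂ refl) = classes-complete (List.allFin m) (∈-allFin e) Ee

  comp-joined : ∀ {u v} → comp u ≡ comp v → Joined u v
  comp-joined {u} {v} eq = subst (Joined u) eq (classes-sound (List.allFin m) u) ◅◅
    EqClosure.symmetric _ (classes-sound (List.allFin m) v)

  component : Fin n → Subgraph G
  component r = subgraph (Vec.tabulate λ v → does (comp v Fin.≟ r))
                         (Vec.tabulate λ e → E e ∧ does (comp (src e) Fin.≟ r))

  ∈-component⁺ : ∀ {r e} → E e ≡ true → comp (src e) ≡ r → e Subset.∈ edges (component r)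
  ∈-component⁺ {r} {e} Ee eq = ∈-tabulate⁺ (cong₂ _∧_ Ee (dec-true (comp (src e) Fin.≟ r) eq))

  ∈-component⁻ : ∀ {r e} → e Subset.∈ edges (component r) → E e ≡ true × comp (src e) ≡ r
  ∈-component⁻ {r} {e} e∈ with Ee , eq ← ∧-true {E e} (∈-tabulate⁻ e∈) = Ee , does-true (comp (src e) Fin.≟ r) eq

  component-joined : ∀ {r u v} → comp u ≡ r → Joined u v → JoinedBy G (Subset._∈ edges (component r)) u v
  component-joined _ ε = ε
  component-joined eq (fwd (e , Ee , refl , refl) ◅ uv) =
    fwd (e , ∈-component⁺ Ee eq , refl , refl) ◅
    component-joined (trans (sym (comp-Inc Ee (inj₂ refl))) eq) uv
  component-joined eq (bwd (e , Ee , refl , refl) ◅ uv) =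
    bwd (e , ∈-component⁺ Ee (trans (comp-Inc Ee (inj₂ refl)) eq) , refl , refl) ◅
    component-joined (trans (comp-Inc Ee (inj₂ refl)) eq) uv

  TwoAt : Fin n → Set
  TwoAt v = ∃₂ λ a b → a ≢ b × Inc a v × Inc b v ×
    E a ≡ true × E b ≡ true × (∀ {x} → Inc x v → E x ≡ true → x ≡ a ⊎ x ≡ b)

  -- Even degree in the form it takes in a cubic graph: a vertex met by `E` at all is met exactly
  -- twice, so the components that contain edges are circuits.
  Even : Set
  Even = ∀ {v e} → Inc e v → E e ≡ true → TwoAt v

  component-circuit : Even → ∀ {e} → E e ≡ true → IsCircuit G (component (comp (src e)))
  component-circuit even {e₀} Ee₀ = record
    { ends-in = λ e e∈ → let Ee , eq = ∈-component⁻ e∈ in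
        ∈-vertices eq , ∈-vertices (trans (sym (comp-Inc Ee (inj₂ refl))) eq)
    ; nonempty = src e₀ , ∈-vertices refl
    ; connected = λ u v u∈ v∈ → component-joined (vertices-∈ u∈)
        (comp-joined (trans (vertices-∈ u∈) (sym (vertices-∈ v∈))))
    ; 2-regular = regular
    }
    where
    r = comp (src e₀)
    ∈-vertices : ∀ {v} → comp v ≡ r → v Subset.∈ vertices (component r)
    ∈-vertices {v} eq = ∈-tabulate⁺ (dec-true (comp v Fin.≟ r) eq)
    vertices-∈ : ∀ {v} → v Subset.∈ vertices (component r) → comp v ≡ r
    vertices-∈ {v} v∈ = does-true (comp v Fin.≟ r) (∈-tabulate⁻ v∈)
    some-edge : ∀ {v} → Joined v (src e₀) → ∃[ e ] (Inc e v × E e ≡ true)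
    some-edge ε = e₀ , inj₁ refl , Ee₀
    some-edge (fwd (e , Ee , refl , refl) ◅ _) = e , inj₁ refl , Ee
    some-edge (bwd (e , Ee , refl , refl) ◅ _) = e , inj₂ refl , Ee
    regular : ∀ v → v Subset.∈ vertices (component r) → ∣ incident G v ∩ edges (component r) ∣ ≡ 2
    regular v v∈ with e , inc , Ee ← some-edge (comp-joined (vertices-∈ v∈))
      with a , b , a≢b , inc-a , inc-b , Ea , Eb , only ← even inc Ee =
      ∣∣≡2 _ (inside inc-a Ea) (inside inc-b Eb) a≢b λ x∈ →
        let x∈v , x∈c = Subset.x∈p∩q⁻ _ _ x∈ in only (∈-incident⁻ x∈v) (proj₁ (∈-component⁻ x∈c))
      where
      inside : ∀ {x} → Inc x v → E x ≡ true → x Subset.∈ incident G v ∩ edges (component r)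
      inside inc Ex = Subset.x∈p∩q⁺ (∈-incident⁺ inc , ∈-component⁺ Ex (trans (comp-Inc Ex inc) (vertices-∈ v∈)))

-- Flags of an embedded cubic graph

three-cover : (x y z w : Fin 3) → x ≢ y → x ≢ z → y ≢ z → w ≡ x ⊎ w ≡ y ⊎ w ≡ z
three-cover = from-yes (Fin.all? λ (x : Fin 3) → Fin.all? λ y → Fin.all? λ z → Fin.all? λ w →
  ¬? (x Fin.≟ y) →-dec ¬? (x Fin.≟ z) →-dec ¬? (y Fin.≟ z) →-dec
  (w Fin.≟ x ⊎-dec w Fin.≟ y ⊎-dec w Fin.≟ z))

module Flags {n : ℕ} (G : Graph n) (cubic : Cubic G) (M : Embedding G) where
  open Graph G public
  open Embedding M public
  open Incidence G public

  rot rot⁻¹ : Dart G → Dart G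
  rot = Inverse.to rotation
  rot⁻¹ = Inverse.from rotation

  rot-rot⁻¹ : ∀ d → rot (rot⁻¹ d) ≡ d
  rot-rot⁻¹ d = Inverse.inverseˡ rotation refl

  rot⁻¹-rot : ∀ d → rot⁻¹ (rot d) ≡ d
  rot⁻¹-rot d = Inverse.inverseʳ rotation refl

  rot-injective : ∀ {d d′} → rot d ≡ rot d′ → d ≡ d′
  rot-injective {d} {d′} eq = trans (sym (rot⁻¹-rot d)) (trans (cong rot⁻¹ eq) (rot⁻¹-rot d′))

  _≟ᶠ_ : DecidableEquality (Flag G)
  _≟ᶠ_ = ≡-dec (≡-dec Fin._≟_ Bool._≟_) Bool._≟_

  edgeOf : Flag G → Fin m
  edgeOf ((e , _) , _) = e

  vertexOf : Flag G → Fin n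
  vertexOf (d , _) = tail G d

  τ₀-involutive : ∀ x → τ₀ (τ₀ x) ≡ x
  τ₀-involutive ((e , b) , s) with twisted e
  ... | true = cong₂ (λ b s → (e , b) , s) (Bool.not-involutive b) refl
  ... | false = cong₂ (λ b s → (e , b) , s) (Bool.not-involutive b) (Bool.not-involutive s)

  τ₁-involutive : ∀ x → τ₁ (τ₁ x) ≡ x
  τ₁-involutive (d , false) = cong (_, false) (rot⁻¹-rot d)
  τ₁-involutive (d , true) = cong (_, true) (rot-rot⁻¹ d)

  τ₂-involutive : ∀ x → τ₂ (τ₂ x) ≡ x
  τ₂-involutive (d , s) = cong (d ,_) (Bool.not-involutive s)

  τ₀τ₂-comm : ∀ x → τ₀ (τ₂ x) ≡ τ₂ (τ₀ x)
  τ₀τ₂-comm ((e , b) , s) with twisted e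
  ... | true = refl
  ... | false = refl

  τ₀-apart : ∀ x → τ₀ x ≢ x
  τ₀-apart ((e , false) , s) ()
  τ₀-apart ((e , true) , s) ()

  τ₁-apart : ∀ x → τ₁ x ≢ x
  τ₁-apart (d , false) ()
  τ₁-apart (d , true) ()

  τ₂-apart : ∀ x → τ₂ x ≢ x
  τ₂-apart (d , false) ()
  τ₂-apart (d , true) ()

  τ₀τ₂-apart : ∀ x → τ₀ x ≢ τ₂ x
  τ₀τ₂-apart ((e , false) , s) ()
  τ₀τ₂-apart ((e , true) , s) ()

  face-τ₀ : ∀ x → face (τ₀ x) ≡ face x
  face-τ₀ x = sym (Equivalence.from (face-orbits x (τ₀ x)) (fwd (inj₁ refl) ◅ ε))

  face-τ₁ : ∀ x → face (τ₁ x) ≡ face x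
  face-τ₁ x = sym (Equivalence.from (face-orbits x (τ₁ x)) (fwd (inj₂ refl) ◅ ε))

  vertex-τ₁ : ∀ x → vertexOf (τ₁ x) ≡ vertexOf x
  vertex-τ₁ (d , false) = rotation-tail d
  vertex-τ₁ (d , true) = trans (sym (rotation-tail (rot⁻¹ d))) (cong (tail G) (rot-rot⁻¹ d))

  opp : Flag G → Fin φ
  opp x = face (τ₂ x)

  opp-τ₀ : ∀ x → opp (τ₀ x) ≡ opp x
  opp-τ₀ x = trans (cong face (sym (τ₀τ₂-comm x))) (face-τ₀ (τ₂ x))

  opp-τ₂ : ∀ x → opp (τ₂ x) ≡ face x
  opp-τ₂ x = cong face (τ₂-involutive x)

  face-base : ∀ f → ∃[ x ] face x ≡ f
  face-base f with x , eq ← face-surjective f = x , eq refl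

  sameDart : ∀ x y → proj₁ x ≡ proj₁ y → y ≡ x ⊎ y ≡ τ₂ x
  sameDart (d , false) (.d , false) refl = inj₁ refl
  sameDart (d , false) (.d , true) refl = inj₂ refl
  sameDart (d , true) (.d , false) refl = inj₂ refl
  sameDart (d , true) (.d , true) refl = inj₁ refl

  -- The orbit of a flag under the commuting involutions `τ₀` and `τ₂`.
  data OnEdge (x : Flag G) : Flag G → Set where
    at     : OnEdge x x
    at₀    : OnEdge x (τ₀ x)
    at₂    : OnEdge x (τ₂ x)
    at₂₀   : OnEdge x (τ₂ (τ₀ x))

  onEdge : ∀ x y → edgeOf x ≡ edgeOf y → OnEdge x y
  onEdge x@((e , b) , s) y@((.e , b′) , s′) refl with b Bool.≟ b′
  ... | yes refl with sameDart x y refl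
  ...   | inj₁ eq = subst (OnEdge x) (sym eq) at
  ...   | inj₂ eq = subst (OnEdge x) (sym eq) at₂
  onEdge x@((e , b) , s) y@((.e , b′) , s′) refl | no b≢b′
    with sameDart (τ₀ x) y (cong (e ,_) (sym (Bool.¬-not (b≢b′ ∘ sym))))
  ...   | inj₁ eq = subst (OnEdge x) (sym eq) at₀
  ...   | inj₂ eq = subst (OnEdge x) (sym eq) at₂₀

  -- Cubic vertices

  dart-unique : ∀ d d′ → proj₁ d ≡ proj₁ d′ → tail G d ≡ tail G d′ → d ≡ d′
  dart-unique (e , false) (.e , false) refl _ = refl
  dart-unique (e , true) (.e , true) refl _ = refl
  dart-unique (e , false) (.e , true) refl eq = contradiction eq (loopless e)
  dart-unique (e , true) (.e , false) refl eq = contradiction (sym eq) (loopless e)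

  dart-at : ∀ {e v} → Inc e v → ∃[ d ] (proj₁ d ≡ e × tail G d ≡ v)
  dart-at {e} (inj₁ eq) = (e , false) , refl , eq
  dart-at {e} (inj₂ eq) = (e , true) , refl , eq

  tail-Inc : ∀ d → Inc (proj₁ d) (tail G d)
  tail-Inc (e , false) = inj₁ refl
  tail-Inc (e , true) = inj₂ refl

  rot-star : ∀ {P : Dart G → Set} → (∀ {d} → P d → P (rot d)) → ∀ {d d′} →
    Star (λ a b → rot a ≡ b) d d′ → P d → P d′
  rot-star step ε p = p
  rot-star step (refl ◅ rest) p = rot-star step rest (step p)

  -- The first three darts of the orbit are distinct, since otherwise the orbit would have at most
  -- two darts, while it contains all three at the vertex. The fourth must repeat one of them, and
  -- injectivity of `rot` leaves only the first.
  rot³ : ∀ d → rot (rot (rot d)) ≡ d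
  rot³ d with ∣∣≡3⁻ (incident G (tail G d)) (cubic (tail G d))
  ... | a , b , c , a≢b , a≢c , b≢c , a∈ , b∈ , c∈ , only = conclusion
    where
    v = tail G d
    Here : Dart G → Set
    Here d′ = tail G d′ ≡ v
    here-rot : ∀ d′ → Here d′ → Here (rot d′)
    here-rot d′ eq = trans (rotation-tail d′) eq
    number : ∀ {e} → e ≡ a ⊎ e ≡ b ⊎ e ≡ c → Fin 3
    number (inj₁ _) = zero
    number (inj₂ (inj₁ _)) = suc zero
    number (inj₂ (inj₂ _)) = suc (suc zero)
    number-injective : ∀ {e e′} (p : e ≡ a ⊎ e ≡ b ⊎ e ≡ c) (q : e′ ≡ a ⊎ e′ ≡ b ⊎ e′ ≡ c) →
      number p ≡ number q → e ≡ e′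
    number-injective (inj₁ p) (inj₁ q) _ = trans p (sym q)
    number-injective (inj₂ (inj₁ p)) (inj₂ (inj₁ q)) _ = trans p (sym q)
    number-injective (inj₂ (inj₂ p)) (inj₂ (inj₂ q)) _ = trans p (sym q)
    number-injective (inj₁ _) (inj₂ (inj₁ _)) ()
    number-injective (inj₁ _) (inj₂ (inj₂ _)) ()
    number-injective (inj₂ (inj₁ _)) (inj₁ _) ()
    number-injective (inj₂ (inj₁ _)) (inj₂ (inj₂ _)) ()
    number-injective (inj₂ (inj₂ _)) (inj₁ _) ()
    number-injective (inj₂ (inj₂ _)) (inj₂ (inj₁ _)) ()
    which : ∀ d → Here d → proj₁ d ≡ a ⊎ proj₁ d ≡ b ⊎ proj₁ d ≡ c
    which d h = only (proj₁ d) (∈-incident⁺ (subst (Inc (proj₁ d)) h (tail-Inc d)))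
    index : ∀ d → Here d → Fin 3
    index d h = number (which d h)
    index-injective : ∀ d d′ (h : Here d) (h′ : Here d′) → index d h ≡ index d′ h′ → d ≡ d′
    index-injective d d′ h h′ eq =
      dart-unique d d′ (number-injective (which d h) (which d′ h′) eq) (trans h (sym h′))
    dart : ∀ {e} → e Subset.∈ incident G v → ∃[ d′ ] (proj₁ d′ ≡ e × Here d′)
    dart e∈ = dart-at (∈-incident⁻ e∈)
    differ : ∀ {e e′ d d′} → e ≢ e′ → proj₁ d ≡ e → proj₁ d′ ≡ e′ → d ≢ d′
    differ e≢ refl refl refl = e≢ refl
    da = proj₁ (dart a∈)
    db = proj₁ (dart b∈)
    dc = proj₁ (dart c∈)
    da≢db = differ a≢b (proj₁ (proj₂ (dart a∈))) (proj₁ (proj₂ (dart b∈)))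
    da≢dc = differ a≢c (proj₁ (proj₂ (dart a∈))) (proj₁ (proj₂ (dart c∈)))
    db≢dc = differ b≢c (proj₁ (proj₂ (dart b∈))) (proj₁ (proj₂ (dart c∈)))
    reach : ∀ {d′} → Here d′ → Star (λ a b → rot a ≡ b) d d′
    reach h = rotation-cyclic d _ (sym h)
    two : ∀ {e₁ e₂} → (∀ d′ → Here d′ → d′ ≡ e₁ ⊎ d′ ≡ e₂) → ⊥
    two all with all da (proj₂ (proj₂ (dart a∈))) | all db (proj₂ (proj₂ (dart b∈))) | all dc (proj₂ (proj₂ (dart c∈)))
    ... | inj₁ p | inj₁ q | _ = da≢db (trans p (sym q))
    ... | inj₂ p | inj₂ q | _ = da≢db (trans p (sym q))
    ... | inj₁ p | _ | inj₁ q = da≢dc (trans p (sym q))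
    ... | inj₂ p | _ | inj₂ q = da≢dc (trans p (sym q))
    ... | _ | inj₁ p | inj₁ q = db≢dc (trans p (sym q))
    ... | _ | inj₂ p | inj₂ q = db≢dc (trans p (sym q))
    d≢d² : rot (rot d) ≢ d
    d≢d² eq = two λ _ h → rot-star {P = λ d′ → d′ ≡ d ⊎ d′ ≡ rot d}
      (λ { (inj₁ refl) → inj₂ refl ; (inj₂ refl) → inj₁ eq }) (reach h) (inj₁ refl)
    d≢d¹ : rot d ≢ d
    d≢d¹ eq = d≢d² (trans (cong rot eq) eq)
    d¹ = rot d
    d² = rot d¹
    d³ = rot d²
    h¹ = here-rot d refl
    h² = here-rot d¹ h¹
    h³ = here-rot d² h²
    conclusion : d³ ≡ d
    conclusion with three-cover (index d refl) (index d¹ h¹) (index d² h²) (index d³ h³)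
                      (λ eq → d≢d¹ (sym (index-injective d d¹ refl h¹ eq)))
                      (λ eq → d≢d² (sym (index-injective d d² refl h² eq)))
                      (λ eq → d≢d¹ (sym (rot-injective (index-injective d¹ d² h¹ h² eq))))
    ... | inj₁ eq = index-injective d³ d h³ refl eq
    ... | inj₂ (inj₁ eq) = contradiction (rot-injective (index-injective d³ d¹ h³ h¹ eq)) d≢d²
    ... | inj₂ (inj₂ eq) = contradiction (rot-injective (rot-injective (index-injective d³ d² h³ h² eq))) d≢d¹

  rot⁻¹≡rot² : ∀ d → rot⁻¹ d ≡ rot (rot d)
  rot⁻¹≡rot² d = rot-injective (trans (rot-rot⁻¹ d) (sym (rot³ d)))

  -- The relation of the symmetric group on three letters. With it, the words in `τ₁` and `τ₂`
  -- reduce to six, one for each flag at a cubic vertex.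
  braid : ∀ x → τ₁ (τ₂ (τ₁ x)) ≡ τ₂ (τ₁ (τ₂ x))
  braid (d , false) = cong (_, true) (sym (rot⁻¹≡rot² d))
  braid (d , true) = cong (_, false) (trans (rot⁻¹≡rot² (rot⁻¹ d)) (cong rot (rot-rot⁻¹ d)))

  data AtVertex (x : Flag G) : Flag G → Set where
    on    : AtVertex x x
    on₂   : AtVertex x (τ₂ x)
    on₁   : AtVertex x (τ₁ x)
    on₂₁  : AtVertex x (τ₂ (τ₁ x))
    on₁₂  : AtVertex x (τ₁ (τ₂ x))
    on₂₁₂ : AtVertex x (τ₂ (τ₁ (τ₂ x)))

  private
    step₂ : ∀ {x y} → AtVertex x y → AtVertex x (τ₂ y)
    step₂ on = on₂
    step₂ {x} on₂ = subst (AtVertex x) (sym (τ₂-involutive x)) on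
    step₂ on₁ = on₂₁
    step₂ {x} on₂₁ = subst (AtVertex x) (sym (τ₂-involutive (τ₁ x))) on₁
    step₂ on₁₂ = on₂₁₂
    step₂ {x} on₂₁₂ = subst (AtVertex x) (sym (τ₂-involutive (τ₁ (τ₂ x)))) on₁₂

    step₁ : ∀ {x y} → AtVertex x y → AtVertex x (τ₁ y)
    step₁ on = on₁
    step₁ on₂ = on₁₂
    step₁ {x} on₁ = subst (AtVertex x) (sym (τ₁-involutive x)) on
    step₁ {x} on₂₁ = subst (AtVertex x) (sym (braid x)) on₂₁₂
    step₁ {x} on₁₂ = subst (AtVertex x) (sym (τ₁-involutive (τ₂ x))) on₂
    step₁ {x} on₂₁₂ = subst (AtVertex x) (sym (trans (cong τ₁ (sym (braid x))) (τ₁-involutive (τ₂ (τ₁ x))))) on₂₁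

  private
    start : ∀ x → AtVertex x (proj₁ x , false)
    start (d , false) = on
    start (d , true) = on₂

    both : ∀ {x d} s → AtVertex x (d , false) → AtVertex x (d , s)
    both false a = a
    both true a = step₂ a

  atVertex : ∀ x y → vertexOf x ≡ vertexOf y → AtVertex x y
  atVertex x (d , s) eq = both s (rot-star {P = λ d → AtVertex x (d , false)} (step₂ ∘ step₁)
    (rotation-cyclic (proj₁ x) d eq) (start x))

  -- The three faces at a vertex are face x, opp x and opp (τ₁ x).
  face-atVertex : ∀ x y → vertexOf x ≡ vertexOf y → face y ≡ face x ⊎ face y ≡ opp x ⊎ face y ≡ opp (τ₁ x)
  face-atVertex x y eq with atVertex x y eq
  ... | on = inj₁ refl
  ... | on₂ = inj₂ (inj₁ refl)
  ... | on₁ = inj₁ (face-τ₁ x)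
  ... | on₂₁ = inj₂ (inj₂ refl)
  ... | on₁₂ = inj₂ (inj₁ (face-τ₁ (τ₂ x)))
  ... | on₂₁₂ = inj₂ (inj₂ (trans (cong face (sym (braid x))) (face-τ₁ (τ₂ (τ₁ x)))))

  flag-at : ∀ {e v} → Inc e v → ∃[ x ] (edgeOf x ≡ e × vertexOf x ≡ v)
  flag-at inc with d , eq , eq′ ← dart-at inc = (d , false) , eq , eq′

-- Connectivity of the surface cut along a set of edges

module Cutting {n : ℕ} (G : Graph n) (cubic : Cubic G) (M : Embedding G) where
  open Flags G cubic M public

  -- The curves considered meet the graph only in midpoints of edges, so the flags at a vertex
  -- always stay together and only `τ₀` can be blocked.
  data Link (B : Fin m → Set) : Flag G → Flag G → Set where
    link₁ : ∀ {x} → Link B x (τ₁ x)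
    link₂ : ∀ {x} → Link B x (τ₂ x)
    link₀ : ∀ {x} → ¬ B (edgeOf x) → Link B x (τ₀ x)

  Conn : (B : Fin m → Set) → Flag G → Flag G → Set
  Conn B = EqClosure (Link B)

  module _ {B : Fin m → Set} where
    conn-sym : ∀ {x y} → Conn B x y → Conn B y x
    conn-sym = EqClosure.symmetric _

    conn₁ : ∀ {x} → Conn B x (τ₁ x)
    conn₁ = fwd link₁ ◅ ε

    conn₂ : ∀ {x} → Conn B x (τ₂ x)
    conn₂ = fwd link₂ ◅ ε

    conn₀ : ∀ {x} → ¬ B (edgeOf x) → Conn B x (τ₀ x)
    conn₀ ¬b = fwd (link₀ ¬b) ◅ ε

    conn-vertex : ∀ x y → vertexOf x ≡ vertexOf y → Conn B x y
    conn-vertex x y eq with atVertex x y eq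
    ... | on = ε
    ... | on₂ = conn₂
    ... | on₁ = conn₁
    ... | on₂₁ = conn₁ ◅◅ conn₂
    ... | on₁₂ = conn₂ ◅◅ conn₁
    ... | on₂₁₂ = conn₂ ◅◅ conn₁ ◅◅ conn₂

    -- As `τ₂` is never blocked, a connection between the ends of an edge on one side serves the
    -- other side too.
    conn-edge : ∀ x y → edgeOf x ≡ edgeOf y → Conn B x (τ₀ x) → Conn B y (τ₀ y)
    conn-edge x y eq c with onEdge x y eq
    ... | at = c
    ... | at₀ = subst (Conn B (τ₀ x)) (sym (τ₀-involutive x)) (conn-sym c)
    ... | at₂ = conn-sym conn₂ ◅◅ c ◅◅ subst (Conn B (τ₀ x)) (sym (τ₀τ₂-comm x)) conn₂
    ... | at₂₀ = conn-sym conn₂ ◅◅ conn-sym c ◅◅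
      subst (Conn B x) (trans (cong τ₂ (sym (τ₀-involutive x))) (sym (τ₀τ₂-comm (τ₀ x)))) conn₂

    conn-all : (∀ x → Conn B x (τ₀ x)) → ∀ x y → Conn B x y
    conn-all c₀ x y = go (connected x y)
      where
      step : ∀ {x y} → τ₀ x ≡ y ⊎ τ₁ x ≡ y ⊎ τ₂ x ≡ y → Conn B x y
      step (inj₁ refl) = c₀ _
      step (inj₂ (inj₁ refl)) = conn₁
      step (inj₂ (inj₂ refl)) = conn₂
      go : ∀ {x y} → EqClosure (λ a b → τ₀ a ≡ b ⊎ τ₁ a ≡ b ⊎ τ₂ a ≡ b) x y → Conn B x y
      go ε = ε
      go (fwd s ◅ rest) = step s ◅◅ go rest
      go (bwd s ◅ rest) = conn-sym (step s) ◅◅ go rest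

  at-edge-injective : ∀ {x y} → at-edge {M = M} x ≡ at-edge y → x ≡ y
  at-edge-injective refl = refl

  ≈-point : ∀ {s t} → _≈_ G M s t → point G M s ≡ point G M t
  ≈-point same = refl
  ≈-point {at-vertex x} vertex = cong inj₁ (sym (vertex-τ₁ x))
  ≈-point edge = refl

  -- Blocking every passage along the edges in `B` cuts at least as much as the curve does, so
  -- connectedness after blocking implies connectedness off the curve.
  noncontractible : ∀ {k} .{{_ : ℕ.NonZero k}} (C : Curve G M k) {B : Fin m → Set} →
    (∀ i → ∃[ e ] (B e × point G M (Curve.enter C i) ≡ inj₂ e)) →
    (∀ i → ∃[ e ] (B e × point G M (Curve.leave C i) ≡ inj₂ e)) →
    (∀ x y → Conn B x y) → Noncontractible G M C
  noncontractible C {B} enter-edge leave-edge conn x y = EqClosure.map cut (conn x y)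
    where
    not-vertex : ∀ {s x} → _≈_ G M s (at-vertex x) → ¬ (∃[ e ] (B e × point G M s ≡ inj₂ e))
    not-vertex s≈ (_ , _ , eq) with trans (sym eq) (≈-point s≈)
    ... | ()
    blocked : ∀ {s x} → _≈_ G M s (at-edge x) → ∃[ e ] (B e × point G M s ≡ inj₂ e) → B (edgeOf x)
    blocked s≈ (_ , b , eq) = subst B (inj₂-injective (trans (sym eq) (≈-point s≈))) b
    cut : ∀ {x y} → Link B x y → Uncut G M C x y
    cut link₁ = across-vertex λ where
      (i , inj₁ s≈) → not-vertex s≈ (enter-edge i)
      (i , inj₂ s≈) → not-vertex s≈ (leave-edge i)
    cut link₂ = across-edge
    cut (link₀ ¬b) = across-mid λ where
      (i , inj₁ s≈) → ¬b (blocked s≈ (enter-edge i))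
      (i , inj₂ s≈) → ¬b (blocked s≈ (leave-edge i))

-- Faces across an edge, boundary walks, and triangles of faces

module Tight {n : ℕ} (G : Graph n) (cubic : Cubic G) (bridgeless : Bridgeless G)
             (M : Embedding G) (rep : RepresentativityAtLeast G M 4) where
  open Cutting G cubic M public

  -- If both sides of an edge were the same face, a curve inside that face would cross the graph
  -- only there. The edge is not a bridge, so its ends are joined without it and the curve does not
  -- separate, although it meets the graph in a single point.
  opp≢face : ∀ x → opp x ≢ face x
  opp≢face x same-side = bridgeless (edgeOf x) λ joined →
    contradiction (rep 1 curve (noncontractible curve (λ _ → edgeOf x , refl , refl) (λ _ → edgeOf x , refl , refl)
      (conn-all (across joined)))) λ { (s≤s ()) }
    where
    curve : Curve G M 1
    curve = record
      { enter = λ _ → at-edge x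
      ; leave = λ _ → at-edge (τ₂ x)
      ; same-face = λ _ → sym same-side
      ; closed = λ _ → refl
      ; points-distinct = λ { {zero} {zero} _ → refl }
      ; faces-distinct = λ { {zero} {zero} _ → refl }
      ; no-backtrack = λ _ → no-backtrack
      }
      where
      no-backtrack : ¬ _≈_ G M (at-edge x) (at-edge (τ₂ x))
      no-backtrack back = go back refl refl
        where
        go : ∀ {s t} → _≈_ G M s t → s ≡ at-edge x → t ≡ at-edge (τ₂ x) → ⊥
        go same refl eq = τ₂-apart x (sym (at-edge-injective eq))
        go edge refl eq = τ₀τ₂-apart x (at-edge-injective eq)
    along : ∀ {u v} → JoinedBy G (_≢ edgeOf x) u v →
      ∀ a b → vertexOf a ≡ u → vertexOf b ≡ v → Conn (_≡ edgeOf x) a b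
    along ε a b eq eq′ = conn-vertex a b (trans eq (sym eq′))
    along (fwd (e , e≢ , refl , refl) ◅ rest) a b eq eq′ =
      conn-vertex a ((e , false) , false) eq ◅◅ conn₀ e≢ ◅◅ along rest (τ₀ ((e , false) , false)) b refl eq′
    along (bwd (e , e≢ , refl , refl) ◅ rest) a b eq eq′ =
      conn-vertex a ((e , true) , false) eq ◅◅ conn₀ e≢ ◅◅ along rest (τ₀ ((e , true) , false)) b refl eq′
    across : JoinedBy G (_≢ edgeOf x) (src (edgeOf x)) (tgt (edgeOf x)) → ∀ y → Conn (_≡ edgeOf x) y (τ₀ y)
    across joined y with edgeOf y Fin.≟ edgeOf x
    ... | no e≢ = conn₀ e≢
    across joined ((e , false) , s) | yes refl = along joined _ _ refl refl
    across joined ((e , true) , s) | yes refl = conn-sym (along joined _ _ refl refl)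

  face-onEdge : ∀ x y → edgeOf x ≡ edgeOf y → face y ≡ face x ⊎ face y ≡ opp x
  face-onEdge x y eq with onEdge x y eq
  ... | at = inj₁ refl
  ... | at₀ = inj₁ (face-τ₀ x)
  ... | at₂ = inj₂ refl
  ... | at₂₀ = inj₂ (opp-τ₀ x)

  onEdge-face : ∀ x y → edgeOf x ≡ edgeOf y → face x ≡ face y → y ≡ x ⊎ y ≡ τ₀ x
  onEdge-face x y eq eq′ with onEdge x y eq
  ... | at = inj₁ refl
  ... | at₀ = inj₂ refl
  ... | at₂ = contradiction (sym eq′) (opp≢face x)
  ... | at₂₀ = contradiction (trans (sym (opp-τ₀ x)) (sym eq′)) (opp≢face x)

  -- The boundary walk of a face

  next : Flag G → Flag G
  next x = τ₁ (τ₀ x)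

  ring : Flag G → ℕ → Flag G
  ring x zero = x
  ring x (suc i) = next (ring x i)

  next-injective : ∀ {x y} → next x ≡ next y → x ≡ y
  next-injective {x} {y} eq = begin
    x                      ≡⟨ back x ⟨
    τ₀ (τ₁ (τ₁ (τ₀ x)))    ≡⟨ cong (τ₀ ∘ τ₁) eq ⟩
    τ₀ (τ₁ (τ₁ (τ₀ y)))    ≡⟨ back y ⟩
    y                      ∎
    where
    open ≡-Reasoning
    back : ∀ x → τ₀ (τ₁ (τ₁ (τ₀ x))) ≡ x
    back x = trans (cong τ₀ (τ₁-involutive (τ₀ x))) (τ₀-involutive x)

  face-next : ∀ x → face (next x) ≡ face x
  face-next x = trans (face-τ₁ (τ₀ x)) (face-τ₀ x)

  face-ring : ∀ x i → face (ring x i) ≡ face x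
  face-ring x zero = refl
  face-ring x (suc i) = trans (face-next (ring x i)) (face-ring x i)

  ring-+ : ∀ x i j → ring x (i + j) ≡ ring (ring x j) i
  ring-+ x zero j = refl
  ring-+ x (suc i) j = cong next (ring-+ x i j)

  ring-suc : ∀ x i → ring x (suc i) ≡ ring (next x) i
  ring-suc x i = trans (cong (ring x) (ℕ.+-comm 1 i)) (ring-+ x i 1)

  ring-cancel : ∀ x i j → ring x (i + j) ≡ ring x i → ring x j ≡ x
  ring-cancel x zero j eq = eq
  ring-cancel x (suc i) j eq = ring-cancel x i j (next-injective eq)

  -- A walk from `x` to its mirror image `τ₀ x` can be shortened by a step at both ends at once,
  -- until a fixed point of `τ₀` or of `τ₁` is left.
  ring≢τ₀ : ∀ i x → ring x i ≢ τ₀ x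
  ring≢τ₀ zero x eq = τ₀-apart x (sym eq)
  ring≢τ₀ (suc zero) x eq = τ₁-apart (τ₀ x) eq
  ring≢τ₀ (suc (suc i)) x eq = ring≢τ₀ i (next x) (begin
    ring (next x) i               ≡⟨ ring-suc x i ⟨
    ring x (suc i)                ≡⟨ τ₀-involutive _ ⟨
    τ₀ (τ₀ (ring x (suc i)))      ≡⟨ cong τ₀ (τ₁-involutive _) ⟨
    τ₀ (τ₁ (ring x (2 + i)))      ≡⟨ cong (τ₀ ∘ τ₁) eq ⟩
    τ₀ (next x)                   ∎)
    where open ≡-Reasoning

  record Period (x : Flag G) : Set where
    field
      size : ℕ
      size>0 : 0 < size
      ring-size : ring x size ≡ x
      minimal : ∀ {j} → 0 < j → j < size → ring x j ≢ x

  bit : Bool → Fin 2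
  bit false = zero
  bit true = suc zero

  bit-injective : ∀ b b′ → bit b ≡ bit b′ → b ≡ b′
  bit-injective false false _ = refl
  bit-injective true true _ = refl

  code : Flag G → Fin (m * 2 * 2)
  code ((e , b) , s) = Fin.combine (Fin.combine e (bit b)) (bit s)

  code-injective : ∀ x y → code x ≡ code y → x ≡ y
  code-injective ((e , b) , s) ((e′ , b′) , s′) eq
    with eq₁ , eq₂ ← Fin.combine-injective (Fin.combine e _) _ (Fin.combine e′ _) _ eq
    with eq₃ , eq₄ ← Fin.combine-injective e _ e′ _ eq₁ = cong₂ _,_ (cong₂ _,_ eq₃ (bit-injective b b′ eq₄)) (bit-injective s s′ eq₂)

  abstract
    period : ∀ x → Period x
    period x with Fin.pigeonhole (ℕ.n<1+n (m * 2 * 2)) (code ∘ ring x ∘ toℕ)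
    ... | i , j , i<j , eq with least (λ k → 0 ℕ.<? k ×-dec ring x k ≟ᶠ x) (toℕ j ℕ.∸ toℕ i)
           (ℕ.m<n⇒0<n∸m i<j , ring-cancel x (toℕ i) _ (trans (cong (ring x) (ℕ.m+[n∸m]≡n (ℕ.<⇒≤ i<j))) (sym (code-injective _ _ eq))))
    ... | k , _ , (k>0 , eq) , min = record
      { size = k ; size>0 = k>0 ; ring-size = eq ; minimal = λ j>0 j<k eq → min j<k (j>0 , eq) }

  module Ring (x : Flag G) where
    open Period (period x) public

    -- A face lies on one side of each of its edges only, so a second visit to an edge would be at
    -- the same flag, against minimality of the period, or at its mirror image, against `ring≢τ₀`.
    ring-distinct : ∀ {i j} → i < j → j < size → edgeOf (ring x i) ≢ edgeOf (ring x j)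
    ring-distinct {i} {j} i<j j<size eq
      with onEdge-face (ring x i) (ring x j) eq (trans (face-ring x i) (sym (face-ring x j)))
    ... | inj₁ equal = minimal (ℕ.m<n⇒0<n∸m i<j) (ℕ.≤-<-trans (ℕ.m∸n≤m j i) j<size)
      (ring-cancel x i (j ℕ.∸ i) (trans (cong (ring x) (ℕ.m+[n∸m]≡n (ℕ.<⇒≤ i<j))) equal))
    ... | inj₂ mirror = ring≢τ₀ (j ℕ.∸ i) (ring x i)
      (trans (sym (ring-+ x (j ℕ.∸ i) i)) (trans (cong (ring x) (ℕ.m∸n+n≡m (ℕ.<⇒≤ i<j))) mirror))

    -- The walk meets one of the two flags of the face at each edge; together with the images under
    -- `τ₀` the set is closed under `τ₀` and `τ₁`, hence is the whole face.
    OnRing : Flag G → Set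
    OnRing y = ∃[ i ] (i < size × (y ≡ ring x i ⊎ y ≡ τ₀ (ring x i)))

    onRing₀ : ∀ {y} → OnRing y → OnRing (τ₀ y)
    onRing₀ (i , i< , inj₁ refl) = i , i< , inj₂ refl
    onRing₀ (i , i< , inj₂ refl) = i , i< , inj₁ (τ₀-involutive _)

    pred-ring : ∀ i → i < size → ∃[ j ] (j < size × next (ring x j) ≡ ring x i)
    pred-ring (suc i) i< = i , ℕ.<-trans (ℕ.n<1+n i) i< , refl
    pred-ring zero i< = ℕ.pred size , ℕ.≤-reflexive suc-pred , trans (cong (ring x) suc-pred) ring-size
      where
      suc-pred : suc (ℕ.pred size) ≡ size
      suc-pred = ℕ.suc-pred size ⦃ ℕ.>-nonZero size>0 ⦄

    onRing₁ : ∀ {y} → OnRing y → OnRing (τ₁ y)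
    onRing₁ (i , i< , inj₁ refl) with j , j< , eq ← pred-ring i i< =
      j , j< , inj₂ (trans (cong τ₁ (sym eq)) (τ₁-involutive _))
    onRing₁ (i , i< , inj₂ refl) with suc i ℕ.<? size
    ... | yes si< = suc i , si< , inj₁ refl
    ... | no si≮ = 0 , size>0 , inj₁ (trans (cong (ring x) (ℕ.≤-antisym i< (ℕ.≮⇒≥ si≮))) ring-size)

    onRing : ∀ y → face y ≡ face x → OnRing y
    onRing y eq = go (Equivalence.to (face-orbits x y) (sym eq)) (0 , size>0 , inj₁ refl)
      where
      go : ∀ {y z} → EqClosure (λ a b → τ₀ a ≡ b ⊎ τ₁ a ≡ b) y z → OnRing y → OnRing z
      go ε r = r
      go (fwd (inj₁ refl) ◅ rest) r = go rest (onRing₀ r)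
      go (fwd (inj₂ refl) ◅ rest) r = go rest (onRing₁ r)
      go (bwd (inj₁ refl) ◅ rest) r = go rest (subst OnRing (τ₀-involutive _) (onRing₀ r))
      go (bwd (inj₂ refl) ◅ rest) r = go rest (subst OnRing (τ₁-involutive _) (onRing₁ r))

    opp-onRing : ∀ y → face y ≡ face x → ∃[ i ] (i < size × opp (ring x i) ≡ opp y)
    opp-onRing y eq with onRing y eq
    ... | i , i< , inj₁ refl = i , i< , refl
    ... | i , i< , inj₂ refl = i , i< , sym (opp-τ₀ _)

    module _ {B : Fin m → Set} where
      Open : ℕ → Set
      Open i = Conn B (ring x i) (τ₀ (ring x i))

      conn-step : ∀ i → Open i → Conn B (ring x i) (ring x (suc i))
      conn-step i c = c ◅◅ conn₁

      conn-arc : ∀ i k → (∀ j → i ≤ j → j < i + k → Open j) → Conn B (ring x i) (ring x (i + k))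
      conn-arc i zero _ = subst (λ j → Conn B (ring x i) (ring x j)) (sym (ℕ.+-identityʳ i)) ε
      conn-arc i (suc k) opens = subst (λ j → Conn B (ring x i) (ring x j)) (sym (ℕ.+-suc i k))
        (conn-arc i k (λ j i≤j j< → opens j i≤j (ℕ.<-≤-trans j< (ℕ.+-monoʳ-≤ i (ℕ.n≤1+n k)))) ◅◅
         conn-step (i + k) (opens (i + k) (ℕ.m≤m+n i k) (ℕ.+-monoʳ-< i (ℕ.n<1+n k))))

      conn-between : ∀ {i j} → i ≤ j → (∀ k → i ≤ k → k < j → Open k) → Conn B (ring x i) (ring x j)
      conn-between {i} {j} i≤j opens = subst (λ l → Conn B (ring x i) (ring x l)) (ℕ.m+[n∸m]≡n i≤j)
        (conn-arc i (j ℕ.∸ i) (λ k i≤k k< → opens k i≤k (subst (k <_) (ℕ.m+[n∸m]≡n i≤j) k<)))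

  -- One edge of a face may be crossed by going around the face the other way.
  conn-round : ∀ {B} y → (∀ z → face z ≡ face y → edgeOf z ≢ edgeOf y → Conn B z (τ₀ z)) → Conn B y (τ₀ y)
  conn-round y others = conn-sym (conn₁ ◅◅
    subst (Conn _ (ring y 1)) ring-size (conn-between size>0 λ k 0<k k<size →
      others (ring y k) (face-ring y k) (ring-distinct 0<k k<size ∘ sym)))
    where open Ring y

  -- If the two ends of one crossed edge are connected off the curve, then going around the three
  -- faces connects everything, so the curve does not separate.
  module Triangle (a b c : Flag G) (ab : opp a ≡ face b) (bc : opp b ≡ face c) (ca : opp c ≡ face a)
                  (a≢c : face a ≢ face c) where

    Crossed : Fin m → Set
    Crossed e = e ≡ edgeOf a ⊎ e ≡ edgeOf b ⊎ e ≡ edgeOf c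

    private
      fa≢fb : face a ≢ face b
      fa≢fb eq = opp≢face a (trans ab (sym eq))
      fb≢fc : face b ≢ face c
      fb≢fc eq = opp≢face b (trans bc (sym eq))

      a≢b : edgeOf a ≢ edgeOf b
      a≢b eq with face-onEdge a (τ₂ b) eq
      ... | inj₁ p = a≢c (trans (sym p) bc)
      ... | inj₂ p = fb≢fc (trans (sym ab) (trans (sym p) bc))
      b≢c : edgeOf b ≢ edgeOf c
      b≢c eq with face-onEdge b (τ₂ c) eq
      ... | inj₁ p = fa≢fb (trans (sym ca) p)
      ... | inj₂ p = a≢c (trans (sym ca) (trans p bc))
      c≢a : edgeOf c ≢ edgeOf a
      c≢a eq with face-onEdge c (τ₂ a) eq
      ... | inj₁ p = fb≢fc (trans (sym ab) p)
      ... | inj₂ p = fa≢fb (trans (sym ca) (trans (sym p) ab))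

      enter leave : Fin 3 → Spoke G M
      enter zero = at-edge (τ₂ c)
      enter (suc zero) = at-edge (τ₂ a)
      enter (suc (suc zero)) = at-edge (τ₂ b)
      leave zero = at-edge a
      leave (suc zero) = at-edge b
      leave (suc (suc zero)) = at-edge c

      same-face : ∀ i → spokeFace G M (enter i) ≡ spokeFace G M (leave i)
      same-face zero = ca
      same-face (suc zero) = ab
      same-face (suc (suc zero)) = bc

      closed : ∀ i → point G M (leave i) ≡ point G M (enter (suc (toℕ i) mod 3))
      closed zero = refl
      closed (suc zero) = refl
      closed (suc (suc zero)) = refl

      points-distinct : ∀ i j → point G M (enter i) ≡ point G M (enter j) → i ≡ j
      points-distinct zero zero _ = refl
      points-distinct (suc zero) (suc zero) _ = refl
      points-distinct (suc (suc zero)) (suc (suc zero)) _ = refl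
      points-distinct zero (suc zero) eq = contradiction (inj₂-injective eq) c≢a
      points-distinct zero (suc (suc zero)) eq = contradiction (sym (inj₂-injective eq)) b≢c
      points-distinct (suc zero) zero eq = contradiction (sym (inj₂-injective eq)) c≢a
      points-distinct (suc zero) (suc (suc zero)) eq = contradiction (inj₂-injective eq) a≢b
      points-distinct (suc (suc zero)) zero eq = contradiction (inj₂-injective eq) b≢c
      points-distinct (suc (suc zero)) (suc zero) eq = contradiction (sym (inj₂-injective eq)) a≢b

      faces-distinct : ∀ i j → spokeFace G M (enter i) ≡ spokeFace G M (enter j) → i ≡ j
      faces-distinct zero zero _ = refl
      faces-distinct (suc zero) (suc zero) _ = refl
      faces-distinct (suc (suc zero)) (suc (suc zero)) _ = refl
      faces-distinct zero (suc zero) eq = contradiction (trans (sym ca) (trans eq ab)) fa≢fb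
      faces-distinct zero (suc (suc zero)) eq = contradiction (trans (sym ca) (trans eq bc)) a≢c
      faces-distinct (suc zero) zero eq = contradiction (trans (sym ca) (trans (sym eq) ab)) fa≢fb
      faces-distinct (suc zero) (suc (suc zero)) eq = contradiction (trans (sym ab) (trans eq bc)) fb≢fc
      faces-distinct (suc (suc zero)) zero eq = contradiction (trans (sym ca) (trans (sym eq) bc)) a≢c
      faces-distinct (suc (suc zero)) (suc zero) eq = contradiction (trans (sym ab) (trans (sym eq) bc)) fb≢fc

      no-backtrack : ∀ i → ¬ _≈_ G M (enter i) (leave i)
      no-backtrack zero = c≢a ∘ inj₂-injective ∘ ≈-point
      no-backtrack (suc zero) = a≢b ∘ inj₂-injective ∘ ≈-point
      no-backtrack (suc (suc zero)) = b≢c ∘ inj₂-injective ∘ ≈-point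

      curve : Curve G M 3
      curve = record
        { enter = enter ; leave = leave ; same-face = same-face ; closed = closed
        ; points-distinct = λ {i} {j} → points-distinct i j ; faces-distinct = λ {i} {j} → faces-distinct i j
        ; no-backtrack = no-backtrack }

    separated : ¬ Conn Crossed a (τ₀ a)
    separated crossing-a = contradiction (rep 3 curve (noncontractible curve
      (λ { zero → edgeOf c , inj₂ (inj₂ refl) , refl
         ; (suc zero) → edgeOf a , inj₁ refl , refl
         ; (suc (suc zero)) → edgeOf b , inj₂ (inj₁ refl) , refl })
      (λ { zero → edgeOf a , inj₁ refl , refl
         ; (suc zero) → edgeOf b , inj₂ (inj₁ refl) , refl
         ; (suc (suc zero)) → edgeOf c , inj₂ (inj₂ refl) , refl })
      (conn-all all))) λ { (s≤s (s≤s (s≤s ()))) }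
      where
      -- On the boundary of `face a` only the edges of `a` and `c` are crossed. The first is
      -- passable by assumption, so going around the face connects the ends of the second; then
      -- `face b` does the same for the edge of `b`.
      crossing-c : Conn Crossed (τ₂ c) (τ₀ (τ₂ c))
      crossing-c = conn-round (τ₂ c) λ z z-face z≢c → case (edgeOf z Fin.≟ edgeOf a) , (edgeOf z Fin.≟ edgeOf b) of λ where
        (yes z≡a , _) → conn-edge a z (sym z≡a) crossing-a
        (_ , yes z≡b) → ⊥-elim (case face-onEdge b z (sym z≡b) of λ where
          (inj₁ p) → fa≢fb (trans (sym ca) (trans (sym z-face) p))
          (inj₂ p) → a≢c (trans (sym ca) (trans (sym z-face) (trans p bc))))
        (no z≢a , no z≢b) → conn₀ λ { (inj₁ p) → z≢a p ; (inj₂ (inj₁ p)) → z≢b p ; (inj₂ (inj₂ p)) → z≢c p }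
      crossing-b : Conn Crossed b (τ₀ b)
      crossing-b = conn-round b λ z _ z≢b → case (edgeOf z Fin.≟ edgeOf a) , (edgeOf z Fin.≟ edgeOf c) of λ where
        (yes z≡a , _) → conn-edge a z (sym z≡a) crossing-a
        (_ , yes z≡c) → conn-edge (τ₂ c) z (sym z≡c) crossing-c
        (no z≢a , no z≢c) → conn₀ λ { (inj₁ p) → z≢a p ; (inj₂ (inj₁ p)) → z≢b p ; (inj₂ (inj₂ p)) → z≢c p }
      all : ∀ z → Conn Crossed z (τ₀ z)
      all z with edgeOf z Fin.≟ edgeOf a | edgeOf z Fin.≟ edgeOf b | edgeOf z Fin.≟ edgeOf c
      ... | yes z≡a | _ | _ = conn-edge a z (sym z≡a) crossing-a
      ... | _ | yes z≡b | _ = conn-edge b z (sym z≡b) crossing-b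
      ... | _ | _ | yes z≡c = conn-edge (τ₂ c) z (sym z≡c) crossing-c
      ... | no z≢a | no z≢b | no z≢c = conn₀ λ { (inj₁ p) → z≢a p ; (inj₂ (inj₁ p)) → z≢b p ; (inj₂ (inj₂ p)) → z≢c p }

  Adj : Fin φ → Fin φ → Set
  Adj f g = ∃[ x ] (face x ≡ f × opp x ≡ g)

  adj-sym : ∀ {f g} → Adj f g → Adj g f
  adj-sym (x , eq , eq′) = τ₂ x , eq′ , trans (opp-τ₂ x) eq

  adj-irrefl : ∀ {f} → ¬ Adj f f
  adj-irrefl (x , eq , eq′) = opp≢face x (trans eq′ (sym eq))

  anyFlag? : {P : Flag G → Set} → (∀ x → Dec (P x)) → Dec (∃ P)
  anyFlag? P? with Fin.any? (λ e → (P? ((e , false) , false) ⊎-dec P? ((e , false) , true)) ⊎-dec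
                                    (P? ((e , true) , false) ⊎-dec P? ((e , true) , true)))
  ... | yes (e , inj₁ (inj₁ p)) = yes (_ , p)
  ... | yes (e , inj₁ (inj₂ p)) = yes (_ , p)
  ... | yes (e , inj₂ (inj₁ p)) = yes (_ , p)
  ... | yes (e , inj₂ (inj₂ p)) = yes (_ , p)
  ... | no none = no λ where
    (((e , false) , false) , p) → none (e , inj₁ (inj₁ p))
    (((e , false) , true) , p) → none (e , inj₁ (inj₂ p))
    (((e , true) , false) , p) → none (e , inj₂ (inj₁ p))
    (((e , true) , true) , p) → none (e , inj₂ (inj₂ p))

  abstract
    adj? : ∀ f g → Dec (Adj f g)
    adj? f g = anyFlag? λ x → face x Fin.≟ f ×-dec opp x Fin.≟ g

  -- The third edge at the cubic vertex between two consecutive boundary edges lies between the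
  -- faces beyond them.
  adj-next : ∀ x → Adj (opp x) (opp (next x))
  adj-next x = y , trans (face-τ₁ (τ₂ (τ₀ x))) (opp-τ₀ x) ,
    trans (cong face (sym (braid (τ₀ x)))) (face-τ₁ (τ₂ (τ₁ (τ₀ x))))
    where y = τ₁ (τ₂ (τ₀ x))

-- Neighbourhoods of faces

module Links {n : ℕ} (G : Graph n) (cubic : Cubic G) (bridgeless : Bridgeless G)
             (M : Embedding G) (rep : RepresentativityAtLeast G M 4) where
  open Tight G cubic bridgeless M rep public

  LinkColouring : Fin φ → (Fin φ → Fin 3) → Set
  LinkColouring f κ = ∀ {g h} → Adj f g → Adj f h → Adj g h → κ g ≢ κ h

  module Around (x : Flag G) where
    open Ring x public

    w : ℕ → Fin φ
    w i = opp (ring x i)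

    w≢ : ∀ i → w i ≢ face x
    w≢ i eq = opp≢face (ring x i) (trans eq (sym (face-ring x i)))

    adj-w : ∀ i → Adj (face x) (w i)
    adj-w i = ring x i , face-ring x i , refl

    -- The curve runs through `face x`, `w P` and `w Q` and crosses the boundary of `face x` at
    -- positions `P` and `Q`, so the positions strictly between these are cut off from the others.
    module Separate {P Q : ℕ} (P<Q : P < Q) (Q<size : Q < size) (uv : Adj (w P) (w Q)) where

      Avoid : Fin φ → Set
      Avoid k = k ≢ face x × k ≢ w P × k ≢ w Q

      AvoidAdj : Fin φ → Fin φ → Set
      AvoidAdj k k′ = Avoid k × Avoid k′ × Adj k k′

      private
        b = proj₁ uv
        face-b = proj₁ (proj₂ uv)
        opp-b = proj₂ (proj₂ uv)
        c = τ₂ (ring x Q)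

      open Triangle (ring x P) b c (sym face-b) opp-b (trans (opp-τ₂ (ring x Q)) (trans (face-ring x Q) (sym (face-ring x P))))
                    (λ eq → w≢ Q (trans (sym eq) (face-ring x P)))

      avoid-edge : ∀ y → Avoid (face y) → ¬ Crossed (edgeOf y)
      avoid-edge y (≢f , ≢u , ≢v) (inj₁ eq) with face-onEdge (ring x P) y (sym eq)
      ... | inj₁ p = ≢f (trans p (face-ring x P))
      ... | inj₂ p = ≢u p
      avoid-edge y (≢f , ≢u , ≢v) (inj₂ (inj₁ eq)) with face-onEdge b y (sym eq)
      ... | inj₁ p = ≢u (trans p face-b)
      ... | inj₂ p = ≢v (trans p opp-b)
      avoid-edge y (≢f , ≢u , ≢v) (inj₂ (inj₂ eq)) with face-onEdge (ring x Q) y (sym eq)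
      ... | inj₁ p = ≢f (trans p (face-ring x Q))
      ... | inj₂ p = ≢v p

      open-at : ∀ k → k < size → k ≢ P → k ≢ Q → Open {Crossed} k
      open-at k k<size k≢P k≢Q = conn₀ λ where
          (inj₁ eq) → distinct k≢P (ℕ.<-trans P<Q Q<size) eq
          (inj₂ (inj₁ eq)) → case face-onEdge b (ring x k) (sym eq) of λ where
            (inj₁ p) → w≢ P (trans (sym face-b) (trans (sym p) (face-ring x k)))
            (inj₂ p) → w≢ Q (trans (sym opp-b) (trans (sym p) (face-ring x k)))
          (inj₂ (inj₂ eq)) → distinct k≢Q Q<size eq
        where
        distinct : ∀ {j} → k ≢ j → j < size → edgeOf (ring x k) ≢ edgeOf (ring x j)
        distinct {j} k≢j j<size with ℕ.<-cmp k j
        ... | tri< k<j _ _ = ring-distinct k<j j<size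
        ... | tri≈ _ k≡j _ = contradiction k≡j k≢j
        ... | tri> _ _ j<k = ring-distinct j<k k<size ∘ sym

      conn-face : ∀ {y y′} → Avoid (face y) → face y ≡ face y′ → Conn Crossed y y′
      conn-face {y} {y′} av eq = go refl (Equivalence.to (face-orbits y y′) eq)
        where
        step : ∀ {a b} → face a ≡ face y → τ₀ a ≡ b ⊎ τ₁ a ≡ b → Conn Crossed a b
        step {a} eq (inj₁ refl) = conn₀ (avoid-edge a (subst Avoid (sym eq) av))
        step eq (inj₂ refl) = conn₁
        same-face : ∀ {a b} → τ₀ a ≡ b ⊎ τ₁ a ≡ b → face a ≡ face b
        same-face (inj₁ refl) = sym (face-τ₀ _)
        same-face (inj₂ refl) = sym (face-τ₁ _)
        go : ∀ {a b} → face a ≡ face y → EqClosure (λ a b → τ₀ a ≡ b ⊎ τ₁ a ≡ b) a b → Conn Crossed a b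
        go _ ε = ε
        go eq (fwd s ◅ rest) = step eq s ◅◅ go (trans (sym (same-face s)) eq) rest
        go eq (bwd s ◅ rest) = conn-sym (step (trans (same-face s) eq) s) ◅◅ go (trans (same-face s) eq) rest

      conn-chain : ∀ {k k′} → Avoid k → Star AvoidAdj k k′ →
        ∀ {y y′} → face y ≡ k → face y′ ≡ k′ → Conn Crossed y y′
      conn-chain av ε eq eq′ = conn-face (subst Avoid (sym eq) av) (trans eq (sym eq′))
      conn-chain av ((_ , av′ , z , eq₁ , eq₂) ◅ chain) eq eq′ =
        conn-face (subst Avoid (sym eq) av) (trans eq (sym eq₁)) ◅◅ conn₂ ◅◅ conn-chain av′ chain eq₂ eq′

      -- A chain of faces avoiding the curve would join position `A` to position `B`. The boundary
      -- of `face x` leads from the one end of the edge at `P` to `A`, and from `B` to the other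
      -- end, passing the start of the walk if `B` comes after `Q`. The two ends of a crossed edge
      -- would then be connected.
      no-chain : ∀ {A B} → P < A → A < Q → B < P ⊎ (Q < B × B < size) →
        Avoid (w A) → ¬ Star AvoidAdj (w A) (w B)
      no-chain {A} {B} P<A A<Q outside av chain = separated
        (conn-sym (from-B outside) ◅◅ conn-sym (conn₂ ◅◅ conn-chain av chain refl refl ◅◅ conn-sym conn₂) ◅◅ conn-sym to-A)
        where
        A<size = ℕ.<-trans A<Q Q<size
        to-A : Conn Crossed (τ₀ (ring x P)) (ring x A)
        to-A = conn₁ ◅◅ conn-between P<A λ k P<k k<A →
          open-at k (ℕ.<-trans k<A A<size) (ℕ.>⇒≢ P<k) (ℕ.<⇒≢ (ℕ.<-trans k<A A<Q))
        from-B : B < P ⊎ (Q < B × B < size) → Conn Crossed (ring x B) (ring x P)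
        from-B (inj₁ B<P) = conn-between (ℕ.<⇒≤ B<P) λ k _ k<P →
          open-at k (ℕ.<-trans k<P (ℕ.<-trans P<Q Q<size)) (ℕ.<⇒≢ k<P) (ℕ.<⇒≢ (ℕ.<-trans k<P P<Q))
        from-B (inj₂ (Q<B , B<size)) =
          subst (Conn Crossed (ring x B)) ring-size (conn-between (ℕ.<⇒≤ B<size) λ k B≤k k<size →
            let Q<k = ℕ.<-≤-trans Q<B B≤k in
            open-at k k<size (ℕ.>⇒≢ (ℕ.<-trans P<Q Q<k)) (ℕ.>⇒≢ Q<k)) ◅◅
          conn-between z≤n λ k _ k<P →
            open-at k (ℕ.<-trans k<P (ℕ.<-trans P<Q Q<size)) (ℕ.<⇒≢ k<P) (ℕ.<⇒≢ (ℕ.<-trans k<P P<Q))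

    -- One position on the boundary walk for each neighbouring face.

    First : ℕ → Set
    First i = ∀ {j} → j < i → w j ≢ w i

    first? : Unary.Decidable First
    first? i = ℕ.allUpTo? (λ j → ¬? (w j Fin.≟ w i)) i

    abstract
      S : List ℕ
      S = filter first? (List.upTo size)

      S-size : ∀ {i} → i ∈ S → i < size
      S-size i∈ = ∈-upTo⁻ (proj₁ (∈-filter⁻ first? {xs = List.upTo size} i∈))

      S-first : ∀ {i} → i ∈ S → First i
      S-first i∈ = proj₂ (∈-filter⁻ first? {xs = List.upTo size} i∈)

      S⁺ : ∀ {i} → i < size → First i → i ∈ S
      S⁺ i<size first = ∈-filter⁺ first? (∈-upTo⁺ i<size) first

      S-sorted : AllPairs _<_ S
      S-sorted = AllPairs.filter⁺ first? (AllPairs.applyUpTo⁺₁ id size (λ i<j _ → i<j))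

    S-injective : ∀ {i j} → i ∈ S → j ∈ S → w i ≡ w j → i ≡ j
    S-injective {i} {j} i∈ j∈ eq with ℕ.<-cmp i j
    ... | tri< i<j _ _ = contradiction eq (S-first j∈ i<j)
    ... | tri≈ _ i≡j _ = i≡j
    ... | tri> _ _ j<i = contradiction (sym eq) (S-first i∈ j<i)

    position : ∀ {g} → Adj (face x) g → ∃[ i ] (i ∈ S × w i ≡ g)
    position {g} (y , face-y , opp-y) with i , i<size , eq ← opp-onRing y face-y
      with l , l≤i , wl , first ← least (λ j → w j Fin.≟ g) i (trans eq opp-y) =
      l , S⁺ (ℕ.≤-<-trans l≤i i<size) (λ j<l eq → first j<l (trans eq wl)) , wl

    neighbours : List (Fin φ)
    neighbours = map w S

    ∈-neighbours : ∀ {g} → Adj (face x) g → g ∈ neighbours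
    ∈-neighbours adj with i , i∈ , refl ← position adj = ∈-map⁺ w i∈

    abstract
      pos : Fin φ → ℕ
      pos g with adj? (face x) g
      ... | yes adj = proj₁ (position adj)
      ... | no _ = 0

      pos∈ : ∀ {g} → Adj (face x) g → pos g ∈ S
      pos∈ {g} adj with adj? (face x) g
      ... | yes adj′ = proj₁ (proj₂ (position adj′))
      ... | no ¬adj = contradiction adj ¬adj

      w-pos : ∀ {g} → Adj (face x) g → w (pos g) ≡ g
      w-pos {g} adj with adj? (face x) g
      ... | yes adj′ = proj₂ (proj₂ (position adj′))
      ... | no ¬adj = contradiction adj ¬adj

    pos-w : ∀ {i} → i ∈ S → pos (w i) ≡ i
    pos-w {i} i∈ = S-injective (pos∈ (adj-w i)) i∈ (w-pos (adj-w i))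

    E : ℕ → ℕ → Set
    E i j = Adj (w i) (w j)

    open Chords E (λ i j → adj? (w i) (w j)) adj-sym adj-irrefl public

    -- A chord from `b` to `d` is a chain of length one across the triangle on `a` and `c`. Distinct
    -- positions in `S` name distinct faces, so the chain avoids the triangle.
    noncrossing : Noncrossing S
    noncrossing {a} {b} {c} {d} a∈ b∈ c∈ d∈ a<b b<c c<d Eac Ebd =
      no-chain a<b b<c (inj₂ (c<d , S-size d∈)) av-b ((av-b , av-d , Ebd) ◅ ε)
      where
      open Separate (ℕ.<-trans a<b b<c) (S-size c∈) Eac
      av-b : Avoid (w b)
      av-b = w≢ b , S-first b∈ a<b ∘ sym , S-first c∈ b<c
      av-d : Avoid (w d)
      av-d = w≢ d , S-first d∈ (ℕ.<-trans a<b (ℕ.<-trans b<c c<d)) ∘ sym , S-first d∈ c<d ∘ sym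

    linkColouring : (col : ℕ → Fin 3) → Proper S col → LinkColouring (face x) (col ∘ pos)
    linkColouring col proper fg fh gh =
      proper (pos∈ fg) (pos∈ fh) (subst₂ Adj (sym (w-pos fg)) (sym (w-pos fh)) gh)

    abstract
      S-colouring : ∃ (Proper S)
      S-colouring = colouring (length S) S ℕ.≤-refl noncrossing

  abstract
    colour-link : ∀ f → ∃ (LinkColouring f)
    colour-link f with x , refl ← face-base f =
      _ , Around.linkColouring x (proj₁ (Around.S-colouring x)) (proj₂ (Around.S-colouring x))

  Onto : Fin φ → (Fin φ → Fin 3) → Set
  Onto f κ = ∀ j → ∃[ k ] (Adj f k × κ k ≡ j)

  Rich : Fin φ → Set
  Rich f = ∃[ g ] ∃[ h ] ∃[ k ] (Adj f g × Adj f h × Adj f k × Adj g h × k ≢ g × k ≢ h)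

  abstract
    -- Telling whether `f` is switched requires all three colours to occur around it. Two adjacent
    -- neighbours show two of them; if the third is missing, any further neighbour can take it
    -- without conflict.
    colour-rich-link : ∀ f → Rich f → ∃[ κ ] (LinkColouring f κ × Onto f κ)
    colour-rich-link f (g , h , k , fg , fh , fk , gh , k≢g , k≢h)
      with κ , proper ← colour-link f
      with j , j≢g , j≢h ← third (κ g) (κ h)
      with Fin.any? (λ l → adj? f l ×-dec κ l Fin.≟ j)
    ... | yes (l , fl , refl) = κ , proper , onto
      where
      onto : Onto f κ
      onto i with i Fin.≟ κ g | i Fin.≟ κ h
      ... | yes refl | _ = g , fg , refl
      ... | _ | yes refl = h , fh , refl
      ... | no i≢g | no i≢h = l , fl , third-unique (κ g) (κ h) (κ l) i (proper fg fh gh) j≢g j≢h i≢g i≢h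
    ... | no unused = κ′ , proper′ , onto
      where
      κ′ : Fin φ → Fin 3
      κ′ = update Fin._≟_ k j κ
      κ′≢ : ∀ {l} → l ≢ k → κ′ l ≡ κ l
      κ′≢ = update-off Fin._≟_ j κ
      κ′k : κ′ k ≡ j
      κ′k = update-at Fin._≟_ k j κ
      proper′ : LinkColouring f κ′
      proper′ {a} {b} fa fb ab with a Fin.≟ k | b Fin.≟ k
      ... | yes refl | yes refl = contradiction ab adj-irrefl
      ... | yes refl | no b≢k = λ eq → unused (_ , fb , sym eq)
      ... | no a≢k | yes refl = λ eq → unused (_ , fa , eq)
      ... | no a≢k | no b≢k = proper fa fb ab
      onto : Onto f κ′
      onto i with i Fin.≟ κ g | i Fin.≟ κ h
      ... | yes refl | _ = g , fg , κ′≢ (k≢g ∘ sym)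
      ... | _ | yes refl = h , fh , κ′≢ (k≢h ∘ sym)
      ... | no i≢g | no i≢h = k , fk , trans κ′k (third-unique (κ g) (κ h) j i (proper fg fh gh) j≢g j≢h i≢g i≢h)

length-filter-map : {A B : Set} {P : B → Set} (P? : Unary.Decidable P) (f : A → B) (xs : List A) →
  length (filter P? (map f xs)) ≡ length (filter (P? ∘ f) xs)
length-filter-map P? f [] = refl
length-filter-map P? f (x ∷ xs) with does (P? (f x))
... | true = cong suc (length-filter-map P? f xs)
... | false = length-filter-map P? f xs

xor-true : ∀ {a b} → a xor b ≡ true → (a ≡ true × b ≡ false) ⊎ (a ≡ false × b ≡ true)
xor-true {true} {false} _ = inj₁ (refl , refl)
xor-true {false} {true} _ = inj₂ (refl , refl)

xor-cycle : ∀ {p q r} → p xor q ≡ true → (p xor r ≡ true × q xor r ≡ false) ⊎ (p xor r ≡ false × q xor r ≡ true)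
xor-cycle {true} {false} {true} _ = inj₂ (refl , refl)
xor-cycle {true} {false} {false} _ = inj₁ (refl , refl)
xor-cycle {false} {true} {true} _ = inj₁ (refl , refl)
xor-cycle {false} {true} {false} _ = inj₂ (refl , refl)

-- Circuit double covers from labellings of the faces

module Labelling {n : ℕ} (G : Graph n) (cubic : Cubic G) (bridgeless : Bridgeless G)
                 (M : Embedding G) (rep : RepresentativityAtLeast G M 4) where
  open Links G cubic bridgeless M rep public
  open Subgraph

  opp-third : ∀ x → opp (τ₁ (τ₂ x)) ≡ opp (τ₁ x)
  opp-third x = trans (cong face (sym (braid x))) (face-τ₁ (τ₂ (τ₁ x)))

  opp-τ₁≢opp : ∀ x → opp (τ₁ x) ≢ opp x
  opp-τ₁≢opp x eq = opp≢face (τ₁ (τ₂ x)) (trans (opp-third x) (trans eq (sym (face-τ₁ (τ₂ x)))))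

  edge-τ₁ : ∀ x → edgeOf x ≢ edgeOf (τ₁ x)
  edge-τ₁ x eq with face-onEdge x (τ₂ (τ₁ x)) eq
  ... | inj₁ p = opp≢face (τ₁ x) (trans p (sym (face-τ₁ x)))
  ... | inj₂ p = opp-τ₁≢opp x p

  edge-atVertex : ∀ x y → vertexOf x ≡ vertexOf y →
    edgeOf y ≡ edgeOf x ⊎ edgeOf y ≡ edgeOf (τ₁ x) ⊎ edgeOf y ≡ edgeOf (τ₁ (τ₂ x))
  edge-atVertex x y eq with atVertex x y eq
  ... | on = inj₁ refl
  ... | on₂ = inj₁ refl
  ... | on₁ = inj₂ (inj₁ refl)
  ... | on₂₁ = inj₂ (inj₁ refl)
  ... | on₁₂ = inj₂ (inj₂ refl)
  ... | on₂₁₂ = inj₂ (inj₂ refl)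

  -- The observation by which covers are distinguished: it does not depend on the order of the list.
  Covers : List (Subgraph G) → Flag G → Flag G → Flag G → Set
  Covers C x y z = ∃[ H ] (H ∈ C × edgeOf x Subset.∈ edges H × edgeOf y Subset.∈ edges H × edgeOf z Subset.∈ edges H)

  covers-resp-↭ : ∀ {C D x y z} → C ↭ D → Covers C x y z → Covers D x y z
  covers-resp-↭ C↭D (H , H∈ , rest) = H , ∈-resp-↭ C↭D H∈ , rest

  module Labels {K : ℕ} (lab : Fin K → Fin φ → Bool) where

    ∂ : Fin K → Flag G → Bool
    ∂ i x = lab i (face x) xor lab i (opp x)

    ∂E : Fin K → Fin m → Bool
    ∂E i e = ∂ i ((e , false) , false)

    ∂-τ₀ : ∀ i x → ∂ i (τ₀ x) ≡ ∂ i x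
    ∂-τ₀ i x = cong₂ (λ f g → lab i f xor lab i g) (face-τ₀ x) (opp-τ₀ x)

    ∂-τ₂ : ∀ i x → ∂ i (τ₂ x) ≡ ∂ i x
    ∂-τ₂ i x = trans (cong (λ f → lab i (opp x) xor lab i f) (opp-τ₂ x)) (Bool.xor-comm (lab i (opp x)) _)

    ∂-edge : ∀ i x y → edgeOf x ≡ edgeOf y → ∂ i y ≡ ∂ i x
    ∂-edge i x y eq with onEdge x y eq
    ... | at = refl
    ... | at₀ = ∂-τ₀ i x
    ... | at₂ = ∂-τ₂ i x
    ... | at₂₀ = trans (∂-τ₂ i (τ₀ x)) (∂-τ₀ i x)

    ∂E≡∂ : ∀ i x → ∂E i (edgeOf x) ≡ ∂ i x
    ∂E≡∂ i x = ∂-edge i x ((edgeOf x , false) , false) refl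

    module Comp (i : Fin K) = Components G (∂E i)

    -- Of the three faces at a vertex, a label separates one from the other two or none.
    even : ∀ i → Comp.Even i
    even i {v} {e} inc Ee with x , refl , refl ← flag-at inc = result
      where
      y = τ₁ (τ₂ x)
      ∂τ₁ : ∂ i (τ₁ x) ≡ lab i (face x) xor lab i (opp (τ₁ x))
      ∂τ₁ = cong (λ f → lab i f xor lab i (opp (τ₁ x))) (face-τ₁ x)
      ∂y : ∂ i y ≡ lab i (opp x) xor lab i (opp (τ₁ x))
      ∂y = cong₂ (λ f g → lab i f xor lab i g) (face-τ₁ (τ₂ x)) (opp-third x)
      inc₁ : Inc (edgeOf (τ₁ x)) (vertexOf x)
      inc₁ = subst (Inc _) (vertex-τ₁ x) (tail-Inc (proj₁ (τ₁ x)))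
      inc-y : Inc (edgeOf y) (vertexOf x)
      inc-y = subst (Inc _) (vertex-τ₁ (τ₂ x)) (tail-Inc (proj₁ y))
      true≢false : ∀ {b} → b ≡ true → ¬ b ≡ false
      true≢false refl ()
      one-of : ∀ {e′} → Inc e′ (vertexOf x) → e′ ≡ edgeOf x ⊎ e′ ≡ edgeOf (τ₁ x) ⊎ e′ ≡ edgeOf y
      one-of inc with z , refl , at-v ← flag-at inc = edge-atVertex x z (sym at-v)
      result : Comp.TwoAt i (vertexOf x)
      result with xor-cycle {lab i (face x)} {lab i (opp x)} {lab i (opp (τ₁ x))} (trans (sym (∂E≡∂ i x)) Ee)
      ... | inj₁ (p , ¬p) = edgeOf x , edgeOf (τ₁ x) , edge-τ₁ x , inc , inc₁ , Ee , trans (∂E≡∂ i (τ₁ x)) (trans ∂τ₁ p) , only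
        where
        only : ∀ {e′} → Inc e′ (vertexOf x) → ∂E i e′ ≡ true → e′ ≡ edgeOf x ⊎ e′ ≡ edgeOf (τ₁ x)
        only inc Ee′ with one-of inc
        ... | inj₁ eq = inj₁ eq
        ... | inj₂ (inj₁ eq) = inj₂ eq
        ... | inj₂ (inj₂ refl) = contradiction (trans (∂E≡∂ i y) (trans ∂y ¬p)) (true≢false Ee′)
      ... | inj₂ (¬p , p) = edgeOf x , edgeOf y , edge-τ₁ (τ₂ x) , inc , inc-y , Ee , trans (∂E≡∂ i y) (trans ∂y p) , only
        where
        only : ∀ {e′} → Inc e′ (vertexOf x) → ∂E i e′ ≡ true → e′ ≡ edgeOf x ⊎ e′ ≡ edgeOf y
        only inc Ee′ with one-of inc
        ... | inj₁ eq = inj₁ eq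
        ... | inj₂ (inj₂ eq) = inj₂ eq
        ... | inj₂ (inj₁ refl) = contradiction (trans (∂E≡∂ i (τ₁ x)) (trans ∂τ₁ ¬p)) (true≢false Ee′)

    -- Excludes vertices that no edge of the label reaches. Circuits are indexed by label and
    -- representative, so a circuit arising from two labels is counted twice.
    Nonempty : Fin K × Fin n → Set
    Nonempty (i , r) = ∃[ e ] (∂E i e ≡ true × Comp.comp i (src e) ≡ r)

    nonempty? : Unary.Decidable Nonempty
    nonempty? (i , r) = Fin.any? λ e → ∂E i e Bool.≟ true ×-dec Comp.comp i (src e) Fin.≟ r

    pairs : List (Fin K × Fin n)
    pairs = filter nonempty? (List.cartesianProduct (List.allFin K) (List.allFin n))

    pairs-unique : Unique pairs
    pairs-unique = Unique.filter⁺ nonempty? (Unique.cartesianProduct⁺ (Unique.allFin⁺ K) (Unique.allFin⁺ n))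

    piece : Fin K × Fin n → Subgraph G
    piece (i , r) = Comp.component i r

    pairs⁺ : ∀ i {e} → ∂E i e ≡ true → (i , Comp.comp i (src e)) ∈ pairs
    pairs⁺ i {e} Ee = ∈-filter⁺ nonempty? (∈-cartesianProduct⁺ (∈-allFin i) (∈-allFin _)) (e , Ee , refl)

    abstract
      cover : List (Subgraph G)
      cover = map piece pairs

      cover⁺ : ∀ i {e} → ∂E i e ≡ true → Comp.component i (Comp.comp i (src e)) ∈ cover
      cover⁺ i Ee = ∈-map⁺ piece (pairs⁺ i Ee)

      cover⁻ : ∀ {H} → H ∈ cover → ∃[ i ] ∃[ e ] (∂E i e ≡ true × H ≡ Comp.component i (Comp.comp i (src e)))
      cover⁻ H∈ with (i , r) , p∈ , refl ← ∈-map⁻ piece H∈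
        with e , Ee , refl ← proj₂ (∈-filter⁻ nonempty? {xs = List.cartesianProduct (List.allFin K) (List.allFin n)} p∈) = i , e , Ee , refl

    covers⁻ : ∀ {x y z} → Covers cover x y z → ∃[ i ] (∂ i x ≡ true × ∂ i y ≡ true × ∂ i z ≡ true)
    covers⁻ {x} {y} {z} (H , H∈ , x∈ , y∈ , z∈) with i , e , Ee , refl ← cover⁻ H∈ =
      i , inside x x∈ , inside y y∈ , inside z z∈
      where
      inside : ∀ x → edgeOf x Subset.∈ edges (Comp.component i (Comp.comp i (src e))) → ∂ i x ≡ true
      inside x x∈ = trans (sym (∂E≡∂ i x)) (proj₁ (Comp.∈-component⁻ i x∈))

    class : Fin K → Flag G → Fin n
    class i x = Comp.comp i (src (edgeOf x))

    class-vertex : ∀ i x y → vertexOf x ≡ vertexOf y → ∂ i x ≡ true → ∂ i y ≡ true → class i x ≡ class i y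
    class-vertex i x y eq ∂x ∂y =
      trans (Comp.comp-Inc i (trans (∂E≡∂ i x) ∂x) (subst (Inc _) eq (tail-Inc (proj₁ x))))
            (sym (Comp.comp-Inc i (trans (∂E≡∂ i y) ∂y) (tail-Inc (proj₁ y))))

    class-next : ∀ i x → ∂ i x ≡ true → ∂ i (next x) ≡ true → class i x ≡ class i (next x)
    class-next i x ∂x ∂next = class-vertex i (τ₀ x) (next x) (sym (vertex-τ₁ (τ₀ x))) (trans (∂-τ₀ i x) ∂x) ∂next

    covers⁺ : ∀ i {x y z} → ∂ i x ≡ true → ∂ i y ≡ true → ∂ i z ≡ true →
      class i y ≡ class i x → class i z ≡ class i x → Covers cover x y z
    covers⁺ i {x} {y} {z} ∂x ∂y ∂z eq eq′ = _ , cover⁺ i (trans (∂E≡∂ i x) ∂x) ,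
      Comp.∈-component⁺ i (trans (∂E≡∂ i x) ∂x) refl ,
      Comp.∈-component⁺ i (trans (∂E≡∂ i y) ∂y) eq ,
      Comp.∈-component⁺ i (trans (∂E≡∂ i z) ∂z) eq′

    covers-consecutive : ∀ i x → ∂ i x ≡ true → ∂ i (next x) ≡ true → ∂ i (next (next x)) ≡ true →
      Covers cover x (next x) (next (next x))
    covers-consecutive i x ∂₀ ∂₁ ∂₂ = covers⁺ i ∂₀ ∂₁ ∂₂ (sym (class-next i x ∂₀ ∂₁))
      (sym (trans (class-next i x ∂₀ ∂₁) (class-next i (next x) ∂₁ ∂₂)))

    -- Consecutive boundary edges share a vertex, so if a label separates a face along its whole
    -- boundary, the boundary stays in one component.
    class-face : ∀ i x → (∀ y → face y ≡ face x → ∂ i y ≡ true) → ∀ y → face y ≡ face x → class i y ≡ class i x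
    class-face i x all y y∈ with Ring.onRing x y y∈
    ... | j , _ , on-j = trans (same-edge on-j) (along j)
      where
      same-edge : y ≡ ring x j ⊎ y ≡ τ₀ (ring x j) → class i y ≡ class i (ring x j)
      same-edge (inj₁ refl) = refl
      same-edge (inj₂ refl) = refl
      along : ∀ j → class i (ring x j) ≡ class i x
      along zero = refl
      along (suc j) =
        trans (sym (class-next i (ring x j) (all _ (face-ring x j)) (all _ (face-ring x (suc j))))) (along j)

    Balanced : Set
    Balanced = ∀ x → ∃₂ λ a b → a ≢ b × ∂ a x ≡ true × ∂ b x ≡ true × (∀ i → ∂ i x ≡ true → i ≡ a ⊎ i ≡ b)

    abstract
      isCircuitDoubleCover : Balanced → IsCircuitDoubleCover G cover
      isCircuitDoubleCover balanced = record { circuits = All.tabulate circuit ; double-cover = twice }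
        where
        circuit : ∀ {H} → H ∈ cover → IsCircuit G H
        circuit H∈ with i , e , Ee , refl ← cover⁻ H∈ = Comp.component-circuit i (even i) Ee
        twice : ∀ e → length (filter (λ H → e Subset.∈? edges H) cover) ≡ 2
        twice e with a , b , a≢b , ∂a , ∂b , only ← balanced ((e , false) , false) =
          trans (length-filter-map (λ H → e Subset.∈? edges H) piece pairs)
            (length-filter≡2 (λ p → e Subset.∈? edges (piece p)) pairs-unique (pairs⁺ a ∂a) (pairs⁺ b ∂b) (a≢b ∘ cong proj₁)
              (Comp.∈-component⁺ a ∂a refl) (Comp.∈-component⁺ b ∂b refl) λ {(i , r)} e∈ →
                case Comp.∈-component⁻ i e∈ of λ (∂i , eq) → case only i ∂i of λ where
                  (inj₁ refl) → inj₁ (cong (i ,_) (sym eq))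
                  (inj₂ refl) → inj₂ (cong (i ,_) (sym eq)))

  -- Faces carry one label each, except that a switched face carries three labels, one of which
  -- each of its neighbours has.
  module Switch {K : ℕ} (colour : Fin φ → Fin K) (three : Fin φ → Fin 3 → Fin K) (switched : Fin φ → Bool)
    (three-injective : ∀ {f i j} → switched f ≡ true → three f i ≡ three f j → i ≡ j)
    (proper : ∀ {f g} → Adj f g → switched f ≡ false → switched g ≡ false → colour f ≢ colour g)
    (around : ∀ {f g} → Adj f g → switched f ≡ true → switched g ≡ false × ∃[ j ] colour g ≡ three f j)
    where

    label : Fin K → Fin φ → Bool
    label i f with switched f
    ... | true = does (Fin.any? λ j → three f j Fin.≟ i)
    ... | false = does (colour f Fin.≟ i)

    open Labels label public

    label-plain⁺ : ∀ {f} → switched f ≡ false → label (colour f) f ≡ true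
    label-plain⁺ {f} eq with switched f
    ... | false = dec-true (colour f Fin.≟ colour f) refl

    label-plain⁻ : ∀ {i f} → switched f ≡ false → colour f ≢ i → label i f ≡ false
    label-plain⁻ {i} {f} eq ≢i with switched f
    ... | false = dec-false (colour f Fin.≟ i) ≢i

    label-three⁺ : ∀ {f} j → switched f ≡ true → label (three f j) f ≡ true
    label-three⁺ {f} j eq with switched f
    ... | true = dec-true (Fin.any? λ j′ → three f j′ Fin.≟ three f j) (j , refl)

    plain-label : ∀ {i f} → switched f ≡ false → label i f ≡ true → colour f ≡ i
    plain-label {i} {f} eq l with switched f
    ... | false = does-true (colour f Fin.≟ i) l

    three-label : ∀ {i f} → switched f ≡ true → label i f ≡ true → ∃[ j ] three f j ≡ i
    three-label {i} {f} eq l with switched f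
    ... | true = does-true (Fin.any? λ j → three f j Fin.≟ i) l

    ∂-plain : ∀ x → switched (face x) ≡ false → switched (opp x) ≡ false → ∂ (colour (face x)) x ≡ true
    ∂-plain x sf sg = cong₂ _xor_ (label-plain⁺ sf) (label-plain⁻ sg (proper (x , refl , refl) sf sg ∘ sym))

    ∂-plain⁻ : ∀ x {i} → switched (face x) ≡ false → switched (opp x) ≡ false → ∂ i x ≡ true →
      i ≡ colour (face x) ⊎ i ≡ colour (opp x)
    ∂-plain⁻ x {i} sf sg ∂i with xor-true {label i (face x)} ∂i
    ... | inj₁ (l , _) = inj₁ (sym (plain-label sf l))
    ... | inj₂ (_ , l) = inj₂ (sym (plain-label sg l))

    -- Of the three labels of the switched face, the neighbour shares exactly the one with index
    -- `j`; the other two are the labels seen on the edge.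
    ∂-three : ∀ x {j j′} → switched (face x) ≡ true → colour (opp x) ≡ three (face x) j → j′ ≢ j →
      ∂ (three (face x) j′) x ≡ true
    ∂-three x {j} {j′} sf eq j′≢j = cong₂ _xor_ (label-three⁺ j′ sf)
      (label-plain⁻ (proj₁ (around (x , refl , refl) sf)) λ eq′ → j′≢j (three-injective sf (trans (sym eq′) eq)))

    ∂-three⁻ : ∀ x {i j} → switched (face x) ≡ true → colour (opp x) ≡ three (face x) j → ∂ i x ≡ true →
      ∃[ j′ ] (j′ ≢ j × i ≡ three (face x) j′)
    ∂-three⁻ x {i} {j} sf eq ∂i with xor-true {label i (face x)} ∂i
    ... | inj₁ (l , ¬l) with j′ , refl ← three-label sf l = j′ , differ , refl
      where
      differ : j′ ≢ j
      differ refl with trans (sym ¬l) (trans (cong (λ c → label c (opp x)) (sym eq)) (label-plain⁺ (proj₁ (around (x , refl , refl) sf))))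
      ... | ()
    ... | inj₂ (¬l , l) with refl ← plain-label (proj₁ (around (x , refl , refl) sf)) l =
      case trans (sym ¬l) (trans (cong (λ c → label c (face x)) eq) (label-three⁺ j sf)) of λ ()

    private
      TwoLabels : Flag G → Set
      TwoLabels x = ∃₂ λ a b → a ≢ b × ∂ a x ≡ true × ∂ b x ≡ true × (∀ i → ∂ i x ≡ true → i ≡ a ⊎ i ≡ b)

      beside-switched : ∀ x → switched (face x) ≡ true → TwoLabels x
      beside-switched x sf with _ , j , eq ← around (x , refl , refl) sf
        -- `third j j` merely provides an index other than `j`; `l` is then the remaining one.
        with k , k≢j , _ ← third j j
        with l , l≢j , l≢k ← third j k =
        three (face x) k , three (face x) l , (λ eq → l≢k (sym (three-injective sf eq))) ,
        ∂-three x sf eq k≢j , ∂-three x sf eq l≢j , only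
        where
        only : ∀ i → ∂ i x ≡ true → i ≡ three (face x) k ⊎ i ≡ three (face x) l
        only i ∂i with j′ , j′≢j , refl ← ∂-three⁻ x sf eq ∂i with j′ Fin.≟ k
        ... | yes refl = inj₁ refl
        ... | no j′≢k = inj₂ (cong (three (face x)) (third-unique j k j′ l (k≢j ∘ sym) j′≢j j′≢k l≢j l≢k))

      other-side : ∀ x → TwoLabels (τ₂ x) → TwoLabels x
      other-side x (a , b , a≢b , ∂a , ∂b , only) =
        a , b , a≢b , trans (sym (∂-τ₂ a x)) ∂a , trans (sym (∂-τ₂ b x)) ∂b , λ i ∂i → only i (trans (∂-τ₂ i x) ∂i)

    balanced : Balanced
    balanced x = by _ _ refl refl
      where
      by : ∀ s t → switched (face x) ≡ s → switched (opp x) ≡ t → TwoLabels x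
      by true _ sf _ = beside-switched x sf
      by false true _ sg = other-side x (beside-switched (τ₂ x) sg)
      by false false sf sg = colour (face x) , colour (opp x) , proper (x , refl , refl) sf sg , ∂-plain x sf sg ,
        trans (sym (∂-τ₂ _ x)) (∂-plain (τ₂ x) sg (trans (cong switched (opp-τ₂ x)) sf)) , λ i → ∂-plain⁻ x sf sg

    switched-cover : IsCircuitDoubleCover G cover
    switched-cover = isCircuitDoubleCover balanced

lookup-injective : {A : Set} {xs : List A} → AllPairs _≢_ xs → ∀ i j → List.lookup xs i ≡ List.lookup xs j → i ≡ j
lookup-injective (_ ∷ _) zero zero _ = refl
lookup-injective (x≢ ∷ _) zero (suc j) eq = contradiction eq (All.lookup x≢ (∈-lookup j))
lookup-injective (x≢ ∷ _) (suc i) zero eq = contradiction (sym eq) (All.lookup x≢ (∈-lookup i))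
lookup-injective (_ ∷ uniq) (suc i) (suc j) eq = cong suc (lookup-injective uniq i j eq)

allPairs-∈ : {A : Set} {R : A → A → Set} {xs : List A} → (∀ {x y} → R x y → R y x) → AllPairs R xs →
  ∀ {x y} → x ∈ xs → y ∈ xs → x ≢ y → R x y
allPairs-∈ R-sym (_ ∷ _) (here refl) (here refl) x≢y = contradiction refl x≢y
allPairs-∈ R-sym (r ∷ _) (here refl) (there y∈) _ = All.lookup r y∈
allPairs-∈ R-sym (r ∷ _) (there x∈) (here refl) _ = R-sym (All.lookup r x∈)
allPairs-∈ R-sym (_ ∷ rs) (there x∈) (there y∈) x≢y = allPairs-∈ R-sym rs x∈ y∈ x≢y

length-concatMap-≤ : {A B : Set} (f : A → List B) (xs : List A) {b : ℕ} → (∀ x → length (f x) ≤ b) →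
  length (concatMap f xs) ≤ length xs * b
length-concatMap-≤ f [] _ = z≤n
length-concatMap-≤ f (x ∷ xs) bound = ℕ.≤-trans (ℕ.≤-reflexive (length-++ (f x)))
  (ℕ.+-mono-≤ (bound x) (length-concatMap-≤ f xs bound))

-- Switching independent faces

module Families {n : ℕ} (G : Graph n) (cubic : Cubic G) (bridgeless : Bridgeless G)
                (M : Embedding G) (rep : RepresentativityAtLeast G M 4) where
  open Labelling G cubic bridgeless M rep public

  ManyCovers : ℕ → Set
  ManyCovers r = ∃[ Ds ] (DistinctCircuitDoubleCovers G Ds × length Ds ≡ 2 ^ r)

  family : ∀ {r} (C : Vec Bool r → List (Subgraph G)) → (∀ b → IsCircuitDoubleCover G (C b)) →
    (∀ b b′ → Differ b b′ → ¬ (C b ↭ C b′)) → ManyCovers r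
  family {r} C covers distinct = map C (bitVectors r) ,
    record { all-covers = All.map⁺ (All.universal covers _)
           ; distinct = AllPairs.map⁺ (AllPairs.map (λ {b} {b′} → distinct b b′) (bitVectors-differ r)) } ,
    trans (length-map C (bitVectors r)) (length-bitVectors r)

  -- Four colours per face: the one it starts with (`own`), and three reserved for its neighbours
  -- when it is prepared for switching (`local`).
  Colour : Set
  Colour = Fin (φ * 4)

  own : Fin φ → Colour
  own f = Fin.combine f (suc (suc (suc zero)))

  local : Fin φ → Fin 3 → Colour
  local f j = Fin.combine f (Fin.inject₁ j)

  own-injective : ∀ {f g} → own f ≡ own g → f ≡ g
  own-injective eq = Fin.combine-injectiveˡ _ _ _ _ eq

  local-injective : ∀ {f g i j} → local f i ≡ local g j → f ≡ g × i ≡ j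
  local-injective {f} {g} {i} {j} eq with p , q ← Fin.combine-injective f _ g _ eq = p , Fin.inject₁-injective q

  own≢local : ∀ {f g j} → own f ≢ local g j
  own≢local {f} {g} {j} eq with j | Fin.combine-injectiveʳ f _ g _ eq
  ... | zero | ()
  ... | suc zero | ()
  ... | suc (suc zero) | ()

  module Switching (κ : Fin φ → Fin φ → Fin 3) (κ-proper : ∀ f → LinkColouring f (κ f)) where

    Touched : List (Fin φ) → Fin φ → Set
    Touched T g = ∃[ t ] (t ∈ T × Adj t g)

    -- A proper colouring in which every face of `T` could be switched. The last three fields
    -- restrict where a colour can come from; the induction uses them to exclude clashes when
    -- another face is added.
    record Coloured (T : List (Fin φ)) : Set where
      field
        colour : Fin φ → Colour
        three : Fin φ → Fin 3 → Colour
        proper : ∀ {f g} → Adj f g → colour f ≢ colour g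
        three-injective : ∀ {t i j} → t ∈ T → three t i ≡ three t j → i ≡ j
        around : ∀ {t k} → t ∈ T → Adj t k → colour k ≡ three t (κ t k)
        untouched : ∀ g → colour g ≡ own g ⊎ Touched T g
        own-only : ∀ {g k} → colour g ≡ own k → g ≡ k ⊎ Touched T k
        local-only : ∀ {g t j} → colour g ≡ local t j → t ∈ T

    uncoloured : Coloured []
    uncoloured = record
      { colour = own
      ; three = local
      ; proper = λ adj eq → adj-irrefl (subst (Adj _) (sym (own-injective eq)) adj)
      ; three-injective = λ ()
      ; around = λ ()
      ; untouched = λ _ → inj₁ refl
      ; own-only = λ eq → inj₁ (own-injective eq)
      ; local-only = λ eq → contradiction eq own≢local
      }

    -- The neighbours of `t` are recoloured through `γ`, a choice of one colour for each class of
    -- the 3-colouring around `t`. `γ-proper` guards the adjacencies leaving the neighbourhood, and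
    -- `γ-agrees` keeps intact what earlier faces of `T` see.
    module Extend {T : List (Fin φ)} (old : Coloured T) {t : Fin φ} (t∉T : t ∉ T) (γ : Fin 3 → Colour)
      (γ-injective : ∀ {i j} → γ i ≡ γ j → i ≡ j)
      (γ-own : ∀ {j g} → γ j ≡ own g → Touched (t ∷ T) g)
      (γ-local : ∀ {j s i} → γ j ≡ local s i → s ∈ t ∷ T)
      (γ-proper : ∀ {k l} → Adj t k → ¬ Adj t l → Adj k l → γ (κ t k) ≢ Coloured.colour old l)
      (γ-agrees : ∀ {s k} → s ∈ T → Adj s k → Adj t k → γ (κ t k) ≡ Coloured.colour old k) where
      open Coloured old

      colour′ : Fin φ → Colour
      colour′ g with adj? t g
      ... | yes _ = γ (κ t g)
      ... | no _ = colour g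

      touched : ∀ {g} → Touched T g → Touched (t ∷ T) g
      touched (s , s∈ , adj) = s , there s∈ , adj

      three′ : Fin φ → Fin 3 → Colour
      three′ = update Fin._≟_ t γ three

      three′-t : three′ t ≡ γ
      three′-t = update-at Fin._≟_ t γ three

      three′-T : ∀ {s} → s ∈ T → three′ s ≡ three s
      three′-T s∈ = update-off Fin._≟_ γ three λ where refl → t∉T s∈

      proper′ : ∀ {f g} → Adj f g → colour′ f ≢ colour′ g
      proper′ {f} {g} fg with adj? t f | adj? t g
      ... | yes tf | yes tg = κ-proper t tf tg fg ∘ γ-injective
      ... | yes tf | no ¬tg = γ-proper tf ¬tg fg
      ... | no ¬tf | yes tg = γ-proper tg ¬tf (adj-sym fg) ∘ sym
      ... | no _ | no _ = proper fg

      around′ : ∀ {s k} → s ∈ t ∷ T → Adj s k → colour′ k ≡ three′ s (κ s k)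
      around′ {s} {k} (here refl) sk with adj? s k
      ... | yes _ = cong (λ h → h (κ s k)) (sym three′-t)
      ... | no ¬sk = contradiction sk ¬sk
      around′ {s} {k} (there s∈) sk with adj? t k
      ... | yes tk = trans (γ-agrees s∈ sk tk) (trans (around s∈ sk) (cong (λ h → h (κ s k)) (sym (three′-T s∈))))
      ... | no _ = trans (around s∈ sk) (cong (λ h → h (κ s k)) (sym (three′-T s∈)))

      three′-injective : ∀ {s i j} → s ∈ t ∷ T → three′ s i ≡ three′ s j → i ≡ j
      three′-injective {i = i} {j} (here refl) eq = γ-injective (subst (λ h → h i ≡ h j) three′-t eq)
      three′-injective {i = i} {j} (there s∈) eq = three-injective s∈ (subst (λ h → h i ≡ h j) (three′-T s∈) eq)

      untouched′ : ∀ g → colour′ g ≡ own g ⊎ Touched (t ∷ T) g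
      untouched′ g with adj? t g
      ... | yes tg = inj₂ (t , here refl , tg)
      ... | no _ = case untouched g of λ where
        (inj₁ eq) → inj₁ eq
        (inj₂ touch) → inj₂ (touched touch)

      own-only′ : ∀ {g k} → colour′ g ≡ own k → g ≡ k ⊎ Touched (t ∷ T) k
      own-only′ {g} eq with adj? t g
      ... | yes _ = inj₂ (γ-own eq)
      ... | no _ = case own-only eq of λ where
        (inj₁ eq′) → inj₁ eq′
        (inj₂ touch) → inj₂ (touched touch)

      local-only′ : ∀ {g s j} → colour′ g ≡ local s j → s ∈ t ∷ T
      local-only′ {g} eq with adj? t g
      ... | yes _ = γ-local eq
      ... | no _ = there (local-only eq)

      extended : Coloured (t ∷ T)
      extended = record
        { colour = colour′ ; three = three′ ; proper = proper′ ; three-injective = three′-injective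
        ; around = around′ ; untouched = untouched′ ; own-only = own-only′ ; local-only = local-only′ }

    module Switched {T : List (Fin φ)} (coloured : Coloured T) (independent : ∀ {s t} → s ∈ T → t ∈ T → ¬ Adj s t)
                    (T-unique : AllPairs _≢_ T) where
      open Coloured coloured

      switched? : (b : Vec Bool (length T)) (f : Fin φ) → Dec (∃[ i ] (List.lookup T i ≡ f × lookup b i ≡ true))
      switched? b f = Fin.any? λ i → List.lookup T i Fin.≟ f ×-dec lookup b i Bool.≟ true

      switched : Vec Bool (length T) → Fin φ → Bool
      switched b f = does (switched? b f)

      switched-T : ∀ {b f} → switched b f ≡ true → f ∈ T
      switched-T {b} {f} eq with i , refl , _ ← does-true (switched? b f) eq = ∈-lookup i

      unswitched : ∀ {b f} → f ∉ T → switched b f ≡ false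
      unswitched {b} {f} f∉ = dec-false (switched? b f) λ where (i , refl , _) → f∉ (∈-lookup i)

      switched-lookup : ∀ b i {s} → lookup b i ≡ s → switched b (List.lookup T i) ≡ s
      switched-lookup b i {true} eq = dec-true (switched? b _) (i , refl , eq)
      switched-lookup b i {false} eq = dec-false (switched? b _) λ (j , eq″ , eq′) →
        case trans (sym eq) (trans (cong (lookup b) (sym (lookup-injective T-unique j i eq″))) eq′) of λ ()

      module Family (b : Vec Bool (length T)) where
        open Switch colour three (switched b) (λ s → three-injective (switched-T {b} s)) (λ adj _ _ → proper adj)
          (λ adj s → unswitched {b} (λ g∈ → independent (switched-T {b} s) g∈ adj) , _ , around (switched-T {b} s) adj) public

      -- Three edges from which bit `i` can be read off, whatever the other bits are.
      Telling : Fin (length T) → Set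
      Telling i = ∃[ x ] ∃[ y ] ∃[ z ] (∀ b →
        (lookup b i ≡ false → Covers (Family.cover b) x y z) × (lookup b i ≡ true → ¬ Covers (Family.cover b) x y z))

      many : (∀ i → Telling i) → ManyCovers (length T)
      many telling = family Family.cover Family.switched-cover distinct
        where
        distinct : ∀ b b′ → Differ b b′ → ¬ (Family.cover b ↭ Family.cover b′)
        distinct b b′ (i , ≢) b↭b′ with x , y , z , tell ← telling i = go _ _ refl refl
          where
          go : ∀ s s′ → lookup b i ≡ s → lookup b′ i ≡ s′ → ⊥
          go true true eq eq′ = ≢ (trans eq (sym eq′))
          go false false eq eq′ = ≢ (trans eq (sym eq′))
          go false true eq eq′ = proj₂ (tell b′) eq′ (covers-resp-↭ {x = x} {y} {z} b↭b′ (proj₁ (tell b) eq))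
          go true false eq eq′ = proj₂ (tell b) eq (covers-resp-↭ {x = x} {y} {z} (↭-sym b↭b′) (proj₁ (tell b′) eq′))

      -- Unswitched, `t` has unswitched neighbours of other colours, so its whole boundary lies on
      -- one circuit. Switched, an edge towards a neighbour of class `j` lacks the label with index
      -- `j`, so edges towards all three classes have no label in common.
      telling-onto : ∀ i → Onto (List.lookup T i) (κ (List.lookup T i)) → Telling i
      telling-onto i onto with _ , (x₀ , face₀ , refl) , κ₀ ← onto zero
        with _ , (x₁ , face₁ , refl) , κ₁ ← onto (suc zero)
        with _ , (x₂ , face₂ , refl) , κ₂ ← onto (suc (suc zero)) = x₀ , x₁ , x₂ , λ b → unswitched-covers b , switched-avoids b
        where
        t = List.lookup T i
        unswitched-covers : ∀ b → lookup b i ≡ false → Covers (Family.cover b) x₀ x₁ x₂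
        unswitched-covers b eq = covers⁺ (colour t) (∂t x₀ face₀) (∂t x₁ face₁) (∂t x₂ face₂)
          (class-face (colour t) x₀ ∂t₀ x₁ (trans face₁ (sym face₀)))
          (class-face (colour t) x₀ ∂t₀ x₂ (trans face₂ (sym face₀)))
          where
          open Family b
          ∂t : ∀ y → face y ≡ t → ∂ (colour t) y ≡ true
          ∂t y refl′ = subst (λ f → ∂ (colour f) y ≡ true) refl′ (∂-plain y
            (trans (cong (switched b) refl′) (switched-lookup b i eq))
            (unswitched {b} λ opp∈ → independent (∈-lookup i) opp∈ (y , refl′ , refl)))
          ∂t₀ : ∀ y → face y ≡ face x₀ → ∂ (colour t) y ≡ true
          ∂t₀ y eq′ = ∂t y (trans eq′ face₀)
        switched-avoids : ∀ b → lookup b i ≡ true → ¬ Covers (Family.cover b) x₀ x₁ x₂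
        switched-avoids b eq covers = clash (Family.covers⁻ b covers)
          where
          avoid : ∀ {t} x {j c} → t ∈ T → switched b t ≡ true → face x ≡ t → κ t (opp x) ≡ j →
            Family.∂ b c x ≡ true → ∃[ j′ ] (j′ ≢ j × c ≡ three t j′)
          avoid x t∈ st refl refl ∂c = Family.∂-three⁻ b x st (around t∈ (x , refl , refl)) ∂c
          avoid-t : ∀ x {j c} → face x ≡ t → κ t (opp x) ≡ j →
            Family.∂ b c x ≡ true → ∃[ j′ ] (j′ ≢ j × c ≡ three t j′)
          avoid-t x = avoid x (∈-lookup i) (switched-lookup b i eq)
          none : (j : Fin 3) → j ≢ zero → j ≢ suc zero → j ≢ suc (suc zero) → ⊥
          none zero p _ _ = p refl
          none (suc zero) _ p _ = p refl
          none (suc (suc zero)) _ _ p = p refl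
          clash : ∃[ c ] (Family.∂ b c x₀ ≡ true × Family.∂ b c x₁ ≡ true × Family.∂ b c x₂ ≡ true) → ⊥
          clash (c , ∂₀ , ∂₁ , ∂₂)
            with j₀ , j₀≢ , refl ← avoid-t x₀ face₀ κ₀ ∂₀
               | j₁ , j₁≢ , eq₁ ← avoid-t x₁ face₁ κ₁ ∂₁
               | j₂ , j₂≢ , eq₂ ← avoid-t x₂ face₂ κ₂ ∂₂
            with refl ← three-injective (∈-lookup i) eq₁ | refl ← three-injective (∈-lookup i) eq₂ = none j₀ j₀≢ j₁≢ j₂≢

      -- If `t` is unswitched, the colour of `f` labels all three edges. If it is switched, the edge
      -- towards `t` loses that label, and the other labels of the next two edges are the colours of
      -- two adjacent faces, hence different.
      telling-consecutive : ∀ i z → opp z ≡ List.lookup T i → opp (next z) ∉ T → opp (next (next z)) ∉ T → Telling i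
      telling-consecutive i z opp-z g∉T h∉T = z , next z , next (next z) , λ b → unswitched-covers b , switched-avoids b
        where
        t = List.lookup T i
        f = face z
        tf : Adj t f
        tf = adj-sym (z , refl , opp-z)
        f∉T : f ∉ T
        f∉T f∈ = independent (∈-lookup i) f∈ tf
        face₁ : face (next z) ≡ f
        face₁ = face-next z
        face₂ : face (next (next z)) ≡ f
        face₂ = trans (face-next (next z)) face₁
        module _ (b : Vec Bool (length T)) where
          open Family b
          plain : ∀ {x} → x ∉ T → switched b x ≡ false
          plain = unswitched {b}
          plain-f : ∀ x → face x ≡ f → switched b (face x) ≡ false
          plain-f x eq = trans (cong (switched b) eq) (plain f∉T)
          ∂f : ∀ x → face x ≡ f → switched b (opp x) ≡ false → ∂ (colour f) x ≡ true
          ∂f x eq so = subst (λ f → ∂ (colour f) x ≡ true) eq (∂-plain x (plain-f x eq) so)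
          unswitched-covers : lookup b i ≡ false → Covers cover z (next z) (next (next z))
          unswitched-covers eq = covers-consecutive (colour f) z
            (∂f z refl (trans (cong (switched b) opp-z) (switched-lookup b i eq)))
            (∂f (next z) face₁ (plain g∉T)) (∂f (next (next z)) face₂ (plain h∉T))
          ∂f⁻ : ∀ x {c} → face x ≡ f → opp x ∉ T → ∂ c x ≡ true → c ≢ colour f → c ≡ colour (opp x)
          ∂f⁻ x eq o∉ ∂c c≢ with ∂-plain⁻ x (plain-f x eq) (plain o∉) ∂c
          ... | inj₁ p = contradiction (trans p (cong colour eq)) c≢
          ... | inj₂ p = p
          not-f : ∀ {t c} x → face x ≡ t → t ∈ T → switched b t ≡ true → ∂ c x ≡ true → c ≢ colour (opp x)
          not-f {t} x refl t∈ st ∂c eq with j′ , j′≢ , refl ← ∂-three⁻ x st (around t∈ (x , refl , refl)) ∂c =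
            j′≢ (three-injective t∈ (trans eq (around t∈ (x , refl , refl))))
          switched-avoids : lookup b i ≡ true → ¬ Covers cover z (next z) (next (next z))
          switched-avoids eq covers = clash (covers⁻ covers)
            where
            clash : ∃[ c ] (∂ c z ≡ true × ∂ c (next z) ≡ true × ∂ c (next (next z)) ≡ true) → ⊥
            clash (c , ∂₀ , ∂₁ , ∂₂) = proper (adj-next (next z))
              (trans (sym (∂f⁻ (next z) face₁ g∉T ∂₁ c≢)) (∂f⁻ (next (next z)) face₂ h∉T ∂₂ c≢))
              where
              c≢ : c ≢ colour f
              c≢ p = not-f (τ₂ z) opp-z (∈-lookup i) (switched-lookup b i eq) (trans (∂-τ₂ c z) ∂₀)
                (trans p (cong colour (sym (opp-τ₂ z))))

      module _ (b : Vec Bool (length T)) {g : Fin φ} (g∈T : g ∈ T) (g-switched : switched b g ≡ true) where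
        open Family b

        private
          ∂⁺ : ∀ {j} y → face y ≡ g → j ≢ κ g (opp y) → ∂ (three g j) y ≡ true
          ∂⁺ y refl = ∂-three y g-switched (around g∈T (y , refl , refl))

          ∂⁻ : ∀ {c} y → face y ≡ g → ∂ c y ≡ true → ∃[ j ] (j ≢ κ g (opp y) × c ≡ three g j)
          ∂⁻ y refl = ∂-three⁻ y g-switched (around g∈T (y , refl , refl))

        bend : ∀ y → face y ≡ g → κ g (opp y) ≢ κ g (opp (next y))
        bend y eq = κ-proper g (y , eq , refl) (next y , trans (face-next y) eq , refl) (adj-next y)

        -- Consecutive neighbours have different classes, so the only label common to the first two
        -- edges has the third class as index. It labels the third edge too iff the third neighbour
        -- repeats the class of the first.
        straight⁺ : ∀ y → face y ≡ g → κ g (opp (next (next y))) ≡ κ g (opp y) → Covers cover y (next y) (next (next y))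
        straight⁺ y eq alike with j , j≢₀ , j≢₁ ← third (κ g (opp y)) (κ g (opp (next y))) =
          covers-consecutive (three g j) y (∂⁺ y eq j≢₀) (∂⁺ (next y) (trans (face-next y) eq) j≢₁)
            (∂⁺ (next (next y)) (trans (face-next (next y)) (trans (face-next y) eq)) (λ p → j≢₀ (trans p alike)))

        straight⁻ : ∀ y → face y ≡ g → Covers cover y (next y) (next (next y)) → κ g (opp (next (next y))) ≡ κ g (opp y)
        straight⁻ y eq straight = from-label (covers⁻ straight)
          where
          eq₁ : face (next y) ≡ g
          eq₁ = trans (face-next y) eq
          from-label : ∃[ c ] (∂ c y ≡ true × ∂ c (next y) ≡ true × ∂ c (next (next y)) ≡ true) → κ g (opp (next (next y))) ≡ κ g (opp y)
          from-label (c , ∂₀ , ∂₁ , ∂₂)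
            with j , ≢₀ , refl ← ∂⁻ y eq ∂₀
            with j₁ , ≢₁ , same₁ ← ∂⁻ (next y) eq₁ ∂₁
            with j₂ , ≢₂ , same₂ ← ∂⁻ (next (next y)) (trans (face-next (next y)) eq₁) ∂₂
            with refl ← three-injective g∈T same₁
            with refl ← three-injective g∈T same₂ =
            third-unique (κ g (opp (next y))) j (κ g (opp (next (next y)))) (κ g (opp y)) (≢₁ ∘ sym)
              (bend (next y) eq₁ ∘ sym) (≢₂ ∘ sym) (bend y eq) (≢₀ ∘ sym)

  -- Switching faces that are far apart

  base : Fin φ → Flag G
  base f = proj₁ (face-base f)

  neighbourhood : Fin φ → List (Fin φ)
  neighbourhood f = Around.neighbours (base f)

  length-neighbourhood : ∀ f → length (neighbourhood f) ≡ length (Around.S (base f))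
  length-neighbourhood f = length-map (Around.w (base f)) (Around.S (base f))

  ∈-neighbourhood : ∀ {f g} → Adj f g → g ∈ neighbourhood f
  ∈-neighbourhood {f} {g} fg = Around.∈-neighbours (base f) (subst (λ f → Adj f g) (sym (proj₂ (face-base f))) fg)

  ball : Fin φ → List (Fin φ)
  ball f = concatMap (λ g → g ∷ neighbourhood g) (f ∷ neighbourhood f)

  -- Distance at least three, so that neighbourhoods are disjoint.
  Far : Fin φ → Fin φ → Set
  Far s t = s ≢ t × ¬ Adj s t × (∀ {k} → Adj s k → ¬ Adj t k)

  far-sym : ∀ {s t} → Far s t → Far t s
  far-sym (≢ , ¬adj , apart) = ≢ ∘ sym , ¬adj ∘ adj-sym , λ tk sk → apart sk tk

  ∉-ball : ∀ {s t} → s ∉ ball t → Far s t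
  ∉-ball {s} {t} s∉ = (λ where refl → s∉ (here refl)) , (λ st → s∉ (there (∈-++⁺ˡ (∈-neighbourhood (adj-sym st))))) ,
    λ sk tk → s∉ (∈-concatMap⁺ (λ g → g ∷ neighbourhood g) {xs = t ∷ neighbourhood t}
      (Any.map (λ where refl → there (∈-neighbourhood (adj-sym sk))) (there (∈-neighbourhood tk))))

  length-ball : ∀ {D} → (∀ f → length (neighbourhood f) ≤ D) → ∀ f → length (ball f) ≤ suc D * suc D
  length-ball {D} bound f = ℕ.≤-trans (length-concatMap-≤ (λ g → g ∷ neighbourhood g) (f ∷ neighbourhood f) (λ g → s≤s (bound g)))
    (ℕ.*-monoˡ-≤ (suc D) (s≤s (bound f)))

  -- Greedy choice: a face outside the balls of radius two around the faces chosen so far is far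
  -- from all of them. Room for `r` balls yields one face more.
  far-faces : ∀ {D} → (∀ f → length (neighbourhood f) ≤ D) → ∀ r → r * (suc D * suc D) < φ →
    ∃[ T ] (length T ≡ suc r × AllPairs Far T)
  far-faces {D} bound zero φ>0 with t , _ ← fresh-element {φ} [] φ>0 = t ∷ [] , refl , [] ∷ []
  far-faces {D} bound (suc r) short
    with T , len , far ← far-faces bound r (ℕ.≤-<-trans (ℕ.m≤n+m _ (suc D * suc D)) short)
    with t , t∉ ← fresh-element (concatMap ball T) (ℕ.≤-<-trans (length-concatMap-≤ ball T (length-ball bound))
                    (subst (λ l → l * (suc D * suc D) < φ) (sym len) short)) =
    t ∷ T , cong suc len , All.tabulate (λ s∈ → ∉-ball (λ t∈ → t∉ (∈-concatMap⁺ ball (Any.map (λ where refl → t∈) s∈)))) ∷ far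

  -- Three consecutive edges around a neighbour of t, opposite to t, to a third face and to a face other
  -- than t, lie on a common circuit of the cover iff t is not switched.
  Good : Fin φ → Set
  Good t = ∃[ z ] (opp z ≡ t × opp (next (next z)) ≢ t)

  module FarApart where
    κ : Fin φ → Fin φ → Fin 3
    κ f = proj₁ (colour-link f)

    open Switching κ (λ f → proj₂ (colour-link f))

    coloured : ∀ {T} → AllPairs Far T → Coloured T
    coloured [] = uncoloured
    coloured {t ∷ T} (far ∷ rest) = Extend.extended old t∉T (local t) (proj₂ ∘ local-injective)
      (λ eq → contradiction (sym eq) own≢local) (λ eq → here (sym (proj₁ (local-injective eq))))
      (λ _ _ _ eq → t∉T (Coloured.local-only old (sym eq)))
      (λ s∈ sk tk → contradiction sk (proj₂ (proj₂ (All.lookup far s∈)) tk))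
      where
      old = coloured rest
      t∉T : t ∉ T
      t∉T t∈ = proj₁ (All.lookup far t∈) refl

    many-far : ∀ {T} → AllPairs Far T → (∀ {t} → t ∈ T → Good t) → ManyCovers (length T)
    many-far {T} far good = many λ i → let z , opp-z , h≢t = good (∈-lookup i) in
      telling-consecutive i z opp-z
        (λ g∈ → independent (∈-lookup i) g∈ (subst (λ t → Adj t (opp (next z))) opp-z (adj-next z)))
        -- The third face and `t` are both neighbours of `face z`, so they cannot be far apart.
        (λ h∈ → proj₂ (proj₂ (allPairs-∈ far-sym far h∈ (∈-lookup i) h≢t))
          (adj-sym (next (next z) , trans (face-next (next z)) (face-next z) , refl))
          (adj-sym (z , refl , opp-z)))
      where
      independent : ∀ {s t} → s ∈ T → t ∈ T → ¬ Adj s t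
      independent {s} {t} s∈ t∈ st with s Fin.≟ t
      ... | yes refl = adj-irrefl st
      ... | no s≢t = proj₁ (proj₂ (allPairs-∈ far-sym far s∈ t∈ s≢t)) st
      open Switched (coloured far) independent (AllPairs.map proj₁ far)

-- Switching faces that are separated by triangles

module Separated {n : ℕ} (G : Graph n) (cubic : Cubic G) (bridgeless : Bridgeless G)
                 (M : Embedding G) (rep : RepresentativityAtLeast G M 4) where
  open Families G cubic bridgeless M rep public

  abstract
    rich? : ∀ f → Dec (Rich f)
    rich? f = Fin.any? λ g → Fin.any? λ h → Fin.any? λ k → adj? f g ×-dec adj? f h ×-dec adj? f k ×-dec
      adj? g h ×-dec ¬? (k Fin.≟ g) ×-dec ¬? (k Fin.≟ h)

  abstract
    colour-face : ∀ f → ∃[ κ ] (LinkColouring f κ × (Rich f → Onto f κ))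
    colour-face f with rich? f
    ... | yes rich with κ , proper , onto ← colour-rich-link f rich = κ , proper , λ _ → onto
    ... | no poor with κ , proper ← colour-link f = κ , proper , λ rich → contradiction rich poor

  κ-rich : Fin φ → Fin φ → Fin 3
  κ-rich f = proj₁ (colour-face f)

  open Switching κ-rich (λ f → proj₁ (proj₂ (colour-face f))) public

  Off : List (Fin φ) → Fin φ → Fin φ → Set
  Off A k l = k ∉ A × l ∉ A × Adj k l

  -- Chains of faces avoiding the anchors stay on one side of the curve through them.
  record Cell : Set where
    field
      centre : Fin φ
      anchors : List (Fin φ)
      clique : ∀ {a b} → a ∈ anchors → b ∈ anchors → a ≢ b → Adj a b
      off : centre ∉ anchors
      rich : Rich centre

  open Cell

  -- Only the anchors of `c` have to separate, so the relation is one-sided: in a list each cell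
  -- answers for those after it, which are already coloured when it is added.
  Apart : Cell → Cell → Set
  Apart c d = centre d ∉ anchors c × ¬ Star (Off (anchors c)) (centre c) (centre d)

  _∈?_ : (k : Fin φ) (A : List (Fin φ)) → Dec (k ∈ A)
  k ∈? A = Any.any? (k Fin.≟_) A

  module Step {cs : List Cell} (old : Coloured (map centre cs)) (c : Cell) (apart : All (Apart c) cs) where
    open Coloured old

    private
      t = centre c
      A = anchors c
      T = map centre cs
      κ = κ-rich t

    κ-proper : LinkColouring t κ
    κ-proper = proj₁ (proj₂ (colour-face t))

    apart-T : ∀ {s} → s ∈ T → s ∉ A × ¬ Star (Off A) t s
    apart-T s∈ with d , d∈ , refl ← ∈-map⁻ centre s∈ = All.lookup apart d∈

    t∉T : t ∉ T
    t∉T t∈ = proj₂ (apart-T t∈) ε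

    Anchor : Fin 3 → Fin φ → Set
    Anchor j a = Adj t a × κ a ≡ j

    anchor? : ∀ j → Dec (Any (Anchor j) A)
    anchor? j = Any.any? (λ a → adj? t a ×-dec κ a Fin.≟ j) A

    -- The colour class of an anchor keeps the anchor's colour.
    γ : Fin 3 → Colour
    γ j with anchor? j
    ... | yes anchored = colour (proj₁ (find anchored))
    ... | no _ = local t j

    data Class (j : Fin 3) : Set where
      anchored : ∀ {a} → a ∈ A → Adj t a → κ a ≡ j → γ j ≡ colour a → Class j
      fresh : (∀ {a} → a ∈ A → Adj t a → κ a ≢ j) → γ j ≡ local t j → Class j

    class-of : ∀ j → Class j
    class-of j with anchor? j in eq
    ... | yes found with a , a∈ , ta , κa ← find found in eq′ =
      anchored a∈ ta κa (trans (γ-yes found eq) (cong (colour ∘ proj₁) eq′))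
      where
      γ-yes : ∀ found → anchor? j ≡ yes found → γ j ≡ colour (proj₁ (find found))
      γ-yes found eq with anchor? j
      γ-yes found refl | yes _ = refl
    ... | no none = fresh (λ a∈ ta κa → none (lose a∈ (ta , κa))) γ-no
      where
      γ-no : γ j ≡ local t j
      γ-no with anchor? j
      ... | no _ = refl
      ... | yes found = contradiction found none

    same-class : ∀ {a b} → a ∈ A → b ∈ A → Adj t a → Adj t b → κ a ≡ κ b → a ≡ b
    same-class {a} {b} a∈ b∈ ta tb eq with a Fin.≟ b
    ... | yes a≡b = a≡b
    ... | no a≢b = contradiction eq (κ-proper ta tb (clique c a∈ b∈ a≢b))

    same-colour : ∀ {a b} → a ∈ A → b ∈ A → colour a ≡ colour b → a ≡ b
    same-colour {a} {b} a∈ b∈ eq with a Fin.≟ b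
    ... | yes a≡b = a≡b
    ... | no a≢b = contradiction eq (proper (clique c a∈ b∈ a≢b))

    -- The anchors are pairwise adjacent, so anchors of one colour coincide; the `local` colours of
    -- `t` occur nowhere yet, because `t` is new.
    γ-injective : ∀ {i j} → γ i ≡ γ j → i ≡ j
    γ-injective {i} {j} eq with class-of i | class-of j
    ... | anchored a∈ _ κa p | anchored b∈ _ κb q =
      trans (sym κa) (trans (cong κ (same-colour a∈ b∈ (trans (sym p) (trans eq q)))) κb)
    ... | anchored _ _ _ p | fresh _ q = contradiction (local-only (trans (sym p) (trans eq q))) t∉T
    ... | fresh _ p | anchored _ _ _ q = contradiction (local-only (trans (sym q) (trans (sym eq) p))) t∉T
    ... | fresh _ p | fresh _ q = proj₂ (local-injective (trans (sym p) (trans eq q)))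

    γ-own : ∀ {j g} → γ j ≡ own g → Touched (t ∷ T) g
    γ-own {j} eq with class-of j
    ... | fresh _ p = contradiction (trans (sym eq) p) own≢local
    ... | anchored _ ta _ p with own-only (trans (sym p) eq)
    ...   | inj₁ refl = t , here refl , ta
    ...   | inj₂ (s , s∈ , sg) = s , there s∈ , sg

    γ-local : ∀ {j s i} → γ j ≡ local s i → s ∈ t ∷ T
    γ-local {j} eq with class-of j
    ... | fresh _ p = here (sym (proj₁ (local-injective (trans (sym p) eq))))
    ... | anchored _ _ _ p = there (local-only (trans (sym p) eq))

    no-link : ∀ {k l s} → s ∈ T → Adj t k → Adj k l → Adj s l → k ∉ A → l ∉ A → ⊥
    no-link s∈ tk kl sl k∉ l∉ = proj₂ (apart-T s∈)
      ((off c , k∉ , tk) ◅ (k∉ , l∉ , kl) ◅ (l∉ , proj₁ (apart-T s∈) , adj-sym sl) ◅ ε)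

    -- Let `a` be the anchor whose colour `k` receives. If `l` is an anchor of that colour, it is
    -- `a`, a neighbour of `t`; if `k` is an anchor, it is `a` and keeps its colour. Otherwise a
    -- clash forces `l` to be a neighbour of an earlier centre, and `k` and `l` form a chain to that
    -- centre avoiding all anchors.
    γ-proper : ∀ {k l} → Adj t k → ¬ Adj t l → Adj k l → γ (κ k) ≢ colour l
    γ-proper {k} {l} tk ¬tl kl eq with class-of (κ k)
    ... | fresh _ p = t∉T (local-only (trans (sym eq) p))
    ... | anchored {a} a∈ ta κa p with l ∈? A | k ∈? A
    ...   | yes l∈ | _ = ¬tl (subst (Adj t) (same-colour a∈ l∈ (trans (sym p) eq)) ta)
    ...   | no _ | yes k∈ with refl ← same-class a∈ k∈ ta tk κa = proper kl (trans (sym p) eq)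
    γ-proper {k} {l} tk ¬tl kl eq | anchored {a} a∈ ta κa p | no l∉ | no k∉ = [ by-own , by-touch ]′ (untouched l)
      where
      by-touch : Touched T l → ⊥
      by-touch (s , s∈ , sl) = no-link s∈ tk kl sl k∉ l∉
      by-own : colour l ≡ own l → ⊥
      by-own plain with own-only (trans (sym p) (trans eq plain))
      ... | inj₁ refl = l∉ a∈
      ... | inj₂ touch = by-touch touch

    -- A common neighbour of `t` and an earlier centre must be an anchor, since otherwise it links
    -- them; and the colours of anchors are kept.
    γ-agrees : ∀ {s k} → s ∈ T → Adj s k → Adj t k → γ (κ k) ≡ colour k
    γ-agrees {s} {k} s∈ sk tk with k ∈? A
    ... | no k∉ = ⊥-elim (proj₂ (apart-T s∈) ((off c , k∉ , tk) ◅ (k∉ , proj₁ (apart-T s∈) , adj-sym sk) ◅ ε))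
    ... | yes k∈ with class-of (κ k)
    ...   | anchored a∈ ta κa p with refl ← same-class a∈ k∈ ta tk κa = p
    ...   | fresh none _ = contradiction refl (none k∈ tk)

    coloured : Coloured (map centre (c ∷ cs))
    coloured = Extend.extended old t∉T γ γ-injective γ-own γ-local γ-proper γ-agrees

  coloured-cells : ∀ {cs} → AllPairs Apart cs → Coloured (map centre cs)
  coloured-cells [] = uncoloured
  coloured-cells {c ∷ _} (apart ∷ rest) = Step.coloured (coloured-cells rest) c apart

  many-separated : ∀ {cs} → AllPairs Apart cs → ManyCovers (length cs)
  many-separated {cs} apart = subst ManyCovers (length-map centre cs) (many telling)
    where
    Unlinked : Cell → Cell → Set
    Unlinked c d = centre c ≢ centre d × ¬ Adj (centre c) (centre d)
    unlinked : ∀ c d → Apart c d → Unlinked c d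
    unlinked c d (d∉ , no-chain) = (λ eq → no-chain (subst (Star (Off (anchors c)) (centre c)) eq ε)) ,
      λ cd → no-chain ((off c , d∉ , cd) ◅ ε)
    pairs : AllPairs (λ s t → s ≢ t × ¬ Adj s t) (map centre cs)
    pairs = AllPairs.map⁺ (AllPairs.map (λ {c} {d} → unlinked c d) apart)
    independent : ∀ {s t} → s ∈ map centre cs → t ∈ map centre cs → ¬ Adj s t
    independent {s} {t} s∈ t∈ st with s Fin.≟ t
    ... | yes refl = adj-irrefl st
    ... | no s≢t = proj₂ (allPairs-∈ (λ (≢ , ¬adj) → ≢ ∘ sym , ¬adj ∘ adj-sym) pairs s∈ t∈ s≢t) st
    open Switched (coloured-cells apart) independent (AllPairs.map proj₁ pairs)
    telling : ∀ i → Telling i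
    telling i with c , _ , eq ← ∈-map⁻ centre (∈-lookup {xs = map centre cs} i) =
      telling-onto i (proj₂ (proj₂ (colour-face _)) (subst Rich (sym eq) (rich c)))

allPairs-reverse : {A : Set} {R : A → A → Set} {xs : List A} → AllPairs R xs → AllPairs (λ x y → R y x) (List.reverse xs)
allPairs-reverse [] = []
allPairs-reverse {R = R} {x ∷ xs} (r ∷ rs) = subst (AllPairs (λ x y → R y x)) (sym (unfold-reverse x xs))
  (AllPairs.++⁺ (allPairs-reverse rs) ([] ∷ []) (All.tabulate λ y∈ → All.lookup r (Any.reverse⁻ y∈) ∷ []))

-- Recolouring the neighbours of a face

module Recolouring {n : ℕ} (G : Graph n) (cubic : Cubic G) (bridgeless : Bridgeless G)
                   (M : Embedding G) (rep : RepresentativityAtLeast G M 4) (x : Flag G) where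
  open Separated G cubic bridgeless M rep public
  open Around x public

  hub : Fin φ
  hub = face x

  private
    kf : (ℕ → Fin 3) → Fin φ → Fin φ → Fin 3
    kf col = update Fin._≟_ hub (col ∘ pos) κ-rich

    kf-proper : ∀ {col} → Proper S col → ∀ g → LinkColouring g (kf col g)
    kf-proper {col} proper g with g Fin.≟ hub
    ... | yes refl = linkColouring col proper
    ... | no _ = proj₁ (proj₂ (colour-face g))

  module Hub (col : ℕ → Fin 3) (col-proper : Proper S col) where
    private
      module Sw = Switching (kf col) (kf-proper col-proper)

    private
      coloured-hub : Sw.Coloured (hub ∷ [])
      coloured-hub = Sw.Extend.extended Sw.uncoloured (λ ()) (local hub) (proj₂ ∘ local-injective)
        (λ eq → contradiction (sym eq) own≢local) (λ eq → here (sym (proj₁ (local-injective eq))))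
        (λ _ _ _ eq → own≢local (sym eq)) (λ ())

      independent : ∀ {s t} → s ∈ hub ∷ [] → t ∈ hub ∷ [] → ¬ Adj s t
      independent (here refl) (here refl) = adj-irrefl

      module S₁ = Sw.Switched coloured-hub independent ([] ∷ [])

      hub-switched : S₁.switched (true ∷ []) hub ≡ true
      hub-switched = S₁.switched-lookup (true ∷ []) zero refl

      kf-hub : ∀ g → kf col hub g ≡ col (pos g)
      kf-hub g = cong (λ κ → κ g) (update-at Fin._≟_ hub (col ∘ pos) κ-rich)

    -- A face may occur several times on the walk; its colour is read at its representative position
    -- in `S`.
    shade : ℕ → Fin 3
    shade i = col (pos (w i))

    shade-step : ∀ i → shade i ≢ shade (suc i)
    shade-step i = linkColouring col col-proper (adj-w i) (adj-w (suc i)) (adj-next (ring x i))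

    abstract
      cover : List (Subgraph G)
      cover = S₁.Family.cover (true ∷ [])

      cover-double : IsCircuitDoubleCover G cover
      cover-double = S₁.Family.switched-cover (true ∷ [])

      straight⁺ : ∀ i → shade (2 + i) ≡ shade i → Covers cover (ring x i) (ring x (1 + i)) (ring x (2 + i))
      straight⁺ i eq = S₁.straight⁺ (true ∷ []) (here refl) hub-switched (ring x i) (face-ring x i)
        (trans (kf-hub (w (2 + i))) (trans eq (sym (kf-hub (w i)))))

      straight⁻ : ∀ i → Covers cover (ring x i) (ring x (1 + i)) (ring x (2 + i)) → shade (2 + i) ≡ shade i
      straight⁻ i straight = trans (sym (kf-hub (w (2 + i)))) (trans
        (S₁.straight⁻ (true ∷ []) (here refl) hub-switched (ring x i) (face-ring x i) straight)
        (kf-hub (w i)))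

  0∈S : 0 ∈ S
  0∈S = S⁺ size>0 λ ()

  -- The neighbours at positions 0 and 1 are adjacent, hence different faces; for the same reason
  -- the walk has more than one step.
  1∈S : 1 ∈ S
  1∈S = S⁺ 1<size λ { {zero} _ eq → adj-irrefl (subst (λ g → Adj g (w 1)) eq (adj-next x)) ; {suc _} (s≤s ()) _ }
    where
    1<size : 1 < size
    1<size with ℕ.<-cmp 1 size
    ... | tri< 1<size _ _ = 1<size
    ... | tri≈ _ 1≡size _ = contradiction
      (subst (λ y → Adj (w 0) (opp y)) (trans (cong (ring x) 1≡size) ring-size) (adj-next x)) adj-irrefl
    ... | tri> _ _ size<1 = contradiction (ℕ.<-≤-trans size>0 (s≤s⁻¹ size<1)) λ ()

  -- Whether consecutive edges of the hub lie on a common circuit determines the colouring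
  -- from the colours at positions 0 and 1.
  module _ (col col′ : ℕ → Fin 3) (p : Proper S col) (p′ : Proper S col′) where
    private
      module H = Hub col p
      module H′ = Hub col′ p′

    rigid : H.cover ↭ H′.cover → col 0 ≡ col′ 0 → col 1 ≡ col′ 1 → ∀ {i} → i ∈ S → col i ≡ col′ i
    rigid alike eq₀ eq₁ {i} i∈ = subst (λ i → col i ≡ col′ i) (pos-w i∈) (proj₁ (go i))
      where
      -- Two consecutive shades are carried along. The next one either repeats the first of them,
      -- which the cover shows, or is the one colour different from both.
      go : ∀ i → H.shade i ≡ H′.shade i × H.shade (suc i) ≡ H′.shade (suc i)
      go zero = subst (λ i → col i ≡ col′ i) (sym (pos-w 0∈S)) eq₀ , subst (λ i → col i ≡ col′ i) (sym (pos-w 1∈S)) eq₁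
      go (suc i) with e₀ , e₁ ← go i = e₁ , next-shade
        where
        transfer : H.shade (2 + i) ≡ H.shade i → H′.shade (2 + i) ≡ H′.shade i
        transfer eq = H′.straight⁻ i (covers-resp-↭ {x = ring x i} {ring x (1 + i)} {ring x (2 + i)} alike (H.straight⁺ i eq))
        transfer′ : H′.shade (2 + i) ≡ H′.shade i → H.shade (2 + i) ≡ H.shade i
        transfer′ eq = H.straight⁻ i (covers-resp-↭ {x = ring x i} {ring x (1 + i)} {ring x (2 + i)} (↭-sym alike) (H′.straight⁺ i eq))
        next-shade : H.shade (2 + i) ≡ H′.shade (2 + i)
        next-shade with H.shade (2 + i) Fin.≟ H.shade i
        ... | yes eq = trans eq (trans e₀ (sym (transfer eq)))
        ... | no bent = third-unique (H.shade i) (H.shade (1 + i)) _ _ (H.shade-step i) bent (H.shade-step (1 + i) ∘ sym)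
          (λ eq → bent (transfer′ (trans eq e₀))) (λ eq → H′.shade-step (1 + i) (sym (trans eq e₁)))

  -- Demanded for every proper colouring, so that changes in disjoint sets can be applied one after
  -- another.
  Flippable : List ℕ → Set
  Flippable B = ∀ col → Proper S col → ∃[ col′ ] (Proper S col′ ×
    (∀ {i} → i ∉ B → col′ i ≡ col i) × ∃[ i ] (i ∈ B × i ∈ S × col′ i ≢ col i))

  Flips : Set
  Flips = List (∃ Flippable)

  choose : (Bs : Flips) → Vec Bool (length Bs) → ∃ (Proper S)
  choose [] [] = S-colouring
  choose (_ ∷ Bs) (false ∷ b) = choose Bs b
  choose ((_ , flip) ∷ Bs) (true ∷ b) with col , proper ← choose Bs b
    with col′ , proper′ , _ ← flip col proper = col′ , proper′

  choose-head : ∀ {B} (flip : Flippable B) Bs s b {i} → i ∉ B →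
    proj₁ (choose ((B , flip) ∷ Bs) (s ∷ b)) i ≡ proj₁ (choose Bs b) i
  choose-head flip Bs false b i∉ = refl
  choose-head flip Bs true b i∉ = proj₁ (proj₂ (proj₂ (flip _ (proj₂ (choose Bs b))))) i∉

  choose-fixed : ∀ Bs b {i} → All (λ B → i ∉ proj₁ B) Bs → proj₁ (choose Bs b) i ≡ proj₁ S-colouring i
  choose-fixed [] [] [] = refl
  choose-fixed ((B , flip) ∷ Bs) (s ∷ b) (i∉ ∷ rest) = trans (choose-head flip Bs s b i∉) (choose-fixed Bs b rest)

  Disjoint : ∃ Flippable → ∃ Flippable → Set
  Disjoint (B , _) (B′ , _) = ∀ {i} → i ∈ B′ → i ∉ B

  -- A difference produced by the later sets survives, because the change in `B` does not touch
  -- them; if the later bits agree, the first bit alone makes a difference inside `B`.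
  choose-differ : ∀ Bs → AllPairs Disjoint Bs → ∀ b b′ → b ≡ b′ ⊎
    ∃[ i ] (i ∈ S × Any (λ B → i ∈ proj₁ B) Bs × proj₁ (choose Bs b) i ≢ proj₁ (choose Bs b′) i)
  choose-differ [] _ [] [] = inj₁ refl
  choose-differ ((B , flip) ∷ Bs) (disjoint ∷ rest) (s ∷ b) (s′ ∷ b′) with choose-differ Bs rest b b′
  ... | inj₂ (i , i∈S , i∈ , ≢) = inj₂ (i , i∈S , there i∈ , λ eq → ≢
    (trans (sym (choose-head flip Bs s b i∉)) (trans eq (choose-head flip Bs s′ b′ i∉))))
    where
    i∉ : i ∉ B
    i∉ = All.lookupWith (λ disj i∈B′ → disj i∈B′) disjoint i∈
  ... | inj₁ refl with s | s′
  ...   | true | true = inj₁ refl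
  ...   | false | false = inj₁ refl
  ...   | true | false with _ , _ , _ , i , i∈ , i∈S , ≢ ← flip _ (proj₂ (choose Bs b)) = inj₂ (i , i∈S , here i∈ , ≢)
  ...   | false | true with _ , _ , _ , i , i∈ , i∈S , ≢ ← flip _ (proj₂ (choose Bs b)) = inj₂ (i , i∈S , here i∈ , ≢ ∘ sym)

  chosen : (Bs : Flips) → Vec Bool (length Bs) → List (Subgraph G)
  chosen Bs b = Hub.cover (proj₁ (choose Bs b)) (proj₂ (choose Bs b))

  -- No change touches positions 0 and 1, so all colourings agree there and `rigid` turns equal
  -- covers into equal colourings on `S`.
  many-flips : ∀ Bs → AllPairs Disjoint Bs → All (λ B → All (1 <_) (proj₁ B)) Bs → ManyCovers (length Bs)
  many-flips Bs disjoint late =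
    family (chosen Bs) (λ b → Hub.cover-double (proj₁ (choose Bs b)) (proj₂ (choose Bs b))) distinct
    where
    fixed : ∀ b i → i ≤ 1 → proj₁ (choose Bs b) i ≡ proj₁ S-colouring i
    fixed b i i≤1 = choose-fixed Bs b (All.map (λ late i∈ → ℕ.<⇒≱ (All.lookup late i∈) i≤1) late)
    distinct : ∀ b b′ → Differ b b′ → ¬ (chosen Bs b ↭ chosen Bs b′)
    distinct b b′ (j , ≢) alike with choose-differ Bs disjoint b b′
    ... | inj₁ refl = ≢ refl
    ... | inj₂ (i , i∈S , _ , ≢′) = ≢′ (rigid (proj₁ (choose Bs b)) (proj₁ (choose Bs b′)) (proj₂ (choose Bs b)) (proj₂ (choose Bs b′)) alike
      (trans (fixed b 0 z≤n) (sym (fixed b′ 0 z≤n)))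
      (trans (fixed b 1 ℕ.≤-refl) (sym (fixed b′ 1 ℕ.≤-refl))) i∈S)

-- Windows on the boundary walk of a face with many neighbours

module Windows {n : ℕ} (G : Graph n) (cubic : Cubic G) (bridgeless : Bridgeless G)
               (M : Embedding G) (rep : RepresentativityAtLeast G M 4) (x : Flag G) where
  open Recolouring G cubic bridgeless M rep x public

  record Window : Set where
    field
      a b c d : ℕ
      a∈ : a ∈ S
      b∈ : b ∈ S
      c∈ : c ∈ S
      d∈ : d ∈ S
      a<b : a < b
      b<c : b < c
      c<d : c < d
      late : 1 < a
      consecutive : ∀ {s} → s ∈ S → s ≤ a ⊎ s ≡ b ⊎ s ≡ c ⊎ d ≤ s

  open Window

  Before : Window → Window → Set
  Before W W′ = d W < a W′

  -- `L` is an upper end of `S`. Windows are cut off such ends, which makes their four positions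
  -- consecutive in `S`.
  Splits : List ℕ → Set
  Splits L = ∀ {s} → s ∈ S → All (s <_) L ⊎ s ∈ L

  splits-tail : ∀ {a L} → All (a <_) L → Splits (a ∷ L) → Splits L
  splits-tail a<L split s∈ with split s∈
  ... | inj₁ (_ ∷ s<L) = inj₁ s<L
  ... | inj₂ (here refl) = inj₁ a<L
  ... | inj₂ (there s∈L) = inj₂ s∈L

  consecutive-head : ∀ {a b c d L} → All (d <_) L → Splits (a ∷ b ∷ c ∷ d ∷ L) →
    ∀ {s} → s ∈ S → s ≤ a ⊎ s ≡ b ⊎ s ≡ c ⊎ d ≤ s
  consecutive-head d<L split s∈ with split s∈
  ... | inj₁ (s<a ∷ _) = inj₁ (ℕ.<⇒≤ s<a)
  ... | inj₂ (here refl) = inj₁ ℕ.≤-refl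
  ... | inj₂ (there (here refl)) = inj₂ (inj₁ refl)
  ... | inj₂ (there (there (here refl))) = inj₂ (inj₂ (inj₁ refl))
  ... | inj₂ (there (there (there (here refl)))) = inj₂ (inj₂ (inj₂ ℕ.≤-refl))
  ... | inj₂ (there (there (there (there s∈L)))) = inj₂ (inj₂ (inj₂ (ℕ.<⇒≤ (All.lookup d<L s∈L))))

  windows : ∀ L → AllPairs _<_ L → All (_∈ S) L → All (1 <_) L → Splits L →
    ∀ k → k * 4 ≤ length L → ∃[ Ws ] (length Ws ≡ k × AllPairs Before Ws × All (λ W → a W ∈ L) Ws)
  windows L _ _ _ _ zero _ = [] , refl , [] , []
  windows (a ∷ b ∷ c ∷ d ∷ L) ((a<b ∷ a<L) ∷ (b<c ∷ b<L) ∷ (c<d ∷ c<L) ∷ d<L ∷ sorted)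
      (a∈ ∷ b∈ ∷ c∈ ∷ d∈ ∷ L∈) (1<a ∷ _ ∷ _ ∷ _ ∷ late) split (suc k) (s≤s (s≤s (s≤s (s≤s le))))
    with Ws , len , before , start ← windows L sorted L∈ late
           (splits-tail d<L (splits-tail (c<d ∷ c<L) (splits-tail (b<c ∷ b<L) (splits-tail (a<b ∷ a<L) split)))) k le =
    W ∷ Ws , cong suc len , All.map (All.lookup d<L) start ∷ before , here refl ∷ All.map (there ∘ there ∘ there ∘ there) start
    where
    W : Window
    W = record { a = a ; b = b ; c = c ; d = d ; a∈ = a∈ ; b∈ = b∈ ; c∈ = c∈ ; d∈ = d∈ ; a<b = a<b ; b<c = b<c ; c<d = c<d
               ; late = 1<a ; consecutive = consecutive-head d<L split }

  -- `w p` has the adjacent neighbours `hub` and `w (suc p)`; any further neighbour would make it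
  -- rich.
  poor-neighbour : ∀ p {s} → ¬ Rich (w p) → s ∈ S → E p s → s ≡ pos (w (suc p))
  poor-neighbour p {s} poor s∈ ps with w s Fin.≟ w (suc p)
  ... | yes eq = trans (sym (pos-w s∈)) (cong pos eq)
  ... | no ≢ = contradiction (hub , w (suc p) , w s , adj-sym (adj-w p) , adj-next (ring x p) , ps , adj-w (suc p) , w≢ s , ≢) poor

  flip-one : ∀ {p} → p ∈ S → ¬ Rich (w p) → Flippable (p ∷ [])
  flip-one {p} p∈ poor col proper with c , c≢p , c≢q ← third (col p) (col (pos (w (suc p)))) =
    col′ , proper′ , (λ i∉ → update-off ℕ._≟_ c col (i∉ ∘ here)) ,
    p , here refl , p∈ , c≢p ∘ trans (sym (update-at ℕ._≟_ p c col))
    where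
    col′ : ℕ → Fin 3
    col′ = update ℕ._≟_ p c col
    beside : ∀ {s} → s ∈ S → E p s → c ≢ col s
    beside s∈ ps eq = c≢q (trans eq (cong col (poor-neighbour p poor s∈ ps)))
    proper′ : Proper S col′
    proper′ {s} {s′} s∈ s′∈ ss′ with s ℕ.≟ p | s′ ℕ.≟ p
    ... | yes refl | yes refl = contradiction ss′ adj-irrefl
    ... | yes refl | no _ = beside s′∈ ss′
    ... | no _ | yes refl = beside s∈ (adj-sym ss′) ∘ sym
    ... | no _ | no _ = proper s∈ s′∈ ss′

  -- The path from `a` over `b` and `c` to `d` carries all adjacencies of `b` and `c`. First `b`
  -- gets a colour different from its own and that of `a`; then a colour avoiding `d` and the new
  -- `b` is left for `c`, and need not be new.
  flip-two : ∀ {a b c d} → b ∈ S → (∀ {s} → s ∈ S → E b s → s ≡ a ⊎ s ≡ c) → (∀ {s} → s ∈ S → E c s → s ≡ b ⊎ s ≡ d) →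
    Flippable (b ∷ c ∷ [])
  flip-two {a} {b} {c} {d} b∈ near-b near-c col proper
    with β , β≢a , β≢b ← third (col a) (col b)
    with γ , γ≢d , γ≢β ← third (col d) β =
    col′ , proper′ , (λ i∉ → trans (update-off ℕ._≟_ β col₁ (i∉ ∘ here)) (update-off ℕ._≟_ γ col (i∉ ∘ there ∘ here))) ,
    b , here refl , b∈ , β≢b ∘ trans (sym (update-at ℕ._≟_ b β col₁))
    where
    col₁ col′ : ℕ → Fin 3
    col₁ = update ℕ._≟_ c γ col
    col′ = update ℕ._≟_ b β col₁
    proper₁ : ∀ {s s′} → s ∈ S → s′ ∈ S → s ≢ b → s′ ≢ b → E s s′ → col₁ s ≢ col₁ s′
    proper₁ {s} {s′} s∈ s′∈ s≢b s′≢b ss′ with s ℕ.≟ c | s′ ℕ.≟ c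
    ... | yes refl | yes refl = contradiction ss′ adj-irrefl
    ... | no _ | no _ = proper s∈ s′∈ ss′
    ... | yes refl | no _ = case near-c s′∈ ss′ of λ where
      (inj₁ eq) → contradiction eq s′≢b
      (inj₂ refl) → γ≢d
    ... | no _ | yes refl = case near-c s∈ (adj-sym ss′) of λ where
      (inj₁ eq) → contradiction eq s≢b
      (inj₂ refl) → γ≢d ∘ sym
    beside-b : ∀ {s} → s ∈ S → E b s → β ≢ col₁ s
    beside-b {s} s∈ bs with s ℕ.≟ c
    ... | yes _ = γ≢β ∘ sym
    ... | no s≢c = case near-b s∈ bs of λ where
      (inj₁ refl) → β≢a
      (inj₂ eq) → contradiction eq s≢c
    proper′ : Proper S col′
    proper′ {s} {s′} s∈ s′∈ ss′ with s ℕ.≟ b | s′ ℕ.≟ b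
    ... | yes refl | yes refl = contradiction ss′ adj-irrefl
    ... | yes refl | no _ = beside-b s′∈ ss′
    ... | no _ | yes refl = beside-b s∈ (adj-sym ss′) ∘ sym
    ... | no s≢b | no s′≢b = proper₁ s∈ s′∈ s≢b s′≢b ss′

  record Tri : Set where
    field
      u t v : ℕ
      u∈ : u ∈ S
      t∈ : t ∈ S
      v∈ : v ∈ S
      uv : E u v
      rich-t : Rich (w t)
      t≢u : t ≢ u
      t≢v : t ≢ v

  open Tri

  w-apart : ∀ {i j} → i ∈ S → j ∈ S → i ≢ j → w i ≢ w j
  w-apart i∈ j∈ i≢j eq = i≢j (S-injective i∈ j∈ eq)

  cell : Tri → Cell
  cell τ = record
    { centre = w (t τ) ; anchors = A ; clique = clique
    ; off = λ where
        (here eq) → w≢ (t τ) eq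
        (there (here eq)) → w-apart (t∈ τ) (u∈ τ) (t≢u τ) eq
        (there (there (here eq))) → w-apart (t∈ τ) (v∈ τ) (t≢v τ) eq
    ; rich = rich-t τ }
    where
    A = hub ∷ w (u τ) ∷ w (v τ) ∷ []
    clique : ∀ {p q} → p ∈ A → q ∈ A → p ≢ q → Adj p q
    clique (here refl) (here refl) p≢q = contradiction refl p≢q
    clique (here refl) (there (here refl)) _ = adj-w (u τ)
    clique (here refl) (there (there (here refl))) _ = adj-w (v τ)
    clique (there (here refl)) (here refl) _ = adj-sym (adj-w (u τ))
    clique (there (here refl)) (there (here refl)) p≢q = contradiction refl p≢q
    clique (there (here refl)) (there (there (here refl))) _ = uv τ
    clique (there (there (here refl))) (here refl) _ = adj-sym (adj-w (v τ))
    clique (there (there (here refl))) (there (here refl)) _ = adj-sym (uv τ)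
    clique (there (there (here refl))) (there (there (here refl))) p≢q = contradiction refl p≢q

  off-anchors : ∀ τ τ′ → t τ′ ≢ u τ → t τ′ ≢ v τ → w (t τ′) ∉ Cell.anchors (cell τ)
  off-anchors τ τ′ ≢u ≢v (here eq) = w≢ (t τ′) eq
  off-anchors τ τ′ ≢u ≢v (there (here eq)) = w-apart (t∈ τ′) (u∈ τ) ≢u eq
  off-anchors τ τ′ ≢u ≢v (there (there (here eq))) = w-apart (t∈ τ′) (v∈ τ) ≢v eq

  -- The centre lies on the arc between `u` and `v`, and the other centre before that arc.
  apart-right : ∀ τ τ′ → u τ < t τ → t τ < v τ → t τ′ < u τ → Apart (cell τ) (cell τ′)
  apart-right τ τ′ u<t t<v t′<u =
    off-anchors τ τ′ (ℕ.<⇒≢ t′<u) (ℕ.<⇒≢ (ℕ.<-trans t′<u u<v)) ,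
    λ chain → no-chain u<t t<v (inj₁ t′<u) (avoid (Cell.off (cell τ))) (Star.map (λ (k∉ , l∉ , kl) → avoid k∉ , avoid l∉ , kl) chain)
    where
    u<v = ℕ.<-trans u<t t<v
    open Separate u<v (S-size (v∈ τ)) (uv τ)
    avoid : ∀ {k} → k ∉ Cell.anchors (cell τ) → Avoid k
    avoid k∉ = k∉ ∘ here , k∉ ∘ there ∘ here , k∉ ∘ there ∘ there ∘ here

  apart-left : ∀ τ τ′ → t τ < u τ → v τ < t τ → u τ < t τ′ → Apart (cell τ) (cell τ′)
  apart-left τ τ′ t<u v<t u<t′ =
    off-anchors τ τ′ (ℕ.>⇒≢ u<t′) (ℕ.>⇒≢ (ℕ.<-trans v<u u<t′)) ,
    λ chain → no-chain v<t t<u (inj₂ (u<t′ , S-size (t∈ τ′))) (avoid (Cell.off (cell τ)))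
      (Star.map (λ (k∉ , l∉ , kl) → avoid k∉ , avoid l∉ , kl) chain)
    where
    v<u = ℕ.<-trans v<t t<u
    open Separate v<u (S-size (u∈ τ)) (adj-sym (uv τ))
    avoid : ∀ {k} → k ∉ Cell.anchors (cell τ) → Avoid k
    avoid k∉ = k∉ ∘ here , k∉ ∘ there ∘ there ∘ here , k∉ ∘ there ∘ here

  -- The triangle hub, w u, w v cuts w t off from all earlier windows (Rightward) or all later ones
  -- (Leftward); otherwise the colouring can be changed inside the window.
  Rightward Leftward Free : Window → Set
  Rightward W = ∃[ τ ] (a W ≤ u τ × u τ < t τ × t τ < v τ × t τ ≤ d W)
  Leftward W = ∃[ τ ] (u τ ≤ d W × t τ < u τ × v τ < t τ × a W ≤ t τ)
  Free W = Σ (∃ Flippable) λ B → All (λ i → a W ≤ i × i ≤ d W) (proj₁ B)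

  classify : ∀ W → Rightward W ⊎ Leftward W ⊎ Free W
  classify W with rich? (w (a W)) | rich? (w (b W)) | rich? (w (c W)) | rich? (w (d W))
  ... | no poor | _ | _ | _ = inj₂ (inj₂ ((_ , flip-one (a∈ W) poor) , (ℕ.≤-refl , a≤d) ∷ []))
    where a≤d = ℕ.<⇒≤ (ℕ.<-trans (a<b W) (ℕ.<-trans (b<c W) (c<d W)))
  ... | _ | no poor | _ | _ = inj₂ (inj₂ ((_ , flip-one (b∈ W) poor) , (ℕ.<⇒≤ (a<b W) , ℕ.<⇒≤ (ℕ.<-trans (b<c W) (c<d W))) ∷ []))
  ... | _ | _ | no poor | _ = inj₂ (inj₂ ((_ , flip-one (c∈ W) poor) , (ℕ.<⇒≤ (ℕ.<-trans (a<b W) (b<c W)) , ℕ.<⇒≤ (c<d W)) ∷ []))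
  ... | _ | _ | _ | no poor = inj₂ (inj₂ ((_ , flip-one (d∈ W) poor) , (a≤d , ℕ.≤-refl) ∷ []))
    where a≤d = ℕ.<⇒≤ (ℕ.<-trans (a<b W) (ℕ.<-trans (b<c W) (c<d W)))
  ... | yes rich-a | yes rich-b | yes rich-c | yes rich-d
    -- A chord from `b` or `c` that jumps over another position of the window makes, with `hub`, a
    -- triangle enclosing that position: `c` or `d` for chords to the right, `b` or `a` for chords
    -- to the left. Without such chords `b` sees only `a` and `c`, and `c` only `b` and `d`.
    with Any.any? (λ v → c W ℕ.<? v ×-dec adj? (w (b W)) (w v)) S
       | Any.any? (λ v → d W ℕ.<? v ×-dec adj? (w (c W)) (w v)) S
       | Any.any? (λ v → v ℕ.<? b W ×-dec adj? (w (c W)) (w v)) S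
       | Any.any? (λ v → v ℕ.<? a W ×-dec adj? (w (b W)) (w v)) S
  ... | yes found | _ | _ | _ with v , v∈ , c<v , bv ← find found = inj₁
    ( record { u = b W ; t = c W ; v = v ; u∈ = b∈ W ; t∈ = c∈ W ; v∈ = v∈ ; uv = bv ; rich-t = rich-c
             ; t≢u = ℕ.>⇒≢ (b<c W) ; t≢v = ℕ.<⇒≢ c<v }
    , ℕ.<⇒≤ (a<b W) , b<c W , c<v , ℕ.<⇒≤ (c<d W))
  ... | no _ | yes found | _ | _ with v , v∈ , d<v , cv ← find found = inj₁
    ( record { u = c W ; t = d W ; v = v ; u∈ = c∈ W ; t∈ = d∈ W ; v∈ = v∈ ; uv = cv ; rich-t = rich-d
             ; t≢u = ℕ.>⇒≢ (c<d W) ; t≢v = ℕ.<⇒≢ d<v }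
    , ℕ.<⇒≤ (ℕ.<-trans (a<b W) (b<c W)) , c<d W , d<v , ℕ.≤-refl)
  ... | no _ | no _ | yes found | _ with v , v∈ , v<b , cv ← find found = inj₂ (inj₁
    ( record { u = c W ; t = b W ; v = v ; u∈ = c∈ W ; t∈ = b∈ W ; v∈ = v∈ ; uv = cv ; rich-t = rich-b
             ; t≢u = ℕ.<⇒≢ (b<c W) ; t≢v = ℕ.>⇒≢ v<b }
    , ℕ.<⇒≤ (c<d W) , b<c W , v<b , ℕ.<⇒≤ (a<b W)))
  ... | no _ | no _ | no _ | yes found with v , v∈ , v<a , bv ← find found = inj₂ (inj₁
    ( record { u = b W ; t = a W ; v = v ; u∈ = b∈ W ; t∈ = a∈ W ; v∈ = v∈ ; uv = bv ; rich-t = rich-a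
             ; t≢u = ℕ.<⇒≢ (a<b W) ; t≢v = ℕ.>⇒≢ v<a }
    , ℕ.<⇒≤ (ℕ.<-trans (b<c W) (c<d W)) , a<b W , v<a , ℕ.≤-refl))
  classify W | yes _ | yes _ | yes _ | yes _ | no bR | no cR | no cL | no bL = inj₂ (inj₂
    ((_ , flip-two {a W} {b W} {c W} {d W} (b∈ W) near-b near-c) ,
     (ℕ.<⇒≤ (a<b W) , ℕ.<⇒≤ (ℕ.<-trans (b<c W) (c<d W))) ∷ (ℕ.<⇒≤ (ℕ.<-trans (a<b W) (b<c W)) , ℕ.<⇒≤ (c<d W)) ∷ []))
    where
    near-b : ∀ {s} → s ∈ S → E (b W) s → s ≡ a W ⊎ s ≡ c W
    near-b s∈ bs with consecutive W s∈
    ... | inj₁ s≤a = inj₁ (ℕ.≤-antisym s≤a (ℕ.≮⇒≥ λ s<a → bL (lose s∈ (s<a , bs))))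
    ... | inj₂ (inj₁ refl) = contradiction bs adj-irrefl
    ... | inj₂ (inj₂ (inj₁ eq)) = inj₂ eq
    ... | inj₂ (inj₂ (inj₂ d≤s)) = contradiction (lose s∈ (ℕ.<-≤-trans (c<d W) d≤s , bs)) bR
    near-c : ∀ {s} → s ∈ S → E (c W) s → s ≡ b W ⊎ s ≡ d W
    near-c s∈ cs with consecutive W s∈
    ... | inj₁ s≤a = contradiction (lose s∈ (ℕ.≤-<-trans s≤a (a<b W) , cs)) cL
    ... | inj₂ (inj₁ eq) = inj₁ eq
    ... | inj₂ (inj₂ (inj₁ refl)) = contradiction cs adj-irrefl
    ... | inj₂ (inj₂ (inj₂ d≤s)) = inj₂ (ℕ.≤-antisym (ℕ.≮⇒≥ λ d<s → cR (lose s∈ (d<s , cs))) d≤s)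

  module _ {X : Window → Set} (f : ∀ W → Maybe (X W)) where
    select : List Window → List (Σ Window X)
    select [] = []
    select (W ∷ Ws) with f W
    ... | just k = (W , k) ∷ select Ws
    ... | nothing = select Ws

    select-All : ∀ {P : Window → Set} {Ws} → All P Ws → All (P ∘ proj₁) (select Ws)
    select-All [] = []
    select-All {Ws = W ∷ _} (p ∷ ps) with f W
    ... | just _ = p ∷ select-All ps
    ... | nothing = select-All ps

    select-AllPairs : ∀ {R : Window → Window → Set} {Ws} → AllPairs R Ws → AllPairs (λ V W → R (proj₁ V) (proj₁ W)) (select Ws)
    select-AllPairs [] = []
    select-AllPairs {Ws = W ∷ _} (r ∷ rs) with f W
    ... | just _ = select-All r ∷ select-AllPairs rs
    ... | nothing = select-AllPairs rs

  right? : ∀ W → Maybe (Rightward W)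
  right? W = [ just , (λ _ → nothing) ]′ (classify W)

  left? : ∀ W → Maybe (Leftward W)
  left? W = [ (λ _ → nothing) , [ just , (λ _ → nothing) ]′ ]′ (classify W)

  free? : ∀ W → Maybe (Free W)
  free? W = [ (λ _ → nothing) , [ (λ _ → nothing) , just ]′ ]′ (classify W)

  length-select : ∀ Ws → length (select right? Ws) + (length (select left? Ws) + length (select free? Ws)) ≡ length Ws
  length-select [] = refl
  length-select (W ∷ Ws) with classify W
  ... | inj₁ _ = cong suc (length-select Ws)
  ... | inj₂ (inj₁ _) = trans (ℕ.+-suc _ _) (cong suc (length-select Ws))
  ... | inj₂ (inj₂ _) = trans (cong (λ k → length (select right? Ws) + k) (ℕ.+-suc _ _)) (trans (ℕ.+-suc _ _) (cong suc (length-select Ws)))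

  -- A rightward triangle separates its centre from the earlier windows, so the list is reversed:
  -- each cell must be apart from those after it.
  many-right : ∀ Ws → AllPairs Before Ws → ManyCovers (length (select right? Ws))
  many-right Ws before = subst ManyCovers (trans (length-map _ (List.reverse rights)) (length-reverse rights))
    (many-separated {map (cell ∘ proj₁ ∘ proj₂) (List.reverse rights)}
      (AllPairs.map⁺ (AllPairs.map (λ {V} {W} → apart V W) (allPairs-reverse (select-AllPairs right? before)))))
    where
    rights = select right? Ws
    apart : ∀ (V W : Σ Window Rightward) → Before (proj₁ W) (proj₁ V) → Apart (cell (proj₁ (proj₂ V))) (cell (proj₁ (proj₂ W)))
    apart (_ , τ , a≤u , u<t , t<v , _) (_ , τ′ , _ , _ , _ , t′≤d) d<a =
      apart-right τ τ′ u<t t<v (ℕ.<-≤-trans (ℕ.≤-<-trans t′≤d d<a) a≤u)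

  many-left : ∀ Ws → AllPairs Before Ws → ManyCovers (length (select left? Ws))
  many-left Ws before = subst ManyCovers (length-map _ lefts)
    (many-separated {map (cell ∘ proj₁ ∘ proj₂) lefts} (AllPairs.map⁺ (AllPairs.map (λ {V} {W} → apart V W) (select-AllPairs left? before))))
    where
    lefts = select left? Ws
    apart : ∀ (V W : Σ Window Leftward) → Before (proj₁ V) (proj₁ W) → Apart (cell (proj₁ (proj₂ V))) (cell (proj₁ (proj₂ W)))
    apart (_ , τ , u≤d , t<u , v<t , _) (_ , τ′ , _ , _ , _ , a≤t′) d<a =
      apart-left τ τ′ t<u v<t (ℕ.<-≤-trans (ℕ.≤-<-trans u≤d d<a) a≤t′)

  many-free : ∀ Ws → AllPairs Before Ws → ManyCovers (length (select free? Ws))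
  many-free Ws before = subst ManyCovers (length-map _ frees)
    (many-flips (map (proj₁ ∘ proj₂) frees) (AllPairs.map⁺ (AllPairs.map (λ {V} {W} → disjoint V W) (select-AllPairs free? before)))
      (All.map⁺ (All.tabulate λ {V} _ → All.map (λ (a≤i , _) → ℕ.<-≤-trans (late (proj₁ V)) a≤i) (proj₂ (proj₂ V)))))
    where
    frees = select free? Ws
    disjoint : ∀ (V W : Σ Window Free) → Before (proj₁ V) (proj₁ W) → Disjoint (proj₁ (proj₂ V)) (proj₁ (proj₂ W))
    disjoint V W d<a i∈W i∈V = ℕ.<⇒≱ d<a (ℕ.≤-trans (proj₁ (All.lookup (proj₂ (proj₂ W)) i∈W)) (proj₂ (All.lookup (proj₂ (proj₂ V)) i∈V)))

  -- The first two positions are dropped, so that all windows start after position 1, where the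
  -- colours must stay fixed. `xs` stands for the abstract list `S` and can be matched on.
  many-windows : ∀ r xs → xs ≡ S → 2 + r * 3 * 4 ≤ length xs → ∃[ Ws ] (length Ws ≡ r * 3 × AllPairs Before Ws)
  many-windows r (p ∷ q ∷ L) eq (s≤s (s≤s le)) with subst (AllPairs _<_) (sym eq) S-sorted
  ... | (p<q ∷ p<L) ∷ q<L ∷ sorted
    with Ws , len , before , _ ← windows L sorted (All.tabulate λ s∈ → subst (_ ∈_) eq (there (there s∈)))
           (All.map (ℕ.≤-<-trans (ℕ.≤-<-trans z≤n p<q)) q<L)
           (splits-tail q<L (splits-tail (p<q ∷ p<L) λ s∈ → inj₂ (subst (_ ∈_) (sym eq) s∈))) (r * 3) le = Ws , len , before

  -- Among `r * 3` windows of three kinds, one kind occurs at least `r` times. Each window takes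
  -- four positions, and two positions are dropped.
  many-neighbours : ∀ r → 2 + r * 3 * 4 ≤ length S → ∃[ k ] (r ≤ k × ManyCovers k)
  many-neighbours r le with Ws , len , before ← many-windows r S refl le
    with r ℕ.≤? length (select right? Ws) | r ℕ.≤? length (select left? Ws) | r ℕ.≤? length (select free? Ws)
  ... | yes r≤ | _ | _ = _ , r≤ , many-right Ws before
  ... | _ | yes r≤ | _ = _ , r≤ , many-left Ws before
  ... | _ | _ | yes r≤ = _ , r≤ , many-free Ws before
  ... | no r≰₁ | no r≰₂ | no r≰₃ = ⊥-elim (ℕ.<⇒≢ (begin-strict
      length (select right? Ws) + (length (select left? Ws) + length (select free? Ws))
        <⟨ ℕ.+-mono-< (ℕ.≰⇒> r≰₁) (ℕ.+-mono-< (ℕ.≰⇒> r≰₂) (ℕ.≰⇒> r≰₃)) ⟩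
      r + (r + r)
        ≡⟨ trans (cong (λ k → r + (r + k)) (sym (ℕ.+-identityʳ r))) (ℕ.*-comm 3 r) ⟩
      r * 3 ∎) (trans (length-select Ws) len))
    where open ℕ.≤-Reasoning

-- Faces that can be told apart after switching

module GoodFaces {n : ℕ} (G : Graph n) (cubic : Cubic G) (bridgeless : Bridgeless G)
                 (M : Embedding G) (rep : RepresentativityAtLeast G M 4) where
  open Separated G cubic bridgeless M rep public

  good? : ∀ t → Dec (Good t)
  good? t = anyFlag? λ z → opp z Fin.≟ t ×-dec ¬? (opp (next (next z)) Fin.≟ t)

  AtVertexOf : Fin φ → Flag G → Set
  AtVertexOf t y = ∃[ x ] (vertexOf x ≡ vertexOf y × face x ≡ t)

  -- If `t` is not good, an edge leaving the boundary of `t` ends on that boundary again: it is the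
  -- middle one of three consecutive edges, the first of them opposite to `t`, so the last is as
  -- well. The vertices on `t` are therefore closed under adjacency, and the surface is connected.
  not-good⇒everywhere : ∀ {t} → ¬ Good t → ∀ y → AtVertexOf t y
  not-good⇒everywhere {t} bad y with x₀ , face₀ ← face-base t = go (connected x₀ y) (x₀ , refl , face₀)
    where
    loops : ∀ z → opp z ≡ t → opp (next (next z)) ≡ t
    loops z opp-z with opp (next (next z)) Fin.≟ t
    ... | yes eq = eq
    ... | no ≢ = contradiction (z , opp-z , ≢) bad
    along-spoke : ∀ x → face x ≡ t → AtVertexOf t (τ₀ (τ₁ (τ₂ x)))
    along-spoke x eq = τ₂ (τ₁ (τ₀ (τ₁ (τ₂ x)))) , vertex-τ₁ (τ₀ (τ₁ (τ₂ x))) , subst (λ z → opp (next z) ≡ t) (cong τ₁ (τ₀-involutive (τ₂ x)))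
      (loops (τ₀ (τ₂ x)) (trans (opp-τ₀ (τ₂ x)) (trans (opp-τ₂ x) eq)))
    flip : ∀ {z} → AtVertexOf t (τ₀ z) → AtVertexOf t (τ₀ (τ₂ z))
    flip {z} (x , eq , eq′) = x , trans eq (cong vertexOf (sym (τ₀τ₂-comm z))) , eq′
    step₀ : ∀ y → AtVertexOf t y → AtVertexOf t (τ₀ y)
    step₀ y (x , eq , eq′) with atVertex x y eq
    ... | on = τ₀ x , refl , trans (face-τ₀ x) eq′
    ... | on₂ = flip {x} (τ₀ x , refl , trans (face-τ₀ x) eq′)
    ... | on₁ = τ₀ (τ₁ x) , refl , trans (face-τ₀ (τ₁ x)) (trans (face-τ₁ x) eq′)
    ... | on₂₁ = flip {τ₁ x} (τ₀ (τ₁ x) , refl , trans (face-τ₀ (τ₁ x)) (trans (face-τ₁ x) eq′))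
    ... | on₁₂ = along-spoke x eq′
    ... | on₂₁₂ = flip {τ₁ (τ₂ x)} (along-spoke x eq′)
    step : ∀ {a b} → τ₀ a ≡ b ⊎ τ₁ a ≡ b ⊎ τ₂ a ≡ b → AtVertexOf t a → AtVertexOf t b
    step {a} (inj₁ refl) here-t = step₀ a here-t
    step {a} (inj₂ (inj₁ refl)) (x , eq , eq′) = x , trans eq (sym (vertex-τ₁ a)) , eq′
    step (inj₂ (inj₂ refl)) here-t = here-t
    back : ∀ {a b} → τ₀ b ≡ a ⊎ τ₁ b ≡ a ⊎ τ₂ b ≡ a → τ₀ a ≡ b ⊎ τ₁ a ≡ b ⊎ τ₂ a ≡ b
    back (inj₁ refl) = inj₁ (τ₀-involutive _)
    back (inj₂ (inj₁ refl)) = inj₂ (inj₁ (τ₁-involutive _))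
    back (inj₂ (inj₂ refl)) = inj₂ (inj₂ (τ₂-involutive _))
    go : ∀ {a b} → EqClosure (λ a b → τ₀ a ≡ b ⊎ τ₁ a ≡ b ⊎ τ₂ a ≡ b) a b → AtVertexOf t a → AtVertexOf t b
    go ε here-t = here-t
    go (fwd s ◅ rest) here-t = go rest (step s here-t)
    go (bwd s ◅ rest) here-t = go rest (step (back s) here-t)

  -- A face that is not good meets every vertex, hence every other face is a neighbour of it.
  good : ∀ t → suc (length (neighbourhood t)) < φ → Good t
  good t few with good? t
  ... | yes is-good = is-good
  ... | no bad with k , k∉ ← fresh-element (t ∷ neighbourhood t) few
    with y , refl ← face-base k
    with x , eq , refl ← not-good⇒everywhere bad y
    with face-atVertex x y eq
  ... | inj₁ p = contradiction (here p) k∉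
  ... | inj₂ (inj₁ p) = contradiction (there (∈-neighbourhood (x , refl , sym p))) k∉
  ... | inj₂ (inj₂ p) = contradiction (there (∈-neighbourhood (τ₁ x , face-τ₁ x , sym p))) k∉

  opp-τ₁≢face : ∀ x → opp (τ₁ x) ≢ face x
  opp-τ₁≢face x eq = opp≢face (τ₁ x) (trans eq (sym (face-τ₁ x)))

  -- A fourth face is missing at the vertex of `x`, so it does not meet every vertex and is good.
  good-face : Flag G → 3 < φ → ∃ Good
  good-face x many with t , t∉ ← fresh-element (face x ∷ opp x ∷ opp (τ₁ x) ∷ []) many with good? t
  ... | yes is-good = t , is-good
  ... | no bad with y , eq , refl ← not-good⇒everywhere bad x with face-atVertex x y (sym eq)
  ...   | inj₁ p = contradiction (here p) t∉
  ...   | inj₂ (inj₁ p) = contradiction (there (here p)) t∉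
  ...   | inj₂ (inj₂ p) = contradiction (there (there (here p))) t∉

  vertex-τ₀ : ∀ x → vertexOf (τ₀ x) ≢ vertexOf x
  vertex-τ₀ ((e , false) , s) eq = loopless e (sym eq)
  vertex-τ₀ ((e , true) , s) eq = loopless e eq

  vertex-onEdge : ∀ x y → edgeOf x ≡ edgeOf y → vertexOf y ≡ vertexOf x ⊎ vertexOf y ≡ vertexOf (τ₀ x)
  vertex-onEdge x y eq with onEdge x y eq
  ... | at = inj₁ refl
  ... | at₀ = inj₂ refl
  ... | at₂ = inj₁ refl
  ... | at₂₀ = inj₂ refl

  module ThreeFaces (few : φ < 4) where

    -- The three faces at a vertex are pairwise different, so with at most three faces all of them
    -- occur at every vertex.
    at-every-vertex : ∀ x k → k ≡ face x ⊎ k ≡ opp x ⊎ k ≡ opp (τ₁ x)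
    at-every-vertex x k with Fin.pigeonhole few f
      where
      f : Fin 4 → Fin φ
      f zero = k
      f (suc zero) = face x
      f (suc (suc zero)) = opp x
      f (suc (suc (suc zero))) = opp (τ₁ x)
    ... | zero , suc zero , _ , eq = inj₁ eq
    ... | zero , suc (suc zero) , _ , eq = inj₂ (inj₁ eq)
    ... | zero , suc (suc (suc zero)) , _ , eq = inj₂ (inj₂ eq)
    ... | suc zero , suc (suc zero) , _ , eq = contradiction (sym eq) (opp≢face x)
    ... | suc zero , suc (suc (suc zero)) , _ , eq = contradiction (sym eq) (opp-τ₁≢face x)
    ... | suc (suc zero) , suc (suc (suc zero)) , _ , eq = contradiction (sym eq) (opp-τ₁≢opp x)
    ... | suc zero , suc zero , s≤s () , _
    ... | suc (suc zero) , suc zero , s≤s () , _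
    ... | suc (suc zero) , suc (suc zero) , s≤s (s≤s ()) , _
    ... | suc (suc (suc zero)) , suc zero , s≤s () , _
    ... | suc (suc (suc zero)) , suc (suc zero) , s≤s (s≤s ()) , _
    ... | suc (suc (suc zero)) , suc (suc (suc zero)) , s≤s (s≤s (s≤s ())) , _

    flag-in : ∀ x k → ∃[ y ] (vertexOf y ≡ vertexOf x × face y ≡ k)
    flag-in x k with at-every-vertex x k
    ... | inj₁ eq = x , refl , sym eq
    ... | inj₂ (inj₁ eq) = τ₂ x , refl , sym eq
    ... | inj₂ (inj₂ eq) = τ₂ (τ₁ x) , vertex-τ₁ x , sym eq

    flag-between : ∀ x {k l} → k ≢ l → ∃[ y ] (vertexOf y ≡ vertexOf x × face y ≡ k × opp y ≡ l)
    flag-between x {k} {l} k≢l with y , at-x , refl ← flag-in x k with at-every-vertex y l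
    ... | inj₁ eq = contradiction (sym eq) k≢l
    ... | inj₂ (inj₁ eq) = y , at-x , refl , sym eq
    ... | inj₂ (inj₂ eq) = τ₁ y , trans (vertex-τ₁ y) at-x , face-τ₁ y , sym eq

    -- The curve crosses two edges of a face at one vertex and an edge between the other two
    -- faces elsewhere; the vertex stays connected to the rest of the face along its third edge.
    module _ (x z : Flag G) (z≢near : vertexOf z ≢ vertexOf x) (z≢far : vertexOf z ≢ vertexOf (τ₀ (τ₁ (τ₂ x)))) where
      private
        s = τ₁ (τ₂ x)
        between = flag-between z {opp x} {opp (τ₁ x)} (opp-τ₁≢opp x ∘ sym)
        b = proj₁ between
        at-z : vertexOf b ≡ vertexOf z
        at-z = proj₁ (proj₂ between)
        face-b : face b ≡ opp x
        face-b = proj₁ (proj₂ (proj₂ between))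
        opp-b : opp b ≡ opp (τ₁ x)
        opp-b = proj₂ (proj₂ (proj₂ between))

        open Triangle x b (τ₂ (τ₁ x)) (sym face-b) opp-b (trans (opp-τ₂ (τ₁ x)) (face-τ₁ x)) (opp-τ₁≢face x ∘ sym)

        at-s : vertexOf s ≡ vertexOf x
        at-s = vertex-τ₁ (τ₂ x)

        s-open : ¬ Crossed (edgeOf s)
        s-open (inj₁ eq) = edge-τ₁ (τ₂ x) (sym eq)
        s-open (inj₂ (inj₂ eq)) = edge-τ₁ (τ₂ (τ₁ x)) (trans (sym eq) (sym (cong edgeOf (braid x))))
        s-open (inj₂ (inj₁ eq)) with vertex-onEdge s b eq
        ... | inj₁ p = z≢near (trans (sym at-z) (trans p at-s))
        ... | inj₂ p = z≢far (trans (sym at-z) p)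

        y = proj₁ (flag-in (τ₀ s) (face x))
        at-far : vertexOf y ≡ vertexOf (τ₀ s)
        at-far = proj₁ (proj₂ (flag-in (τ₀ s) (face x)))
        face-y : face y ≡ face x
        face-y = proj₂ (proj₂ (flag-in (τ₀ s) (face x)))
        y≢near : vertexOf y ≢ vertexOf x
        y≢near eq = vertex-τ₀ s (trans (sym at-far) (trans eq (sym at-s)))

        open Ring (τ₁ x)

        last = proj₁ (pred-ring 0 size>0)
        last<size : last < size
        last<size = proj₁ (proj₂ (pred-ring 0 size>0))
        ring-last : ring (τ₁ x) last ≡ τ₀ x
        ring-last = begin
          ring (τ₁ x) last                    ≡⟨ τ₀-involutive _ ⟨
          τ₀ (τ₀ (ring (τ₁ x) last))          ≡⟨ cong τ₀ (τ₁-involutive _) ⟨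
          τ₀ (τ₁ (next (ring (τ₁ x) last)))   ≡⟨ cong (τ₀ ∘ τ₁) (proj₂ (proj₂ (pred-ring 0 size>0))) ⟩
          τ₀ (τ₁ (τ₁ x))                      ≡⟨ cong τ₀ (τ₁-involutive x) ⟩
          τ₀ x                                ∎
          where open ≡-Reasoning
        ≤last : ∀ {i} → i < size → i ≤ last
        ≤last i<size = s≤s⁻¹ (ℕ.≤-trans i<size (ℕ.≮⇒≥ λ short →
          minimal (s≤s z≤n) short (proj₂ (proj₂ (pred-ring 0 size>0)))))

        open-at : ∀ k → 0 < k → k < last → Open {Crossed} k
        open-at k 0<k k<last = conn₀ λ where
          (inj₁ eq) → ring-distinct k<last last<size (trans eq (sym (cong edgeOf ring-last)))
          (inj₂ (inj₁ eq)) → case face-onEdge b (ring (τ₁ x) k) (sym eq) of λ where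
            (inj₁ p) → opp≢face x (sym (trans (sym (trans (face-ring (τ₁ x) k) (face-τ₁ x))) (trans p face-b)))
            (inj₂ p) → opp-τ₁≢face x (sym (trans (sym (trans (face-ring (τ₁ x) k) (face-τ₁ x))) (trans p opp-b)))
          (inj₂ (inj₂ eq)) → ring-distinct 0<k (ℕ.<-trans k<last last<size) (sym eq)

        to-last : ∀ i → 0 < i → i ≤ last → Conn Crossed (ring (τ₁ x) i) (τ₀ x)
        to-last i 0<i i≤last = subst (Conn Crossed (ring (τ₁ x) i)) ring-last
          (conn-between i≤last λ k i≤k k<last → open-at k (ℕ.<-≤-trans 0<i i≤k) k<last)

        conn-y : Conn Crossed y (τ₀ x)
        conn-y with onRing y (trans face-y (sym (face-τ₁ x)))
        ... | zero , _ , inj₁ eq = contradiction (trans (cong vertexOf eq) (vertex-τ₁ x)) y≢near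
        ... | suc i , i<size , inj₁ eq = subst (λ y → Conn Crossed y (τ₀ x)) (sym eq) (to-last (suc i) (s≤s z≤n) (≤last i<size))
        ... | i , i<size , inj₂ eq with i ℕ.≟ last
        ...   | yes refl = contradiction (cong vertexOf (trans eq (trans (cong τ₀ ring-last) (τ₀-involutive x)))) y≢near
        ...   | no i≢last = subst (λ y → Conn Crossed y (τ₀ x)) (sym eq)
                  (conn₁ ◅◅ to-last (suc i) (s≤s z≤n) (ℕ.≤∧≢⇒< (≤last i<size) i≢last))

      no-third-vertex : ⊥
      no-third-vertex = separated (conn₂ ◅◅ conn₁ ◅◅ conn₀ s-open ◅◅ conn-vertex (τ₀ s) y (sym at-far) ◅◅ conn-y)

  flag-at-vertex : ∀ v → ∃[ z ] vertexOf z ≡ v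
  flag-at-vertex v with _ , _ , _ , _ , _ , _ , a∈ , _ ← ∣∣≡3⁻ (incident G v) (cubic v)
    with z , _ , at-v ← flag-at (∈-incident⁻ a∈) = z , at-v

  -- A vertex other than that of `x` and the far end of its third edge supplies the edge at which
  -- the curve returns. On two vertices it is missing: three parallel edges in the sphere have three
  -- faces.
  four-faces : 2 < n → 3 < φ
  four-faces n>2 with φ ℕ.<? 4
  ... | no φ≮4 = ℕ.≮⇒≥ φ≮4
  ... | yes few with v , _ ← fresh-element {n} [] (ℕ.<-trans (s≤s z≤n) n>2)
    with x , _ ← flag-at-vertex v
    with v′ , v′∉ ← fresh-element (vertexOf x ∷ vertexOf (τ₀ (τ₁ (τ₂ x))) ∷ []) n>2
    with z , refl ← flag-at-vertex v′ =
    ⊥-elim (ThreeFaces.no-third-vertex few x z (v′∉ ∘ here) (v′∉ ∘ there ∘ here))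

  some-good-face : 2 < n → ∃ Good
  some-good-face n>2 with v , _ ← fresh-element {n} [] (ℕ.<-trans (s≤s z≤n) n>2)
    with x , _ ← flag-at-vertex v = good-face x (four-faces n>2)

-- Double counting, Euler's formula and the numerical bounds

indicator : Bool → ℕ
indicator true = 1
indicator false = 0

∣tabulate∣ : ∀ {k} (f : Fin k → Bool) → ∣ Vec.tabulate f ∣ ≡ sum (indicator ∘ f)
∣tabulate∣ {zero} f = refl
∣tabulate∣ {suc k} f with f zero
... | true = cong suc (∣tabulate∣ (f ∘ suc))
... | false = ∣tabulate∣ (f ∘ suc)

sum-const : ∀ k c → sum {k} (λ _ → c) ≡ k * c
sum-const zero c = refl
sum-const (suc k) c = cong (λ k → c + k) (sum-const k c)

sum-point : ∀ {k} (u : Fin k) → sum (λ v → indicator (does (u Fin.≟ v))) ≡ 1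
sum-point {suc k} zero = cong suc (trans (sum-const k 0) (ℕ.*-zeroʳ k))
sum-point {suc k} (suc u) = sum-point u

indicator-∨ : ∀ {P Q : Set} (P? : Dec P) (Q? : Dec Q) → (P → ¬ Q) →
  indicator (does P? ∨ does Q?) ≡ indicator (does P?) + indicator (does Q?)
indicator-∨ (yes p) (yes q) exclusive = contradiction q (exclusive p)
indicator-∨ (yes _) (no _) _ = refl
indicator-∨ (no _) (yes _) _ = refl
indicator-∨ (no _) (no _) _ = refl

handshake : ∀ {n} (G : Graph n) → Cubic G → n * 3 ≡ Graph.m G * 2
handshake {n} G cubic = begin
  n * 3                                                      ≡⟨ sum-const n 3 ⟨
  sum {n} (λ _ → 3)                                          ≡⟨ sum-cong-≗ cubic ⟨
  sum (λ v → ∣ incident G v ∣)                               ≡⟨ sum-cong-≗ (λ v → ∣tabulate∣ (incidence v)) ⟩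
  sum (λ v → sum (λ e → indicator (incidence v e)))          ≡⟨ ∑-comm (λ v e → indicator (incidence v e)) ⟩
  sum (λ e → sum (λ v → indicator (incidence v e)))          ≡⟨ sum-cong-≗ ends ⟩
  sum {m} (λ _ → 2)                                          ≡⟨ sum-const m 2 ⟩
  m * 2                                                      ∎
  where
  open ≡-Reasoning
  open Graph G
  incidence : Fin n → Fin m → Bool
  incidence v e = does ((src e Fin.≟ v) ⊎-dec (tgt e Fin.≟ v))
  ends : ∀ e → sum (λ v → indicator (incidence v e)) ≡ 2
  ends e = begin
    sum (λ v → indicator (incidence v e))
      ≡⟨ sum-cong-≗ (λ v → indicator-∨ (src e Fin.≟ v) (tgt e Fin.≟ v) λ p q → loopless e (trans p (sym q))) ⟩
    sum (λ v → indicator (does (src e Fin.≟ v)) + indicator (does (tgt e Fin.≟ v)))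
      ≡⟨ ∑-distrib-+ (λ v → indicator (does (src e Fin.≟ v))) (λ v → indicator (does (tgt e Fin.≟ v))) ⟩
    sum (λ v → indicator (does (src e Fin.≟ v))) + sum (λ v → indicator (does (tgt e Fin.≟ v)))
      ≡⟨ cong₂ _+_ (sum-point (src e)) (sum-point (tgt e)) ⟩
    2 ∎

euler : ∀ {n} (G : Graph n) → Cubic G → (M : Embedding G) →
  + n ℤ.+ + 2 ℤ.* eulerCharacteristic G M ≡ + (2 * Embedding.φ M)
euler {n} G cubic M = begin
  + n ℤ.+ + 2 ℤ.* (+ n ℤ.- + m ℤ.+ + φ)                   ≡⟨ rearrange (+ n) (+ m) (+ φ) ⟩
  (+ n ℤ.* + 3 ℤ.- + m ℤ.* + 2) ℤ.+ + 2 ℤ.* + φ            ≡⟨ cong (ℤ._+ + 2 ℤ.* + φ) (ℤ.i≡j⇒i-j≡0 three-halves) ⟩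
  + 0 ℤ.+ + 2 ℤ.* + φ                                        ≡⟨ ℤ.+-identityˡ _ ⟩
  + 2 ℤ.* + φ                                                ≡⟨ ℤ.pos-* 2 φ ⟨
  + (2 * φ)                                                  ∎
  where
  open ≡-Reasoning
  open Graph G
  open Embedding M using (φ)
  rearrange : ∀ n m φ → n ℤ.+ + 2 ℤ.* (n ℤ.- m ℤ.+ φ) ≡ (n ℤ.* + 3 ℤ.- m ℤ.* + 2) ℤ.+ + 2 ℤ.* φ
  rearrange = ℤ-Solver.solve-∀
  three-halves : + n ℤ.* + 3 ≡ + m ℤ.* + 2
  three-halves = trans (sym (ℤ.pos-* n 3)) (trans (cong +_ (handshake G cubic)) (ℤ.pos-* m 2))

-- Cubes are written as x ^ 3 unfolds.
cube-* : ∀ r d q → (r * (d * q)) * ((r * (d * q)) * ((r * (d * q)) * 1)) ≡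
  (r * (r * (r * 1))) * (d * (d * (d * 1))) * (q * (q * (q * 1)))
cube-* = ℕ-Solver.solve-∀

-- Half of 100³.  Kept abstract because products with the literal would unfold in unary.
abstract
  half-million : ℕ
  half-million = 500000

  half-million-doubled : half-million * 2 ≡ 100 ^ 3
  half-million-doubled = refl

  676≤half-million : 26 * 26 ≤ half-million
  676≤half-million = ℕ.≤ᵇ⇒≤ 676 500000 _

-- The largest number of faces for which `2 ^ r` covers suffice: the cube root of `2 * φ` is at most
-- `100 * r` iff `2 * φ` is at most `(100 * r) ^ 3`.
limit : ℕ → ℕ
limit r = r ^ 3 * half-million

≤-limit : ∀ k → k ≤ limit (suc k)
≤-limit k = ℕ.≤-trans (ℕ.n≤1+n k)
  (ℕ.≤-trans (ℕ.m≤m*n (suc k) (suc k ^ 2) ⦃ ℕ.m^n≢0 (suc k) 2 ⦄)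
    (ℕ.m≤m*n (suc k ^ 3) half-million ⦃ ℕ.>-nonZero (ℕ.<-≤-trans (s≤s z≤n) 676≤half-million) ⦄))

-- Comparing cubes bounds every admissible `p` by `k * (100 * q)`, and this is the comparison of
-- exponents that is wanted.
enough : ∀ {φ r k} → φ ≤ limit r → r ≤ k → 2^[∛ + (2 * φ) / 100 ]≤ (2 ^ k)
enough {φ} {r} {k} φ≤ r≤k p q _ le = ℕ.≤-trans (ℕ.^-monoʳ-≤ 2 p≤) (ℕ.≤-reflexive (sym (ℕ.^-*-assoc 2 k (100 * q))))
  where
  p³≤ : p ^ 3 ≤ 2 * φ * q ^ 3
  p³≤ = ℤ.drop‿+≤+ (subst (+ (p ^ 3) ℤ.≤_) (sym (ℤ.pos-* (2 * φ) (q ^ 3))) le)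
  2φ≤ : 2 * φ ≤ r ^ 3 * 100 ^ 3
  2φ≤ = begin
    2 * φ                     ≡⟨ ℕ.*-comm 2 φ ⟩
    φ * 2                     ≤⟨ ℕ.*-monoˡ-≤ 2 φ≤ ⟩
    r ^ 3 * half-million * 2  ≡⟨ ℕ.*-assoc (r ^ 3) half-million 2 ⟩
    r ^ 3 * (half-million * 2) ≡⟨ cong (r ^ 3 *_) half-million-doubled ⟩
    r ^ 3 * 100 ^ 3           ∎
    where open ℕ.≤-Reasoning
  p≤ : p ≤ k * (100 * q)
  p≤ = ℕ.≮⇒≥ λ k100q<p → ℕ.<⇒≱ (ℕ.^-monoˡ-< 3 k100q<p) (begin
    p ^ 3                         ≤⟨ p³≤ ⟩
    2 * φ * q ^ 3                 ≤⟨ ℕ.*-monoˡ-≤ (q ^ 3) 2φ≤ ⟩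
    r ^ 3 * 100 ^ 3 * q ^ 3       ≡⟨ cube-* r 100 q ⟨
    (r * (100 * q)) ^ 3           ≤⟨ ℕ.^-monoˡ-≤ 3 (ℕ.*-monoˡ-≤ (100 * q) r≤k) ⟩
    (k * (100 * q)) ^ 3           ∎)
    where open ℕ.≤-Reasoning

-- One less than the number of neighbours from which the windows give `suc (suc s)` independent
-- choices.
degree : ℕ → ℕ
degree s = 1 + suc (suc s) * 3 * 4

-- A ball of radius two has at most `D * D` faces with `D = 12 * s + 26`, which is at most
-- `26 * suc s`. The cube-root bound leaves ample room, as `26 * 26` is far below half of `100 ^ 3`.
greedy-room : ∀ s → suc s * (suc (degree s) * suc (degree s)) ≤ limit (suc s)
greedy-room s = begin
  t * (D * D)                 ≤⟨ ℕ.*-monoʳ-≤ t (ℕ.*-mono-≤ D≤ D≤) ⟩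
  t * (t * 26 * (t * 26))     ≡⟨ collect t 26 ⟩
  t ^ 3 * (26 * 26)           ≤⟨ ℕ.*-monoʳ-≤ (t ^ 3) 676≤half-million ⟩
  t ^ 3 * half-million        ∎
  where
  open ℕ.≤-Reasoning
  t = suc s
  D = suc (degree s)
  collect : ∀ t c → t * (t * c * (t * c)) ≡ t * (t * (t * 1)) * (c * c)
  collect = ℕ-Solver.solve-∀
  expand : ∀ s → 2 + (1 + (1 + s)) * 3 * 4 + 14 * s ≡ (1 + s) * 26
  expand = ℕ-Solver.solve-∀
  D≤ : D ≤ t * 26
  D≤ = ℕ.≤-trans (ℕ.m≤m+n D (14 * s)) (ℕ.≤-reflexive (expand s))

degree-room : ∀ s → suc (degree s) ≤ limit (suc s)
degree-room s = ℕ.≤-trans (ℕ.m≤m*n D D) (ℕ.≤-trans (ℕ.m≤n*m (D * D) (suc s)) (greedy-room s))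
  where D = suc (degree s)

-- Balancing many neighbours against distant faces

module Main {n : ℕ} (G : Graph n) (n≥4 : 4 ≤ n) (cubic : Cubic G) (bridgeless : Bridgeless G)
            (M : Embedding G) (rep : RepresentativityAtLeast G M 4) where
  open GoodFaces G cubic bridgeless M rep

  Enough : Set
  Enough = ∃[ r ] ∃[ k ] (φ ≤ limit r × r ≤ k × ManyCovers k)

  Crowded : ℕ → Fin φ → Set
  Crowded r f = 2 + r * 3 * 4 ≤ length (Around.S (base f))

  crowded : ∀ r f → φ ≤ limit r → Crowded r f → Enough
  crowded r f φ≤ le = r , proj₁ many , φ≤ , proj₂ many
    where many = Windows.many-neighbours G cubic bridgeless M rep (base f) r le

  one-face : φ ≤ limit 1 → ∃ Good → Enough
  one-face φ≤ (t , is-good) = 1 , 1 , φ≤ , ℕ.≤-refl , FarApart.many-far {t ∷ []} ([] ∷ []) good-t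
    where
    good-t : ∀ {s} → s ∈ t ∷ [] → Good s
    good-t (here refl) = is-good

  -- For positive `s`, minimality provides more than `limit s` faces, hence room for the greedy
  -- choice. For `s = 0` it provides none: two covers are wanted, and the one good face for them
  -- comes from the number of vertices.
  spread : ∀ s → φ ≤ limit (suc s) → (∀ {j} → j < s → ¬ φ ≤ limit (suc j)) →
    ¬ ∃ (Crowded (suc s)) →
    Enough
  spread zero φ≤ _ _ = one-face φ≤ (some-good-face (ℕ.≤-trans (s≤s (s≤s (s≤s z≤n))) n≥4))
  spread (suc s) φ≤ minimal few = switch-all (far-faces bound (suc s) (ℕ.≤-<-trans (greedy-room s) room))
    where
    room : limit (suc s) < φ
    room = ℕ.≰⇒> (minimal (ℕ.n<1+n s))
    bound : ∀ f → length (neighbourhood f) ≤ degree s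
    bound f = ℕ.≤-trans (ℕ.≤-reflexive (length-neighbourhood f)) (s≤s⁻¹ (ℕ.≰⇒> λ le → few (f , le)))
    all-good : ∀ t → Good t
    all-good t = good t (ℕ.≤-<-trans (s≤s (bound t)) (ℕ.≤-<-trans (degree-room s) room))
    switch-all : ∃[ T ] (length T ≡ suc (suc s) × AllPairs Far T) → Enough
    switch-all (T , len , far) =
      suc (suc s) , length T , φ≤ , ℕ.≤-reflexive (sym len) , FarApart.many-far {T} far (λ {t} _ → all-good t)

  -- The target exponent is the least positive `r` with `φ ≤ limit r`: it suffices for the bound,
  -- and below it the number of faces is known to exceed the limit.
  enough-covers : Enough
  enough-covers = by-size (least (λ s → φ ℕ.≤? limit (suc s)) φ (≤-limit φ))
    where
    by-size : ∃[ s ] (s ≤ φ × φ ≤ limit (suc s) × (∀ {j} → j < s → ¬ φ ≤ limit (suc j))) → Enough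
    by-size (s , _ , φ≤ , minimal) = by-degree (Fin.any? (λ f → 2 + suc s * 3 * 4 ℕ.≤? length (Around.S (base f))))
      where
      by-degree : Dec (∃ (Crowded (suc s))) → Enough
      by-degree (yes (f , le)) = crowded (suc s) f φ≤ le
      by-degree (no few) = spread s φ≤ minimal few

theorem21 : (n : ℕ) (G : Graph n) → 4 ≤ n → Cubic G → Bridgeless G →
    (χ : ℤ) (M : Embedding G) → eulerCharacteristic G M ≡ χ →
    RepresentativityAtLeast G M 4 →
    ∃[ Ds ] (DistinctCircuitDoubleCovers G Ds × 2^[∛ (+ n) ℤ.+ (+ 2) ℤ.* χ / 100 ]≤ length Ds)
theorem21 n G n≥4 cubic bridgeless χ M refl rep
  with r , k , φ≤ , r≤k , Ds , distinct , len ← Main.enough-covers G n≥4 cubic bridgeless M rep =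
  Ds , distinct , subst₂ (λ a N → 2^[∛ a / 100 ]≤ N) (sym (euler G cubic M)) (sym len) (enough φ≤ r≤k)
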